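{- For every real $\alpha<1$, $\mathrm S^{\mathrm E}_2\not\subseteq\mathrm{SIZE}_{\mathrm{i.o.}}\!\left(\frac{2^n}{n}\left(1+\frac{\alpha\log n}{n}\right)\right)$.
   Context: $\mathrm{SIZE}_{\mathrm{i.o.}}(s(n))$ is the class of languages $B$ such that for infinitely many $n$, $B\cap\{0,1\}^n$ is decided by a Boolean circuit with at most $s(n)$ gates; logs base 2. $\mathrm S^{\mathrm E}_2$ (symmetric alternation in exponential time) is the class of languages $L$ for which there are a predicate $V$ computable in time $2^{O(n)}$ and a bound $m(n)=2^{O(n)}$ such that for every $x$ of length $n$: if $x\in L$ there is $y\in\{0,1\}^{m(n)}$ with $V(x,y,z)=1$ for all $z\in\{0,1\}^{m(n)}$, and if $x\notin L$ there is $z\in\{0,1\}^{m(n)}$ with $V(x,y,z)=0$ for all $y\in\{0,1\}^{m(n)}$. -}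

module Defs where

open import Data.Nat using (ℕ; zero; suc; _+_; _*_; _^_; _≤_; _<_)
open import Data.Integer as ℤ using (ℤ; +_; -[1+_])
open import Data.Rational as ℚ using (ℚ; ↥_; ↧ₙ_)
open import Data.Bool using (Bool; true; false)
open import Data.Fin using (Fin)
open import Data.List using (List; []; _∷_; _++_)
open import Data.Vec as Vec using (Vec; lookup; toList)
open import Data.Maybe using (Maybe; just; nothing)
open import Data.Product using (Σ; ∃; _×_; _,_)
open import Relation.Binary.PropositionalEquality using (_≡_)

Language : Set
Language = List Bool → Bool

-- Boolean circuits over the full binary basis B2 (fan-in 2, every
-- binary Boolean function allowed as a gate).  Size = number of gates.
-- A circuit with n inputs and s gates is a straight-line program; wires
-- are indexed by Fin (k + n) after k gates, the newest wire being index 0.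

Gate : ℕ → Set
Gate w = (Bool → Bool → Bool) × Fin w × Fin w

data Gates (n : ℕ) : ℕ → Set where
  []  : Gates n 0
  _▷_ : ∀ {s} → Gates n s → Gate (s + n) → Gates n (suc s)

wires : ∀ {n s} → Gates n s → Vec Bool n → Vec Bool (s + n)
wires [] x = x
wires (gs ▷ (f , i , j)) x =
  let w = wires gs x in f (lookup w i) (lookup w j) Vec.∷ w

Circuit : ℕ → ℕ → Set
Circuit n s = Gates n s × Fin (s + n)

eval : ∀ {n s} → Circuit n s → Vec Bool n → Bool
eval (gs , o) x = lookup (wires gs x) o

-- The size bound  s ≤ (2^n / n)(1 + α·log₂ n / n)  for rational α = p/q
-- (q > 0) and n ≥ 1, stated exactly with natural numbers:
-- multiplying by q·n² this is  A − B ≤ p·2ⁿ·log₂ n  with A = q n² s and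
-- B = q n 2ⁿ, i.e. (writing p = p⁺ − p⁻, exponentiating base 2)
--   2^A · n^(p⁻·2ⁿ) ≤ 2^B · n^(p⁺·2ⁿ).

pos : ℤ → ℕ
pos (+ k) = k
pos -[1+ k ] = 0

neg : ℤ → ℕ
neg (+ k) = 0
neg -[1+ k ] = suc k

-- s ≤ (2^n/n)(1 + α log₂ n / n)   (meaningful for n ≥ 1)
WithinBound : ℚ → ℕ → ℕ → Set
WithinBound α n s =
  let q = ↧ₙ α
      p = ↥ α
      A = q * (n * n) * s
      B = q * n * 2 ^ n
  in 2 ^ A * n ^ (neg p * 2 ^ n) ≤ 2 ^ B * n ^ (pos p * 2 ^ n)

SmallCircuitAt : ℚ → Language → ℕ → Set
SmallCircuitAt α L n =
  Σ ℕ λ s → WithinBound α n s ×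
    Σ (Circuit n s) λ C → (x : Vec Bool n) → eval C x ≡ L (toList x)

InSIZEio : ℚ → Language → Set
InSIZEio α L = (N : ℕ) → Σ ℕ λ n → N < n × SmallCircuitAt α L n

-- Deterministic single-tape Turing machines over the tape alphabet
-- {blank, 0, 1, #}, with a two-way infinite tape (blank outside the
-- written part).  Each transition (including the halting one) is one step.

data Sym : Set where
  blank b0 b1 sep : Sym

data Move : Set where
  left right stay : Move

data Action (Q : ℕ) : Set where
  halt : Bool → Action Q
  go   : Fin Q → Sym → Move → Action Q

record TM : Set where
  field
    Q     : ℕ
    start : Fin Q
    δ     : Fin Q → Sym → Action Q

record Config (Q : ℕ) : Set where
  constructor conf
  field
    state : Fin Q
    lft   : List Sym   -- cells left of the head, nearest first
    hd    : Sym
    rgt   : List Sym   -- cells right of the head, nearest first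

moveHead : ∀ {Q} → Fin Q → List Sym → Sym → List Sym → Move → Config Q
moveHead q l h r stay = conf q l h r
moveHead q [] h r left = conf q [] blank (h ∷ r)
moveHead q (c ∷ l) h r left = conf q l c (h ∷ r)
moveHead q l h [] right = conf q (h ∷ l) blank []
moveHead q l h (c ∷ r) right = conf q (h ∷ l) c r

run : (M : TM) → ℕ → Config (TM.Q M) → Maybe Bool
run M zero c = nothing
run M (suc t) (conf q l h r) with TM.δ M q h
... | halt b = just b
... | go q' h' m = run M t (moveHead q' l h' r m)

bitSym : Bool → Sym
bitSym false = b0
bitSym true  = b1

initConf : (M : TM) → List Sym → Config (TM.Q M)
initConf M [] = conf (TM.start M) [] blank []
initConf M (c ∷ w) = conf (TM.start M) [] c w

encode3 : List Bool → List Bool → List Bool → List Sym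
encode3 x y z =
  Data.List.map bitSym x ++ sep ∷ Data.List.map bitSym y ++ sep ∷ Data.List.map bitSym z
  where import Data.List

Str : ℕ → Set
Str m = Vec Bool m

InS2E : Language → Set
InS2E L =
  Σ ℕ λ c → Σ (ℕ → ℕ) λ m → Σ TM λ M →
  let T : ℕ → ℕ
      T n = 2 ^ (c * suc n)
      V : List Bool → List Bool → List Bool → Maybe Bool
      V x y z = run M (T (Data.List.length x)) (initConf M (encode3 x y z))
  in ((n : ℕ) → m n ≤ 2 ^ (c * suc n))
   × ((x : List Bool) (y z : Str (m (Data.List.length x))) →
        Σ Bool λ b → V x (toList y) (toList z) ≡ just b)
   × ((x : List Bool) → L x ≡ true →
        Σ (Str (m (Data.List.length x))) λ y →
          (z : Str (m (Data.List.length x))) → V x (toList y) (toList z) ≡ just true)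
   × ((x : List Bool) → L x ≡ false →
        Σ (Str (m (Data.List.length x))) λ z →
          (y : Str (m (Data.List.length x))) → V x (toList y) (toList z) ≡ just false)
  where
    import Data.List

{-# OPTIONS --safe #-}
module Submission where

-- Let N = 2ⁿ.  Circuits of the stated size have stack programs of fewer than N bits, so a
-- string of N bits outside the range of the map from (N − 1)-bit programs to truth tables is
-- a hard truth table; iterating this map N times turns it into a map G from N to 2N bits.
--
-- Put G on a full binary tree of depth N: the leaf at path p carries a string that differs from
-- the leaf p obtained by unfolding p itself with G, and an inner node carries the least preimage
-- under G of the pair of its children, if there is one.  A node with a value determines its whole
-- subtree, so by diagonalisation the root has none, and following the first undefined child leads
-- to a pair (l , r) outside the range of G.  The path to it, with the values hanging off it to the
-- left, is a claim of N² bits or so.  Two different claims can be compared: walk down to a node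
-- where they differ although they agree on both children; there the smaller preimage is right.
-- Hence the correct claim wins against every other one, whichever side presents it.
--
-- Finally undo as many of the N iterations as possible, starting from (l , r); the value where
-- this stops has no preimage, and it is unique if the longest and then least chain is taken.

open import Defs
open import Data.Rational using (ℚ; _<_; 1ℚ)
open import Data.Product using (Σ; _×_)
open import Relation.Nullary using (¬_)

open import Data.Bool using (Bool; true; false; if_then_else_; _∧_; not)
open import Data.Bool.Properties using (∧-zeroʳ; ∧-assoc)
open import Data.Empty using (⊥; ⊥-elim)
open import Data.Fin as Fin using (Fin; toℕ)
open import Data.Fin.Properties using (splitAt-↑ˡ; splitAt-↑ʳ; toℕ<n)
open import Data.Integer as ℤ using (-[1+_])
import Data.Integer.Properties as ℤ
open import Data.List using (List; []; _∷_; _++_; length; map; replicate; foldl; foldr; reverse; drop; _ʳ++_)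
open import Data.List.Properties using (++-assoc; ++-identityʳ; ++-ʳ++; ʳ++-defn; reverse-involutive; reverse-map; reverse-foldl; length-++; length-map; length-reverse; length-replicate; length-drop; map-++; drop-[]; ∷-injectiveˡ; ∷-injectiveʳ)
open import Data.List.Relation.Unary.All using (All; []; _∷_)
import Data.List.Relation.Unary.All.Properties as All
open import Data.Maybe as Maybe using (Maybe; just; nothing)
open import Data.Maybe.Properties using (just-injective)
open import Data.Nat using (ℕ; zero; suc; _+_; _*_; _^_; _∸_; _≤_; z≤n; s≤s; pred; _≟_; NonZero; >-nonZero)
open import Data.Nat.Properties hiding (_≟_)
open import Data.Nat.Tactic.RingSolver using (solve-∀)
open import Data.Product using (_,_; proj₁; proj₂)
open import Data.Rational using (↥_; ↧ₙ_; *<*; mkℚ)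
open import Data.Sum as Sum using (_⊎_; inj₁; inj₂; [_,_]′)
open import Data.Unit using (⊤; tt)
open import Data.Vec as Vec using (Vec; toList; fromList; lookup)
open import Data.Vec.Properties using (length-toList; toList∘fromList)
open import Function using (id; const; _∘_; case_of_)
open import Relation.Nullary using (yes; no)
open import Relation.Binary.PropositionalEquality

-- Structured commands and their compilation to Turing machines

-- The leading constant 1 of the bound leaves room for about n - log n bits per gate, that is, for
-- one wire address per gate and not for two. Evaluating the circuit depth first on a stack achieves
-- this: a gate met for the first time needs no address at all, and references to inputs or to
-- earlier results number at most one more than the gates. An address then costs n - log n + O(1)
-- bits. Against n bits per gate this saves about (2ⁿ/n)·log n bits in total, while the excess
-- α·(2ⁿ/n)·(log n)/n of gates costs α·(2ⁿ/n)·log n, whence α < 1. The map is stretched to 2N bits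
-- because an inner node joins two children of N bits. Rational α is enough: the bound grows with α,
-- and a rational lies between any real α < 1 and 1. Claims have about N² bits, so time polynomial
-- in the whole input is 2^O(n). The machine model is concrete; hence polynomial time is proved
-- through combinators that carry machine code, a cost and a size bound.

data Cmd : Set where
  act  : (Sym → Sym) → Move → Cmd
  _⨾_  : Cmd → Cmd → Cmd
  sw   : (Sym → Cmd) → Cmd
  loop : (Sym → Bool) → Cmd → Cmd

infixr 5 _⨾_

record Tape : Set where
  constructor tape
  field
    lft : List Sym
    hd  : Sym
    rgt : List Sym

open Tape public

mv : List Sym → Sym → List Sym → Move → Tape
mv l h r stay = tape l h r
mv [] h r left = tape [] blank (h ∷ r)
mv (c ∷ l) h r left = tape l c (h ∷ r)
mv l h [] right = tape (h ∷ l) blank []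
mv l h (c ∷ r) right = tape (h ∷ l) c r

at : ∀ {Q} → Fin Q → Tape → Config Q
at q (tape l h r) = conf q l h r

moveHead-mv : ∀ {Q} (q : Fin Q) l h r m → moveHead q l h r m ≡ at q (mv l h r m)
moveHead-mv q l h r stay = refl
moveHead-mv q [] h r left = refl
moveHead-mv q (c ∷ l) h r left = refl
moveHead-mv q l h [] right = refl
moveHead-mv q l h (c ∷ r) right = refl

-- Step counts are exact: the test of a `sw` or `loop` costs one transition without movement, and
-- sequencing is free, because the last transition of `c` enters `d` directly.
data Exec : Cmd → Tape → ℕ → Tape → Set where
  xact  : ∀ {f m l h r} → Exec (act f m) (tape l h r) 1 (mv l (f h) r m)
  xseq  : ∀ {c d T T′ T″ t t′} → Exec c T t T′ → Exec d T′ t′ T″ → Exec (c ⨾ d) T (t + t′) T″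
  xsw   : ∀ {k T T′ t} → Exec (k (hd T)) T t T′ → Exec (sw k) T (suc t) T′
  xdone : ∀ {p c T} → p (hd T) ≡ false → Exec (loop p c) T 1 T
  xmore : ∀ {p c T T′ T″ t t′} → p (hd T) ≡ true → Exec c T t T′ →
          Exec (loop p c) T′ t′ T″ → Exec (loop p c) T (suc (t + t′)) T″

Ctl : Cmd → Set
Ctl (act f m)  = ⊤
Ctl (c ⨾ d)    = Ctl c ⊎ Ctl d
Ctl (sw k)     = ⊤ ⊎ ((Ctl (k blank) ⊎ Ctl (k b0)) ⊎ (Ctl (k b1) ⊎ Ctl (k sep)))
Ctl (loop p c) = ⊤ ⊎ Ctl c

entry : ∀ c → Ctl c
entry (act f m)  = tt
entry (c ⨾ d)    = inj₁ (entry c)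
entry (sw k)     = inj₁ tt
entry (loop p c) = inj₁ tt

inject : ∀ k s → Ctl (k s) → Ctl (sw k)
inject k blank q = inj₂ (inj₁ (inj₁ q))
inject k b0    q = inj₂ (inj₁ (inj₂ q))
inject k b1    q = inj₂ (inj₂ (inj₁ q))
inject k sep   q = inj₂ (inj₂ (inj₂ q))

-- The control state `nothing` means that the command has finished.
next : ∀ c → Ctl c → Sym → Maybe (Ctl c) × Sym × Move
next (act f m)  tt       s = nothing , f s , m
next (c ⨾ d)    (inj₁ q) s with next c q s
... | q′ , s′ , m = just (Maybe.maybe inj₁ (inj₂ (entry d)) q′) , s′ , m
next (c ⨾ d)    (inj₂ q) s with next d q s
... | q′ , s′ , m = Maybe.map inj₂ q′ , s′ , m
next (sw k) (inj₁ tt) s = just (inject k s (entry (k s))) , s , stay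
next (sw k) (inj₂ (inj₁ (inj₁ q))) s with next (k blank) q s
... | q′ , s′ , m = Maybe.map (inject k blank) q′ , s′ , m
next (sw k) (inj₂ (inj₁ (inj₂ q))) s with next (k b0) q s
... | q′ , s′ , m = Maybe.map (inject k b0) q′ , s′ , m
next (sw k) (inj₂ (inj₂ (inj₁ q))) s with next (k b1) q s
... | q′ , s′ , m = Maybe.map (inject k b1) q′ , s′ , m
next (sw k) (inj₂ (inj₂ (inj₂ q))) s with next (k sep) q s
... | q′ , s′ , m = Maybe.map (inject k sep) q′ , s′ , m
next (loop p c) (inj₁ tt) s = (if p s then just (inj₂ (entry c)) else nothing) , s , stay
next (loop p c) (inj₂ q) s with next c q s
... | q′ , s′ , m = just (Maybe.maybe inj₂ (inj₁ tt) q′) , s′ , m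

next-inject : ∀ k s q s′ → next (sw k) (inject k s q) s′ ≡
  (let n = next (k s) q s′ in Maybe.map (inject k s) (proj₁ n) , proj₂ n)
next-inject k blank q s′ = refl
next-inject k b0    q s′ = refl
next-inject k b1    q s′ = refl
next-inject k sep   q s′ = refl

nCtl : Cmd → ℕ
nCtl (act f m)  = 1
nCtl (c ⨾ d)    = nCtl c + nCtl d
nCtl (sw k)     = 1 + ((nCtl (k blank) + nCtl (k b0)) + (nCtl (k b1) + nCtl (k sep)))
nCtl (loop p c) = 1 + nCtl c

record Finite (A : Set) (n : ℕ) : Set where
  field
    index   : A → Fin n
    element : Fin n → A
    element-index : ∀ a → element (index a) ≡ a

open Finite

finite-⊤ : Finite ⊤ 1
finite-⊤ .index _ = Fin.zero
finite-⊤ .element _ = tt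
finite-⊤ .element-index _ = refl

finite-⊎ : ∀ {A B m n} → Finite A m → Finite B n → Finite (A ⊎ B) (m + n)
finite-⊎ {m = m} {n} F G .index = [ (λ a → index F a Fin.↑ˡ n) , (λ b → m Fin.↑ʳ index G b) ]′
finite-⊎ {m = m} F G .element i = Sum.map (element F) (element G) (Fin.splitAt m i)
finite-⊎ {m = m} {n} F G .element-index (inj₁ a)
  rewrite splitAt-↑ˡ m (index F a) n = cong inj₁ (element-index F a)
finite-⊎ {m = m} {n} F G .element-index (inj₂ b)
  rewrite splitAt-↑ʳ m n (index G b) = cong inj₂ (element-index G b)

finite-Ctl : ∀ c → Finite (Ctl c) (nCtl c)
finite-Ctl (act f m)  = finite-⊤
finite-Ctl (c ⨾ d)    = finite-⊎ (finite-Ctl c) (finite-Ctl d)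
finite-Ctl (sw k)     = finite-⊎ finite-⊤
  (finite-⊎ (finite-⊎ (finite-Ctl (k blank)) (finite-Ctl (k b0)))
            (finite-⊎ (finite-Ctl (k b1)) (finite-Ctl (k sep))))
finite-Ctl (loop p c) = finite-⊎ finite-⊤ (finite-Ctl c)

action : ∀ {Q} {A : Set} → (A → Fin Q) → Fin Q → Maybe A × Sym × Move → Action Q
action e x (q , s , m) = go (Maybe.maybe e x q) s m

-- `M` contains a copy of `c`: `e` places its control states, and `x` takes over when `c` finishes.
-- Keeping `e` and `x` variable lets the induction of `exec-leads` descend into subcommands while
-- the machine stays fixed.
Implements : (M : TM) (c : Cmd) → (Ctl c → Fin (TM.Q M)) → Fin (TM.Q M) → Set
Implements M c e x = ∀ q s → TM.δ M (e q) s ≡ action e x (next c q s)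

module _ (M : TM) where
  open TM M

  -- Phrased through the final verdict, since `run` returns no intermediate configuration to speak
  -- about.
  record Leads (q : Fin Q) (T : Tape) (t : ℕ) (x : Fin Q) (T′ : Tape) : Set where
    constructor leads
    field
      resume : ∀ f b → run M f (at x T′) ≡ just b → run M (t + f) (at q T) ≡ just b

  leads-trans : ∀ {q T t x T′ t′ y T″} → Leads q T t x T′ → Leads x T′ t′ y T″ →
                Leads q T (t + t′) y T″
  leads-trans {q} {T} {t} {t′ = t′} (leads A) (leads B) = leads λ f b eq →
    subst (λ u → run M u (at q T) ≡ just b) (sym (+-assoc t t′ f)) (A (t′ + f) b (B f b eq))

  leads-step : ∀ {q q′ l h r h′ m} → δ q h ≡ go q′ h′ m →
               Leads q (tape l h r) 1 q′ (mv l h′ r m)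
  leads-step {q} {q′} {l} {h} {r} {h′} {m} eq = leads step
    where
    step : ∀ f b → run M f (at q′ (mv l h′ r m)) ≡ just b → run M (suc f) (conf q l h r) ≡ just b
    step f b h≡ rewrite eq = trans (cong (run M f) (moveHead-mv q′ l h′ r m)) h≡

  leads-stay : ∀ {q q′ T} → δ q (hd T) ≡ go q′ (hd T) stay → Leads q T 1 q′ T
  leads-stay = leads-step

  exec-leads : ∀ {c T t T′} → Exec c T t T′ → ∀ e x → Implements M c e x →
               Leads (e (entry c)) T t x T′
  exec-leads xact e x I = leads-step (I tt _)
  exec-leads (xseq {c} {d} p q) e x I =
    leads-trans (exec-leads p (λ a → e (inj₁ a)) (e (inj₂ (entry d))) I₁)
                (exec-leads q (λ a → e (inj₂ a)) x I₂)
    where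
    I₁ : Implements M c (λ a → e (inj₁ a)) (e (inj₂ (entry d)))
    I₁ a s with next c a s | I (inj₁ a) s
    ... | just _ , _  | eq = eq
    ... | nothing , _ | eq = eq
    I₂ : Implements M d (λ a → e (inj₂ a)) x
    I₂ a s with next d a s | I (inj₂ a) s
    ... | just _ , _  | eq = eq
    ... | nothing , _ | eq = eq
  exec-leads (xsw {k} {T} p) e x I =
    leads-trans {t = 1} (leads-stay (I (inj₁ tt) (hd T)))
                (exec-leads p (λ a → e (inject k (hd T) a)) x I′)
    where
    I′ : Implements M (k (hd T)) (λ a → e (inject k (hd T) a)) x
    I′ a s with next (k (hd T)) a s | trans (I (inject k (hd T) a) s) (cong (action e x) (next-inject k (hd T) a s))
    ... | just _ , _  | eq = eq
    ... | nothing , _ | eq = eq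
  exec-leads (xdone {p} {c} {T} np) e x I = leads-stay eq
    where
    eq : δ (e (inj₁ tt)) (hd T) ≡ go x (hd T) stay
    eq = trans (I (inj₁ tt) (hd T))
      (cong (λ b → action e x ((if b then just (inj₂ (entry c)) else nothing) , hd T , stay)) np)
  exec-leads (xmore {p} {c} {T} {t = t} {t′} py b bs) e x I =
    leads-trans {t = 1} (leads-stay eq)
      (leads-trans (exec-leads b (λ a → e (inj₂ a)) (e (inj₁ tt)) I′) (exec-leads bs e x I))
    where
    eq : δ (e (inj₁ tt)) (hd T) ≡ go (e (inj₂ (entry c))) (hd T) stay
    eq = trans (I (inj₁ tt) (hd T))
      (cong (λ b → action e x ((if b then just (inj₂ (entry c)) else nothing) , hd T , stay)) py)
    I′ : Implements M c (λ a → e (inj₂ a)) (e (inj₁ tt))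
    I′ a s with next c a s | I (inj₂ a) s
    ... | just _ , _  | eq = eq
    ... | nothing , _ | eq = eq

isOne : Sym → Bool
isOne b1 = true
isOne _  = false

compile : Cmd → TM
compile c = record
  { Q = suc (nCtl c)
  ; start = Fin.suc (index F (entry c))
  -- State zero is the added exit; it turns the symbol under the head into the verdict.
  ; δ = λ { Fin.zero s → halt (isOne s)
          ; (Fin.suc q) s → action (λ a → Fin.suc (index F a)) Fin.zero (next c (element F q) s) } }
  where F = finite-Ctl c

run-mono : ∀ M {f g} → f ≤ g → ∀ C b → run M f C ≡ just b → run M g C ≡ just b
run-mono M {suc f} {suc g} (s≤s f≤g) (conf q l h r) b eq with TM.δ M q h
... | halt _ = eq
... | go q′ h′ m = run-mono M f≤g _ b eq

compile-correct : ∀ {c T t T′} → Exec c T t T′ → ∀ f → suc t ≤ f →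
  run (compile c) f (at (TM.start (compile c)) T) ≡ just (isOne (hd T′))
compile-correct {c} {T} {t} {T′} E f t<f = run-mono (compile c)
  (≤-trans (≤-reflexive (+-comm t 1)) t<f) _ _
  (Leads.resume (exec-leads (compile c) E (λ a → Fin.suc (index F a)) Fin.zero I) 1 (isOne (hd T′)) refl)
  where
  F = finite-Ctl c
  I : Implements (compile c) c (λ a → Fin.suc (index F a)) Fin.zero
  I q s rewrite element-index F q = refl

-- Stacks of bit strings on the tape

Bits : Set
Bits = List Bool

record Runs (c : Cmd) (T : Tape) (b : ℕ) (T′ : Tape) : Set where
  constructor runs
  field
    {time} : ℕ
    within : time ≤ b
    exec   : Exec c T time T′

runs-weaken : ∀ {c T b b′ T′} → b ≤ b′ → Runs c T b T′ → Runs c T b′ T′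
runs-weaken b≤b′ (runs t≤b E) = runs (≤-trans t≤b b≤b′) E

infixr 5 _⨾ᵣ_

_⨾ᵣ_ : ∀ {c d T T′ T″ b b′} → Runs c T b T′ → Runs d T′ b′ T″ → Runs (c ⨾ d) T (b + b′) T″
runs p E ⨾ᵣ runs q F = runs (+-mono-≤ p q) (xseq E F)

runs-act : ∀ {f m l h r} → Runs (act f m) (tape l h r) 1 (mv l (f h) r m)
runs-act = runs ≤-refl xact

runs-sw : ∀ {k T T′ b} → Runs (k (hd T)) T b T′ → Runs (sw k) T (suc b) T′
runs-sw (runs p E) = runs (s≤s p) (xsw E)

runs-done : ∀ {p c T} → p (hd T) ≡ false → Runs (loop p c) T 1 T
runs-done np = runs ≤-refl (xdone np)

runs-more : ∀ {p c T T′ T″ b b′} → p (hd T) ≡ true → Runs c T b T′ →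
            Runs (loop p c) T′ b′ T″ → Runs (loop p c) T (suc (b + b′)) T″
runs-more py (runs p E) (runs q F) = runs (s≤s (+-mono-≤ p q)) (xmore py E F)

isBit nonBlank : Sym → Bool
isBit b0 = true
isBit b1 = true
isBit _  = false
nonBlank blank = false
nonBlank _     = true

isBit-bitSym : ∀ b → isBit (bitSym b) ≡ true
isBit-bitSym false = refl
isBit-bitSym true  = refl

nonBlank-bitSym : ∀ b → nonBlank (bitSym b) ≡ true
nonBlank-bitSym false = refl
nonBlank-bitSym true  = refl

syms : Bits → List Sym
syms = map bitSym

syms-bits : ∀ l → All (λ s → isBit s ≡ true) (syms l)
syms-bits []      = []
syms-bits (b ∷ l) = isBit-bitSym b ∷ syms-bits l

syms-nonBlank : ∀ l → All (λ s → nonBlank s ≡ true) (syms l)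
syms-nonBlank []      = []
syms-nonBlank (b ∷ l) = nonBlank-bitSym b ∷ syms-nonBlank l

-- Contents of the tape to the left of the head, nearest cell first. The first bit of the top string
-- is adjacent to the head, so consing is a single write; `sep` marks the far end of each string.
flat : List Bits → List Sym
flat []      = []
flat (l ∷ S) = syms l ++ sep ∷ flat S

cells : List Bits → ℕ
cells []      = 0
cells (l ∷ S) = suc (length l) + cells S

length-flat : ∀ S → length (flat S) ≡ cells S
length-flat []      = refl
length-flat (l ∷ S) = trans (length-++ (syms l))
  (trans (cong₂ (λ a b → a + suc b) (length-map bitSym l) (length-flat S)) (+-suc (length l) (cells S)))

cells-++ : ∀ S S′ → cells (S ++ S′) ≡ cells S + cells S′
cells-++ []      S′ = refl
cells-++ (l ∷ S) S′ = trans (cong (suc (length l) +_) (cells-++ S S′)) (sym (+-assoc (suc (length l)) (cells S) _))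

flat-nonBlank : ∀ S → All (λ s → nonBlank s ≡ true) (flat S)
flat-nonBlank []      = []
flat-nonBlank (l ∷ S) = All.++⁺ (syms-nonBlank l) (refl ∷ flat-nonBlank S)

flat-++ : ∀ S S′ → flat (S ++ S′) ≡ flat S ++ flat S′
flat-++ []      S′ = refl
flat-++ (l ∷ S) S′ = trans (cong (λ w → syms l ++ sep ∷ w) (flat-++ S S′))
  (sym (++-assoc (syms l) (sep ∷ flat S) (flat S′)))

blanks : ℕ → List Sym
blanks k = replicate k blank

toLeft : (Sym → Sym) → (Sym → Bool) → Cmd
toLeft f p = act f left ⨾ loop p (act id left)

toRight : (Sym → Bool) → Cmd
toRight p = loop p (act id right)

runs-loopLeft : ∀ {p} ws z l h R → All (λ s → p s ≡ true) (h ∷ ws) → p z ≡ false →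
  Runs (loop p (act id left)) (tape (ws ++ z ∷ l) h R) (2 * suc (length ws) + 1) (tape l z (ws ʳ++ h ∷ R))
runs-loopLeft [] z l h R (ph ∷ _) pz = runs-more ph runs-act (runs-done pz)
runs-loopLeft (w ∷ ws) z l h R (ph ∷ pws) pz = runs-weaken (≤-reflexive (eq (length ws)))
  (runs-more ph runs-act (runs-loopLeft ws z l w (h ∷ R) pws pz))
  where
  eq : ∀ a → suc (1 + (2 * suc a + 1)) ≡ 2 * suc (suc a) + 1
  eq = solve-∀

runs-toLeft : ∀ {f p} ws z l h R → All (λ s → p s ≡ true) ws → p z ≡ false →
  Runs (toLeft f p) (tape (ws ++ z ∷ l) h R) (2 * length ws + 2) (tape l z (ws ʳ++ f h ∷ R))
runs-toLeft [] z l h R _ pz = runs-act ⨾ᵣ runs-done pz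
runs-toLeft (w ∷ ws) z l h R pws pz = runs-weaken (≤-reflexive (eq (length ws)))
  (runs-act ⨾ᵣ runs-loopLeft ws z l w _ pws pz)
  where
  eq : ∀ a → 1 + (2 * suc a + 1) ≡ 2 * suc a + 2
  eq = solve-∀

focus : List Sym → List Sym → Tape
focus l []      = tape l blank []
focus l (h ∷ r) = tape l h r

mv-right : ∀ l h r → mv l h r right ≡ focus (h ∷ l) r
mv-right l h []      = refl
mv-right l h (c ∷ r) = refl

runs-actʳ : ∀ {f l h r} → Runs (act f right) (tape l h r) 1 (focus (f h ∷ l) r)
runs-actʳ {f} {l} {h} {r} = subst (Runs _ _ 1) (mv-right l (f h) r) runs-act

focus-blanks : ∀ l k → focus l (blanks k) ≡ tape l blank (blanks (pred k))
focus-blanks l zero    = refl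
focus-blanks l (suc k) = refl

runs-toRight : ∀ ws l k → All (λ s → nonBlank s ≡ true) ws →
  Runs (toRight nonBlank) (focus l (ws ++ blanks k)) (2 * length ws + 1)
       (tape (ws ʳ++ l) blank (blanks (pred k)))
runs-toRight [] l zero    _ = runs-done refl
runs-toRight [] l (suc k) _ = runs-done refl
runs-toRight (w ∷ ws) l k (pw ∷ pws) = runs-weaken (≤-reflexive (eq (length ws)))
  (runs-more pw runs-actʳ (runs-toRight ws (w ∷ l) k pws))
  where
  eq : ∀ a → suc (1 + (2 * a + 1)) ≡ 2 * suc a + 1
  eq = solve-∀

nop : Cmd
nop = act id stay

skipLists : ℕ → Cmd
skipLists zero    = nop
skipLists (suc i) = toLeft id isBit ⨾ skipLists i

runs-skipLists : ∀ O l h R → Runs (skipLists (length O)) (tape (flat O ++ l) h R) (2 * cells O + 1)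
                                  (focus l (flat O ʳ++ h ∷ R))
runs-skipLists [] l h R = runs-act
runs-skipLists (a ∷ O) l h R
  rewrite ++-assoc (syms a) (sep ∷ flat O) l | ++-ʳ++ (syms a) {sep ∷ flat O} {h ∷ R} =
  runs-weaken (≤-reflexive (trans (cong (λ u → 2 * u + 2 + (2 * cells O + 1)) (length-map bitSym a)) (eq (length a) (cells O))))
    (runs-toLeft (syms a) sep (flat O ++ l) h R (syms-bits a) refl
      ⨾ᵣ runs-skipLists O l sep (syms a ʳ++ h ∷ R))
  where
  eq : ∀ a b → 2 * a + 2 + (2 * b + 1) ≡ 2 * (suc a + b) + 1
  eq = solve-∀

-- The head rests on the first blank to the right of the stack, next to its top.
End : List Bits → ℕ → Tape
End S r = tape (flat S) blank (blanks r)

-- The deleted cell becomes a blank, which is then exchanged with one cell after another to its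
-- right, so that everything above closes up by one cell.
delChar : Cmd
delChar = act (const blank) right
        ⨾ loop nonBlank (sw λ s → act (const blank) left ⨾ act (const s) right ⨾ act id right)
        ⨾ act id left

runs-shift : ∀ ws l k → All (λ s → nonBlank s ≡ true) ws →
  Runs (loop nonBlank (sw λ s → act (const blank) left ⨾ act (const s) right ⨾ act id right))
       (focus (blank ∷ l) (ws ++ blanks k)) (5 * length ws + 1)
       (tape (blank ∷ ws ʳ++ l) blank (blanks (pred k)))
runs-shift [] l zero    _ = runs-done refl
runs-shift [] l (suc k) _ = runs-done refl
runs-shift (w ∷ ws) l k (pw ∷ pws) = runs-weaken (≤-reflexive (eq (length ws)))
  (runs-more pw (runs-sw (runs-act ⨾ᵣ runs-actʳ ⨾ᵣ runs-actʳ)) (runs-shift ws (w ∷ l) k pws))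
  where
  eq : ∀ a → suc (4 + (5 * a + 1)) ≡ 5 * suc a + 1
  eq = solve-∀

ʳ++-reverse : ∀ (ws l : List Sym) → reverse ws ʳ++ l ≡ ws ++ l
ʳ++-reverse ws l = trans (ʳ++-defn (reverse ws)) (cong (_++ l) (reverse-involutive ws))

all-ʳ++ : ∀ {P : Sym → Set} {ws l} → All P ws → All P l → All P (ws ʳ++ l)
all-ʳ++ []       ql = ql
all-ʳ++ (p ∷ ps) ql = all-ʳ++ ps (p ∷ ql)

runs-delChar : ∀ O l c r → Runs delChar (tape l c (flat O ʳ++ blanks r)) (5 * cells O + 3)
                                (tape (flat O ++ l) blank (blanks (suc (pred r))))
runs-delChar O l c r = runs-weaken (≤-reflexive (eq (cells O)))
  (runs-actʳ ⨾ᵣ (runs-weaken (≤-reflexive (cong (λ u → 5 * u + 1) (trans (length-reverse (flat O)) (length-flat O))))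
     (subst₂ (λ a b → Runs _ (focus (blank ∷ l) a) _ (tape (blank ∷ b) blank _))
       (sym (ʳ++-defn (flat O))) (ʳ++-reverse (flat O) l)
       (runs-shift (reverse (flat O)) l r (all-ʳ++ (flat-nonBlank O) [])))
   ⨾ᵣ runs-act))
  where
  eq : ∀ a → 1 + (5 * a + 1 + 1) ≡ 5 * a + 3
  eq = solve-∀

infix 4 _∶_⇒[_]_

-- The number of blanks already visited beyond the stack varies from run to run, so it is arbitrary
-- before the command and merely exists afterwards.
record _∶_⇒[_]_ (c : Cmd) (S : List Bits) (b : ℕ) (S′ : List Bits) : Set where
  constructor stk
  field
    from : ∀ r → Σ ℕ λ r′ → Runs c (End S r) b (End S′ r′)

open _∶_⇒[_]_ public

infixr 5 _⨾ₛ_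

_⨾ₛ_ : ∀ {c d S S′ S″ b b′} → c ∶ S ⇒[ b ] S′ → d ∶ S′ ⇒[ b′ ] S″ → (c ⨾ d) ∶ S ⇒[ b + b′ ] S″
from (p ⨾ₛ q) r with from p r
... | r′ , R with from q r′
... | r″ , R′ = r″ , R ⨾ᵣ R′

stk-weaken : ∀ {c S S′ b b′} → b ≤ b′ → c ∶ S ⇒[ b ] S′ → c ∶ S ⇒[ b′ ] S′
from (stk-weaken le p) r with from p r
... | r′ , R = r′ , runs-weaken le R

stk-nop : ∀ {S} → nop ∶ S ⇒[ 1 ] S
from stk-nop r = r , runs-act

pushBit : Bool → Cmd
pushBit b = act (const (bitSym b)) right

stk-pushBit : ∀ {b l S} → pushBit b ∶ l ∷ S ⇒[ 1 ] (b ∷ l) ∷ S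
from (stk-pushBit {b} {l} {S}) r = pred r , subst (Runs _ _ 1) (focus-blanks _ r) runs-actʳ

newList : Cmd
newList = act (const sep) right

stk-newList : ∀ {S} → newList ∶ S ⇒[ 1 ] [] ∷ S
from stk-newList r = pred r , subst (Runs _ _ 1) (focus-blanks _ r) runs-actʳ

toEdge : ℕ → Cmd
toEdge i = skipLists i ⨾ act id left

runs-toEdge : ∀ O c l r → Runs (toEdge (length O)) (tape (flat O ++ c ∷ l) blank (blanks r)) (2 * cells O + 2)
                               (tape l c (flat O ʳ++ blanks (suc r)))
runs-toEdge O c l r = runs-weaken (≤-reflexive (+-assoc (2 * cells O) 1 1))
  (runs-skipLists O (c ∷ l) blank (blanks r) ⨾ᵣ back (flat O) (blanks r))
  where
  back : ∀ w R → Runs (act id left) (focus (c ∷ l) (w ʳ++ blank ∷ R)) 1 (tape l c (w ʳ++ blank ∷ R))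
  back w R rewrite ʳ++-defn w {blank ∷ R} with reverse w
  ... | []     = runs-act
  ... | _ ∷ _  = runs-act

delList : ℕ → Cmd
delList i = toEdge i ⨾ loop isBit (delChar ⨾ toEdge i) ⨾ delChar

stk-delList : ∀ O {l S} → delList (length O) ∶ O ++ l ∷ S ⇒[ (suc (length l)) * (7 * cells O + 6) ] O ++ S
from (stk-delList O {l} {S}) r = _ , runs-weaken (≤-reflexive (sum-eq (length l) (cells O)))
    (start l ⨾ᵣ body l (suc r))
  where
  Z = cells O
  edge : Bits → Sym × List Sym
  edge []      = sep , flat S
  edge (b ∷ l) = bitSym b , flat (l ∷ S)
  edge-eq : ∀ l → flat (O ++ l ∷ S) ≡ flat O ++ proj₁ (edge l) ∷ proj₂ (edge l)
  edge-eq []      = flat-++ O ([] ∷ S)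
  edge-eq (b ∷ l) = flat-++ O ((b ∷ l) ∷ S)
  atEdge : Bits → ℕ → Tape
  atEdge l r = tape (proj₂ (edge l)) (proj₁ (edge l)) (flat O ʳ++ blanks r)
  start : ∀ l {r} → Runs (toEdge (length O)) (End (O ++ l ∷ S) r) (2 * Z + 2) (atEdge l (suc r))
  start l {r} rewrite edge-eq l = runs-toEdge O _ _ r
  final : ∀ l → ℕ → ℕ
  final []      r = suc (pred r)
  final (b ∷ l) r = final l (suc (suc (pred r)))
  loop-time : ℕ → ℕ
  loop-time a = a * (7 * Z + 6) + 1
  body : ∀ l r → Runs (loop isBit (delChar ⨾ toEdge (length O)) ⨾ delChar) (atEdge l r)
                      (loop-time (length l) + (5 * Z + 3)) (End (O ++ S) (final l r))
  body [] r rewrite flat-++ O S = runs-done refl ⨾ᵣ runs-delChar O (flat S) sep r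
  body (b ∷ l) r with body l (suc (suc (pred r)))
  ... | runs {time} le (xseq {t = t} {t′} E F) =
    runs (≤-trans (≤-reflexive (rearr (Runs.time dc) (Runs.time ed) t t′))
         (≤-trans (s≤s (+-mono-≤ (+-mono-≤ (Runs.within dc) (Runs.within ed)) le))
                  (≤-reflexive (time-eq (length l) Z))))
      (xseq (xmore (isBit-bitSym b) (xseq (Runs.exec dc) (Runs.exec ed)) E) F)
    where
    dc : Runs delChar (atEdge (b ∷ l) r) (5 * Z + 3) (End (O ++ l ∷ S) (suc (pred r)))
    dc rewrite flat-++ O (l ∷ S) = runs-delChar O (flat (l ∷ S)) (bitSym b) r
    ed : Runs (toEdge (length O)) (End (O ++ l ∷ S) (suc (pred r))) (2 * Z + 2) (atEdge l (suc (suc (pred r))))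
    ed = start l
    rearr : ∀ a b c d → suc (a + b + c) + d ≡ suc (a + b + (c + d))
    rearr = solve-∀
    time-eq : ∀ a z → suc (5 * z + 3 + (2 * z + 2) + (a * (7 * z + 6) + 1 + (5 * z + 3))) ≡ suc a * (7 * z + 6) + 1 + (5 * z + 3)
    time-eq = solve-∀
  sum-eq : ∀ a z → 2 * z + 2 + (a * (7 * z + 6) + 1 + (5 * z + 3)) ≡ (suc a) * (7 * z + 6)
  sum-eq = solve-∀

runs-≡ : ∀ {c T U T′ U′ b} → T ≡ U → T′ ≡ U′ → Runs c T b T′ → Runs c U b U′
runs-≡ refl refl R = R

-- The source cell is blanked for the duration of the trip, so both turning points are found by
-- looking for a blank; the bit itself is remembered in the control state.
copyBit : Sym → Cmd
copyBit s = act (const blank) right ⨾ toRight nonBlank ⨾ toLeft (const s) nonBlank ⨾ act (const s) right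

runs-copyBit : ∀ {s} W Y r → All (λ s → nonBlank s ≡ true) W →
  Runs (copyBit s) (tape Y s (W ++ blanks r)) (4 * length W + 5) (focus (s ∷ Y) (W ++ s ∷ blanks (pred r)))
runs-copyBit {s} W Y r nb = runs-weaken (≤-reflexive (eq (length W)))
  (runs-actʳ ⨾ᵣ
   subst (Runs _ _ _) (cong (λ l → tape l blank _) (ʳ++-defn W)) (runs-toRight W (blank ∷ Y) r nb) ⨾ᵣ
   runs-weaken (≤-reflexive (cong (λ t → 2 * t + 2) (length-reverse W))) (runs-≡ refl (cong (tape Y blank) (ʳ++-reverse W _))
     (runs-toLeft (reverse W) blank Y blank (blanks (pred r)) (all-ʳ++ nb []) refl)) ⨾ᵣ
   runs-actʳ)
  where
  eq : ∀ a → 1 + (2 * a + 1 + (2 * a + 2 + 1)) ≡ 4 * a + 5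
  eq = solve-∀

flat-ʳ++-sep : ∀ d O R → Σ (List Sym) λ R′ → flat (d ∷ O) ʳ++ R ≡ sep ∷ R′
flat-ʳ++-sep d []      R = _ , ++-ʳ++ (syms d)
flat-ʳ++-sep d (e ∷ O) R with flat-ʳ++-sep e O (sep ∷ syms d ʳ++ R)
... | R′ , eq = R′ , trans (++-ʳ++ (syms d)) eq

runs-copyLoop : ∀ u d O Y r → Σ ℕ λ r′ →
  Runs (loop isBit (sw copyBit)) (focus Y (syms u ++ (flat (d ∷ O) ʳ++ blanks r)))
       (length u * (4 * (length u + length d + cells O) + 7) + 1)
       (focus (syms u ʳ++ Y) (flat ((u ʳ++ d) ∷ O) ʳ++ blanks r′))
runs-copyLoop [] d O Y r with flat-ʳ++-sep d O (blanks r)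
... | R′ , eq rewrite eq = r , subst (λ R → Runs _ _ _ (focus Y R)) (sym eq) (runs-done refl)
runs-copyLoop (b ∷ u) d O Y r with runs-copyLoop u (b ∷ d) O (bitSym b ∷ Y) (pred r)
... | r′ , rest = r′ , runs-weaken le (runs-more (isBit-bitSym b) (runs-sw first) rest)
  where
  W : List Sym
  W = syms u ++ reverse (flat (d ∷ O))
  W-eq : ∀ R → W ++ R ≡ syms u ++ (flat (d ∷ O) ʳ++ R)
  W-eq R = trans (++-assoc (syms u) (reverse (flat (d ∷ O))) R)
                 (cong (syms u ++_) (sym (ʳ++-defn (flat (d ∷ O)))))
  first : Runs (copyBit (bitSym b)) (focus Y (syms (b ∷ u) ++ (flat (d ∷ O) ʳ++ blanks r))) (4 * length W + 5)
               (focus (bitSym b ∷ Y) (syms u ++ (flat ((b ∷ d) ∷ O) ʳ++ blanks (pred r))))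
  first = subst₂ (λ A B → Runs (copyBit (bitSym b)) (tape Y (bitSym b) A) (4 * length W + 5) (focus (bitSym b ∷ Y) B))
    (W-eq (blanks r)) (W-eq (bitSym b ∷ blanks (pred r)))
    (runs-copyBit W Y r (All.++⁺ (syms-nonBlank u) (all-ʳ++ (flat-nonBlank (d ∷ O)) [])))
  length-W : length W ≡ length u + (suc (length d) + cells O)
  length-W = trans (length-++ (syms u)) (cong₂ _+_ (length-map bitSym u)
               (trans (length-reverse (flat (d ∷ O))) (length-flat (d ∷ O))))
  eq : ∀ u d z → suc (suc (4 * (u + (suc d + z)) + 5) + (u * (4 * (u + suc d + z) + 7) + 1))
               ≡ suc u * (4 * (suc u + d + z) + 7) + 1
  eq = solve-∀
  le : _ ≤ _
  le = ≤-reflexive (trans (cong (λ t → suc (suc (4 * t + 5) + (length u * (4 * (length u + suc (length d) + cells O) + 7) + 1))) length-W)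
                          (eq (length u) (length d) (cells O)))

-- The source is read from its far end towards the head, so consing its bits one by one onto the new
-- string restores their order. The loop stops at the separator of the string above, which exists
-- because the new string was opened first.
pickList : ℕ → Cmd
pickList i = newList ⨾ skipLists (suc (suc i)) ⨾ act id right ⨾ loop isBit (sw copyBit) ⨾ toRight nonBlank

pickTime : ℕ → ℕ → ℕ
pickTime a z = (a + 2) * (4 * (a + z) + 9)

stk-pickList : ∀ O {l S} → pickList (length O) ∶ O ++ l ∷ S ⇒[ pickTime (length l) (cells O) ] l ∷ O ++ l ∷ S
from (stk-pickList O {l} {S}) r
  with from (stk-newList {O ++ l ∷ S}) r
... | r₁ , new with runs-copyLoop (reverse l) [] O (sep ∷ flat S) (suc r₁)
... | r₂ , copy = _ , runs-weaken time-le
  (new ⨾ᵣ reach ⨾ᵣ runs-actʳ ⨾ᵣ copy′ ⨾ᵣ finish)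
  where
  O′ : List Bits
  O′ = [] ∷ O ++ l ∷ []
  O′-length : length O′ ≡ suc (suc (length O))
  O′-length = cong suc (trans (length-++ O) (+-comm (length O) 1))
  O′-cells : cells O′ ≡ suc (cells O + (suc (length l) + 0))
  O′-cells = cong suc (cells-++ O (l ∷ []))
  O′-flat : flat O′ ++ flat S ≡ flat ([] ∷ O ++ l ∷ S)
  O′-flat = trans (sym (flat-++ O′ S)) (cong (λ w → flat ([] ∷ w)) (++-assoc O (l ∷ []) S))
  O′-rev : ∀ R → flat O′ ʳ++ R ≡ sep ∷ syms (reverse l) ++ (flat ([] ∷ O) ʳ++ R)
  O′-rev R = trans (cong (_ʳ++ R) (cong (sep ∷_) (flat-++ O (l ∷ []))))
    (trans (++-ʳ++ (sep ∷ flat O) {syms l ++ sep ∷ []} {R})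
    (trans (++-ʳ++ (syms l) {sep ∷ []})
           (cong (sep ∷_) (trans (ʳ++-defn (syms l)) (cong (_++ (flat ([] ∷ O) ʳ++ R)) (sym (reverse-map bitSym l)))))))
  R₁ : List Sym
  R₁ = syms (reverse l) ++ (flat ([] ∷ O) ʳ++ blanks (suc r₁))
  reach : Runs (skipLists (suc (suc (length O)))) (End ([] ∷ O ++ l ∷ S) r₁) (2 * cells O′ + 1) (tape (flat S) sep R₁)
  reach = subst₂ (λ k w → Runs (skipLists k) (tape w blank (blanks r₁)) (2 * cells O′ + 1) (tape (flat S) sep R₁)) O′-length O′-flat
    (runs-≡ refl (cong (focus (flat S)) (O′-rev (blanks (suc r₁))))
      (runs-skipLists O′ (flat S) blank (blanks r₁)))
  out-eq : syms (reverse l) ʳ++ (sep ∷ flat S) ≡ flat (l ∷ S)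
  out-eq = trans (cong (_ʳ++ (sep ∷ flat S)) (reverse-map bitSym l)) (ʳ++-reverse (syms l) (sep ∷ flat S))
  copy-eq : reverse l ʳ++ [] ≡ l
  copy-eq = reverse-involutive l
  copy′ : Runs (loop isBit (sw copyBit)) (focus (sep ∷ flat S) R₁) (length l * (4 * (length l + 0 + cells O) + 7) + 1)
               (focus (flat (l ∷ S)) (flat (l ∷ O) ʳ++ blanks r₂))
  copy′ = runs-weaken (≤-reflexive (cong (λ k → k * (4 * (k + 0 + cells O) + 7) + 1) (length-reverse l)))
    (runs-≡ refl (cong₂ (λ a b → focus a (flat (b ∷ O) ʳ++ blanks r₂)) out-eq copy-eq) copy)
  finish : Runs (toRight nonBlank) (focus (flat (l ∷ S)) (flat (l ∷ O) ʳ++ blanks r₂)) (2 * (suc (length l) + cells O) + 1)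
                (End (l ∷ O ++ l ∷ S) (pred r₂))
  finish = subst₂ (λ a b → Runs _ (focus (flat (l ∷ S)) a) _ (tape b blank _))
    (sym (ʳ++-defn (flat (l ∷ O))))
    (trans (ʳ++-reverse (flat (l ∷ O)) (flat (l ∷ S))) (sym (flat-++ (l ∷ O) (l ∷ S))))
    (runs-weaken (≤-reflexive (cong (λ t → 2 * t + 1) (trans (length-reverse (flat (l ∷ O))) (length-flat (l ∷ O)))))
      (runs-toRight (reverse (flat (l ∷ O))) (flat (l ∷ S)) r₂ (all-ʳ++ (flat-nonBlank (l ∷ O)) [])))
  eq : ∀ a z → 1 + (2 * suc (z + (suc a + 0)) + 1 + (1 + (a * (4 * (a + 0 + z) + 7) + 1 + (2 * (suc a + z) + 1)))) + (6 * a + 4 * z + 7) ≡ (a + 2) * (4 * (a + z) + 9) 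
  eq = solve-∀
  time-le : 1 + (2 * cells O′ + 1 + (1 + (length l * (4 * (length l + 0 + cells O) + 7) + 1 + (2 * (suc (length l) + cells O) + 1)))) ≤ pickTime (length l) (cells O)
  time-le = ≤-trans (m≤m+n _ (6 * length l + 4 * cells O + 7)) (≤-reflexive (trans (cong (λ t → 1 + (2 * t + 1 + rest) + (6 * length l + 4 * cells O + 7)) O′-cells) (eq (length l) (cells O))))
    where
    rest : ℕ
    rest = 1 + (length l * (4 * (length l + 0 + cells O) + 7) + 1 + (2 * (suc (length l) + cells O) + 1))

pop : Cmd → Cmd → Cmd → Cmd
pop c d₀ d₁ = act id left ⨾ sw λ
  { b0  → act (const blank) stay ⨾ d₀
  ; b1  → act (const blank) stay ⨾ d₁
  ; _   → act id right ⨾ c }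

stk-pop-[] : ∀ {c d₀ d₁ S b S′} → c ∶ [] ∷ S ⇒[ b ] S′ → pop c d₀ d₁ ∶ [] ∷ S ⇒[ 3 + b ] S′
from (stk-pop-[] p) r with from p r
... | r′ , R = r′ , runs-act ⨾ᵣ runs-sw (runs-act ⨾ᵣ R)

stk-pop-∷ : ∀ {c d₀ d₁ S S′ b} x {l} → (if x then d₁ else d₀) ∶ l ∷ S ⇒[ b ] S′ →
            pop c d₀ d₁ ∶ (x ∷ l) ∷ S ⇒[ 3 + b ] S′
from (stk-pop-∷ false p) r with from p (suc r)
... | r′ , R = r′ , runs-act ⨾ᵣ runs-sw (runs-act ⨾ᵣ R)
from (stk-pop-∷ true p) r with from p (suc r)
... | r′ , R = r′ , runs-act ⨾ᵣ runs-sw (runs-act ⨾ᵣ R)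

popBranch : Cmd → Cmd → Cmd
popBranch d₀ d₁ = sw λ
  { b1 → act (const blank) stay ⨾ d₁
  ; _  → act (const blank) stay ⨾ d₀ }

popEach : Cmd → Cmd → Cmd
popEach d₀ d₁ = act id left ⨾ loop isBit (popBranch d₀ d₁ ⨾ act id left) ⨾ act id right

module _ {A : Set} {d₀ d₁ : Cmd} {w : ℕ} (st : A → List Bits) (f : A → Bool → A)
         (I : A → Bits → Set) (I-step : ∀ a x l → I a (x ∷ l) → I (f a x) l)
         (step : ∀ a x l → I a (x ∷ l) → (if x then d₁ else d₀) ∶ l ∷ st a ⇒[ w ] l ∷ st (f a x)) where

  private
    once : ∀ a x l r → (if x then d₁ else d₀) ∶ l ∷ st a ⇒[ w ] l ∷ st (f a x) → Σ ℕ λ r′ →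
      Runs (popBranch d₀ d₁) (tape (flat (l ∷ st a)) (bitSym x) (blanks (suc r))) (2 + w) (End (l ∷ st (f a x)) r′)
    once a false l r p with from p (suc r)
    ... | r′ , R = r′ , runs-sw (runs-act ⨾ᵣ R)
    once a true l r p with from p (suc r)
    ... | r′ , R = r′ , runs-sw (runs-act ⨾ᵣ R)

  -- The invariant also speaks about the bits still unread. This lets a fold distribute a size
  -- budget over them and keep one time bound `w` for all rounds.
  stk-popEach : ∀ a l → I a l → popEach d₀ d₁ ∶ l ∷ st a ⇒[ length l * (w + 4) + 3 ] [] ∷ st (foldl f a l)
  from (stk-popEach a [] i) r = r , runs-act ⨾ᵣ runs-done refl ⨾ᵣ runs-act
  from (stk-popEach a (x ∷ l) i) r with once a x l r (step a x l i)
  ... | r₁ , runs {t₁} le₁ E₁ with from (stk-popEach (f a x) l (I-step a x l i)) r₁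
  ... | r₂ , runs le₂ (xseq {t = t₂} E₂ (xseq {t = t₃} {t′ = t₄} E₃ E₄)) = r₂ , runs time-le
      (xseq xact (xseq (xmore (isBit-bitSym x) (xseq E₁ E₂) E₃) E₄))
    where
    e₁ : ∀ a b c t → 1 + (suc (t + a + b) + c) ≡ 2 + t + (a + (b + c))
    e₁ = solve-∀
    e₂ : ∀ w n → 2 + (2 + w) + (n * (w + 4) + 3) ≡ suc n * (w + 4) + 3
    e₂ = solve-∀
    time-le : 1 + (suc (t₁ + t₂ + t₃) + t₄) ≤ suc (length l) * (w + 4) + 3
    time-le = ≤-trans (≤-reflexive (e₁ t₂ t₃ t₄ t₁))
      (≤-trans (+-mono-≤ (+-monoʳ-≤ 2 le₁) le₂) (≤-reflexive (e₂ w (length l))))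

-- Polynomial-time functions on tuples of bit strings

-- The base is at least 2, so a constant `k` lies below `poly k` and a sum costs one more in the
-- exponent. A single number thus describes a polynomial bound.
poly : ℕ → ℕ → ℕ
poly e s = (2 + s) ^ e

poly-monoˡ : ∀ {e e′} s → e ≤ e′ → poly e s ≤ poly e′ s
poly-monoˡ s = ^-monoʳ-≤ (2 + s)

poly-monoʳ : ∀ e {s s′} → s ≤ s′ → poly e s ≤ poly e s′
poly-monoʳ e p = ^-monoˡ-≤ e (+-monoʳ-≤ 2 p)

1≤poly : ∀ e s → 1 ≤ poly e s
1≤poly e s = m^n>0 (2 + s) e

k≤poly : ∀ k s → k ≤ poly k s
k≤poly zero    s = z≤n
k≤poly (suc k) s = begin
  suc k                     ≤⟨ +-mono-≤ (1≤poly k s) (k≤poly k s) ⟩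
  poly k s + poly k s       ≡⟨ cong (poly k s +_) (sym (+-identityʳ _)) ⟩
  2 * poly k s              ≤⟨ *-monoˡ-≤ (poly k s) (m≤m+n 2 s) ⟩
  poly (suc k) s            ∎
  where open ≤-Reasoning

PolyBounded : {A : Set} → (A → ℕ) → (A → ℕ) → Set
PolyBounded size t = Σ ℕ λ e → ∀ a → t a ≤ poly e (size a)

module _ {A : Set} {s : A → ℕ} where

  pb-≤ : ∀ {t u} → (∀ a → t a ≤ u a) → PolyBounded s u → PolyBounded s t
  pb-≤ t≤u (e , p) = e , λ a → ≤-trans (t≤u a) (p a)

  pb-const : ∀ k → PolyBounded s (λ _ → k)
  pb-const k = k , λ a → k≤poly k (s a)

  pb-size : PolyBounded s s
  pb-size = 1 , λ a → ≤-trans (m≤n+m (s a) 2) (≤-reflexive (sym (*-identityʳ (2 + s a))))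

  pb-+ : ∀ {t u} → PolyBounded s t → PolyBounded s u → PolyBounded s (λ a → t a + u a)
  pb-+ {t} {u} (e , p) (e′ , q) = suc (e + e′) , λ a → begin
    t a + u a                                    ≤⟨ +-mono-≤ (≤-trans (p a) (poly-monoˡ (s a) (m≤m+n e e′)))
                                                             (≤-trans (q a) (poly-monoˡ (s a) (m≤n+m e′ e))) ⟩
    poly (e + e′) (s a) + poly (e + e′) (s a)    ≡⟨ cong (poly (e + e′) (s a) +_) (sym (+-identityʳ _)) ⟩
    2 * poly (e + e′) (s a)                      ≤⟨ *-monoˡ-≤ (poly (e + e′) (s a)) (m≤m+n 2 (s a)) ⟩
    poly (suc (e + e′)) (s a)                    ∎
    where open ≤-Reasoning

  pb-* : ∀ {t u} → PolyBounded s t → PolyBounded s u → PolyBounded s (λ a → t a * u a)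
  pb-* {t} {u} (e , p) (e′ , q) = e + e′ , λ a → ≤-trans (*-mono-≤ (p a) (q a))
    (≤-reflexive (sym (^-distribˡ-+-* (2 + s a) e e′)))

  pb-^ : ∀ {t} k → PolyBounded s t → PolyBounded s (λ a → t a ^ k)
  pb-^ zero    p = pb-const 1
  pb-^ (suc k) p = pb-* p (pb-^ k p)

  pb-poly : ∀ {t} k → PolyBounded s t → PolyBounded s (λ a → poly k (t a))
  pb-poly k p = pb-^ k (pb-+ (pb-const 2) p)

infixr 6 _⊗_

data Ty : Set where
  bool bits : Ty
  _⊗_ : Ty → Ty → Ty

⟦_⟧ : Ty → Set
⟦ bool ⟧  = Bool
⟦ bits ⟧  = Bits
⟦ a ⊗ b ⟧ = ⟦ a ⟧ × ⟦ b ⟧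

enc : ∀ a → ⟦ a ⟧ → List Bits
enc bool    x       = (x ∷ []) ∷ []
enc bits    l       = l ∷ []
enc (a ⊗ b) (x , y) = enc a x ++ enc b y

-- Unlike `enc a x ++ S`, this unfolds on pairs without any use of associativity, so that programs
-- on components compose directly.
push : ∀ a → ⟦ a ⟧ → List Bits → List Bits
push bool    x       S = (x ∷ []) ∷ S
push bits    l       S = l ∷ S
push (a ⊗ b) (x , y) S = push a x (push b y S)

arity : Ty → ℕ
arity bool    = 1
arity bits    = 1
arity (a ⊗ b) = arity a + arity b

push-enc : ∀ a x S → push a x S ≡ enc a x ++ S
push-enc bool    x       S = refl
push-enc bits    l       S = refl
push-enc (a ⊗ b) (x , y) S = trans (push-enc a x (push b y S))
  (trans (cong (enc a x ++_) (push-enc b y S)) (sym (++-assoc (enc a x) (enc b y) S)))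

length-enc : ∀ a x → length (enc a x) ≡ arity a
length-enc bool    x       = refl
length-enc bits    l       = refl
length-enc (a ⊗ b) (x , y) = trans (length-++ (enc a x)) (cong₂ _+_ (length-enc a x) (length-enc b y))

size : ∀ a → ⟦ a ⟧ → ℕ
size bool    x       = 2
size bits    l       = suc (length l)
size (a ⊗ b) (x , y) = size a x + size b y

cells-enc : ∀ a x → cells (enc a x) ≡ size a x
cells-enc bool    x       = refl
cells-enc bits    l       = +-identityʳ _
cells-enc (a ⊗ b) (x , y) = trans (cells-++ (enc a x) (enc b y)) (cong₂ _+_ (cells-enc a x) (cells-enc b y))

delLists : ℕ → ℕ → Cmd
delLists j zero    = nop
delLists j (suc k) = delList j ⨾ delLists j k

stk-delLists : ∀ O A {S} → delLists (length O) (length A) ∶ O ++ A ++ S ⇒[ cells A * (7 * cells O + 6) + 1 ] O ++ S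
stk-delLists O []      = stk-nop
stk-delLists O (l ∷ A) = stk-weaken (≤-reflexive (eq (suc (length l)) (cells A) (7 * cells O + 6)))
  (stk-delList O ⨾ₛ stk-delLists O A)
  where
  eq : ∀ a b c → a * c + (b * c + 1) ≡ (a + b) * c + 1
  eq = solve-∀

-- The deepest string is copied first, which preserves the order; once `k` copies lie on top, the
-- remaining string at depth `j` is found at depth `k + j`.
copyLists : ℕ → ℕ → Cmd
copyLists j zero    = nop
copyLists j (suc k) = copyLists (suc j) k ⨾ pickList (k + j)

copyTime : ℕ → ℕ → ℕ
copyTime z k = k * pickTime z z + 1

pickTime-mono : ∀ {a b z} → a ≤ z → b ≤ z → pickTime a b ≤ pickTime z z
pickTime-mono p q = *-mono-≤ (+-monoˡ-≤ 2 p) (+-monoˡ-≤ 9 (*-monoʳ-≤ 4 (+-mono-≤ p q)))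

stk-copyLists : ∀ O A {S} → copyLists (length O) (length A) ∶ O ++ A ++ S
                  ⇒[ copyTime (cells O + cells A) (length A) ] A ++ O ++ A ++ S
stk-copyLists O [] = stk-nop
stk-copyLists O (a ∷ A) {S} = stk-weaken time-le (rest ⨾ₛ last)
  where
  z = cells O + cells (a ∷ A)
  O′ = O ++ a ∷ []
  O′-length : length O′ ≡ suc (length O)
  O′-length = trans (length-++ O) (+-comm (length O) 1)
  O′-cells : cells O′ + cells A ≡ z
  O′-cells = trans (cong (_+ cells A) (cells-++ O (a ∷ [])))
    (trans (+-assoc (cells O) (suc (length a) + 0) (cells A)) (cong (λ u → cells O + (u + cells A)) (+-identityʳ _)))
  rest : copyLists (suc (length O)) (length A) ∶ O ++ a ∷ A ++ S ⇒[ copyTime z (length A) ] A ++ O ++ a ∷ A ++ S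
  rest with stk-copyLists O′ A {S}
  ... | p rewrite O′-length | O′-cells | ++-assoc O (a ∷ []) (A ++ S) = p
  last : pickList (length A + length O) ∶ A ++ O ++ a ∷ A ++ S ⇒[ pickTime z z ] a ∷ A ++ O ++ a ∷ A ++ S
  last with stk-pickList (A ++ O) {a} {A ++ S}
  ... | p rewrite length-++ A {O} | cells-++ A O | ++-assoc A O (a ∷ A ++ S) =
    stk-weaken (pickTime-mono {length a} {cells A + cells O} {z} a≤z
      (≤-trans (≤-reflexive (+-comm (cells A) (cells O))) (+-monoʳ-≤ (cells O) (m≤n+m (cells A) (suc (length a)))))) p
    where
    a≤z : length a ≤ z
    a≤z = ≤-trans (≤-trans (n≤1+n (length a)) (m≤m+n (suc (length a)) (cells A))) (m≤n+m _ (cells O))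
  eq : ∀ k p → k * p + 1 + p ≡ p + k * p + 1
  eq = solve-∀
  time-le : copyTime z (length A) + pickTime z z ≤ copyTime z (length (a ∷ A))
  time-le = ≤-reflexive (eq (length A) (pickTime z z))

del : Ty → ℕ → Cmd
del a j = delLists j (arity a)

stk-del : ∀ a {x} O {S} → del a (length O) ∶ O ++ push a x S ⇒[ size a x * (7 * cells O + 6) + 1 ] O ++ S
stk-del a {x} O {S} with stk-delLists O (enc a x) {S}
... | p rewrite push-enc a x S | length-enc a x | cells-enc a x = p

copy : Ty → ℕ → Cmd
copy a j = copyLists j (arity a)

stk-copy : ∀ a {x} O {S} → copy a (length O) ∶ O ++ push a x S ⇒[ copyTime (cells O + size a x) (arity a) ] push a x (O ++ push a x S)
stk-copy a {x} O {S} with stk-copyLists O (enc a x) {S}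
... | p rewrite push-enc a x S | push-enc a x (O ++ enc a x ++ S) | length-enc a x | cells-enc a x = p

stk-del-under : ∀ a b {x y S} → del b (arity a) ∶ push a x (push b y S) ⇒[ size b y * (7 * size a x + 6) + 1 ] push a x S
stk-del-under a b {x} {y} {S} with stk-del b {y} (enc a x) {S}
... | p rewrite length-enc a x | cells-enc a x | push-enc a x (push b y S) | push-enc a x S = p

stk-copy-under : ∀ a b {x y S} → copy b (arity a) ∶ push a x (push b y S) ⇒[ copyTime (size a x + size b y) (arity b) ] push b y (push a x (push b y S))
stk-copy-under a b {x} {y} {S} with stk-copy b {y} (enc a x) {S}
... | p rewrite length-enc a x | cells-enc a x | push-enc a x (push b y S) = p

-- The command works on top of an arbitrary stack `S` and leaves it intact; pairing relies on this
-- to store the argument and the other result meanwhile. The size bound feeds the cost of whatever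
-- is applied next.
record PT {a b : Ty} (f : ⟦ a ⟧ → ⟦ b ⟧) : Set where
  field
    code : Cmd
    cost : ⟦ a ⟧ → ℕ
    runs-ok : ∀ x S → code ∶ push a x S ⇒[ cost x ] push b (f x) S
    cost-poly : PolyBounded (size a) cost
    size-poly : PolyBounded (size a) (λ x → size b (f x))

open PT public

pb-copyTime : ∀ {A : Set} {s t : A → ℕ} k → PolyBounded s t → PolyBounded s (λ a → copyTime (t a) k)
pb-copyTime k p = pb-+ (pb-* (pb-const k) (pb-* (pb-+ p (pb-const 2))
  (pb-+ (pb-* (pb-const 4) (pb-+ p p)) (pb-const 9)))) (pb-const 1)

pb-delTime : ∀ {A : Set} {s t u : A → ℕ} → PolyBounded s t → PolyBounded s u →
             PolyBounded s (λ a → t a * (7 * u a + 6) + 1)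
pb-delTime p q = pb-+ (pb-* p (pb-+ (pb-* (pb-const 7) q) (pb-const 6))) (pb-const 1)

pb-∘ : ∀ {A B : Set} {s : A → ℕ} {s′ : B → ℕ} {t : B → ℕ} (f : A → B) →
       PolyBounded s′ t → PolyBounded s (λ a → s′ (f a)) → PolyBounded s (λ a → t (f a))
pb-∘ f (e , p) q = pb-≤ (λ a → p (f a)) (pb-poly e q)

idᴾ : ∀ {a} → PT {a} {a} id
idᴾ = record { code = nop ; cost = λ _ → 1 ; runs-ok = λ _ _ → stk-nop ; cost-poly = pb-const 1 ; size-poly = pb-size }

infixr 9 _∘ᴾ_

_∘ᴾ_ : ∀ {a b c} {g : ⟦ b ⟧ → ⟦ c ⟧} {f : ⟦ a ⟧ → ⟦ b ⟧} → PT {b} {c} g → PT {a} {b} f → PT {a} {c} (λ x → g (f x))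
_∘ᴾ_ {f = f} G F = record
  { code = code F ⨾ code G
  ; cost = λ x → cost F x + cost G (f x)
  ; runs-ok = λ x S → runs-ok F x S ⨾ₛ runs-ok G (f x) S
  ; cost-poly = pb-+ (cost-poly F) (pb-∘ f (cost-poly G) (size-poly F))
  ; size-poly = pb-∘ f (size-poly G) (size-poly F) }

fstᴾ : ∀ {a b} → PT {a ⊗ b} {a} proj₁
fstᴾ {a} {b} = record
  { code = del b (arity a)
  ; cost = λ (x , y) → size b y * (7 * size a x + 6) + 1
  ; runs-ok = λ (x , y) S → stk-del-under a b
  ; cost-poly = pb-delTime (pb-≤ (λ (x , y) → m≤n+m (size b y) (size a x)) pb-size)
                           (pb-≤ (λ (x , y) → m≤m+n (size a x) (size b y)) pb-size)
  ; size-poly = pb-≤ (λ (x , y) → m≤m+n (size a x) (size b y)) pb-size }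

sndᴾ : ∀ {a b} → PT {a ⊗ b} {b} proj₂
sndᴾ {a} {b} = record
  { code = del a 0
  ; cost = λ (x , y) → size a x * (7 * 0 + 6) + 1
  ; runs-ok = λ (x , y) S → stk-del a []
  ; cost-poly = pb-delTime {u = λ _ → 0} (pb-≤ (λ (x , y) → m≤m+n (size a x) (size b y)) pb-size) (pb-const 0)
  ; size-poly = pb-≤ (λ (x , y) → m≤n+m (size b y) (size a x)) pb-size }

infixr 4 _,ᴾ_

_,ᴾ_ : ∀ {a b c} {f : ⟦ a ⟧ → ⟦ b ⟧} {g : ⟦ a ⟧ → ⟦ c ⟧} → PT {a} {b} f → PT {a} {c} g → PT {a} {b ⊗ c} (λ x → f x , g x)
_,ᴾ_ {a} {b} {c} {f} {g} F G = record
  { code = copy a 0 ⨾ code G ⨾ copy a (arity c) ⨾ code F ⨾ del a (arity (b ⊗ c))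
  ; cost = λ x → copyTime (size a x) (arity a) + (cost G x + (copyTime (size c (g x) + size a x) (arity a)
                 + (cost F x + (size a x * (7 * size (b ⊗ c) (f x , g x) + 6) + 1))))
  ; runs-ok = λ x S → stk-copy a [] ⨾ₛ runs-ok G x _ ⨾ₛ stk-copy-under c a ⨾ₛ runs-ok F x _ ⨾ₛ stk-del-under (b ⊗ c) a {f x , g x}
  ; cost-poly = pb-+ (pb-copyTime (arity a) pb-size) (pb-+ (cost-poly G)
      (pb-+ (pb-copyTime (arity a) (pb-+ (size-poly G) pb-size))
        (pb-+ (cost-poly F) (pb-delTime pb-size (pb-+ (size-poly F) (size-poly G))))))
  ; size-poly = pb-+ (size-poly F) (size-poly G) }

nilᴾ : ∀ {a} → PT {a} {bits} (λ _ → [])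
nilᴾ {a} = record
  { code = del a 0 ⨾ newList
  ; cost = λ x → size a x * (7 * 0 + 6) + 1 + 1
  ; runs-ok = λ x S → stk-del a [] ⨾ₛ stk-newList
  ; cost-poly = pb-+ (pb-delTime {u = λ _ → 0} pb-size (pb-const 0)) (pb-const 1)
  ; size-poly = pb-const 1 }

boolᴾ : ∀ {a} x → PT {a} {bool} (λ _ → x)
boolᴾ {a} x = record
  { code = del a 0 ⨾ newList ⨾ pushBit x
  ; cost = λ y → size a y * (7 * 0 + 6) + 1 + 2
  ; runs-ok = λ y S → stk-del a [] ⨾ₛ stk-newList ⨾ₛ stk-pushBit
  ; cost-poly = pb-+ (pb-delTime {u = λ _ → 0} pb-size (pb-const 0)) (pb-const 2)
  ; size-poly = pb-const 2 }

ifᴾ : ∀ {a b} {f g : ⟦ a ⟧ → ⟦ b ⟧} → PT {a} {b} f → PT {a} {b} g → PT {bool ⊗ a} {b} (λ (x , v) → if x then f v else g v)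
ifᴾ {a} {b} {f} {g} F G = record
  { code = pop nop (delList 0 ⨾ code G) (delList 0 ⨾ code F)
  ; cost = λ (x , v) → 3 + (6 + (cost F v + cost G v))
  ; runs-ok = ok
  ; cost-poly = pb-+ (pb-const 3) (pb-+ (pb-const 6) (pb-+ (pb-∘ proj₂ (cost-poly F) below) (pb-∘ proj₂ (cost-poly G) below)))
  ; size-poly = pb-≤ size-le (pb-+ (pb-∘ proj₂ (size-poly F) below) (pb-∘ proj₂ (size-poly G) below)) }
  where
  below : PolyBounded (size (bool ⊗ a)) (λ (x , v) → size a v)
  below = pb-≤ (λ (x , v) → m≤n+m (size a v) 2) pb-size
  ok : ∀ ((x , v) : ⟦ bool ⊗ a ⟧) S → pop nop (delList 0 ⨾ code G) (delList 0 ⨾ code F) ∶ push (bool ⊗ a) (x , v) S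
         ⇒[ 3 + (6 + (cost F v + cost G v)) ] push b (if x then f v else g v) S
  ok (false , v) S = stk-pop-∷ false (stk-delList [] {[]} ⨾ₛ stk-weaken (m≤n+m _ (cost F v)) (runs-ok G v S))
  ok (true , v)  S = stk-pop-∷ true (stk-delList [] {[]} ⨾ₛ stk-weaken (m≤m+n _ (cost G v)) (runs-ok F v S))
  size-le : ∀ ((x , v) : ⟦ bool ⊗ a ⟧) → size b (if x then f v else g v) ≤ size b (f v) + size b (g v)
  size-le (false , v) = m≤n+m _ _
  size-le (true , v)  = m≤m+n _ _

caseBits : {A : Set} → Bits → A → (Bool → Bits → A) → A
caseBits []      n c = n
caseBits (x ∷ l) n c = c x l

caseᴾ : ∀ {a b} {f : ⟦ a ⟧ → ⟦ b ⟧} {g : ⟦ bool ⊗ bits ⊗ a ⟧ → ⟦ b ⟧} → PT {a} {b} f → PT {bool ⊗ bits ⊗ a} {b} g →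
        PT {bits ⊗ a} {b} (λ (l , v) → caseBits l (f v) (λ x l → g (x , l , v)))
caseᴾ {a} {b} {f} {g} F G = record
  { code = pop (delList 0 ⨾ code F) (branch false) (branch true)
  ; cost = cst
  ; runs-ok = ok
  ; cost-poly = pb-+ (pb-const 11) (pb-+ (pb-∘ proj₂ (cost-poly F) below) (pb-≤ cost-le (pb-+ (pb-∘ (ext false) (cost-poly G) above) (pb-∘ (ext true) (cost-poly G) above))))
  ; size-poly = pb-≤ size-le (pb-+ (pb-∘ proj₂ (size-poly F) below) (pb-+ (pb-∘ (ext false) (size-poly G) above) (pb-∘ (ext true) (size-poly G) above))) }
  where
  branch : Bool → Cmd
  branch x = newList ⨾ pushBit x ⨾ code G
  tailCost : ⟦ bits ⊗ a ⟧ → ℕ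
  tailCost ([] , v)    = 0
  tailCost (x ∷ l , v) = cost G (x , l , v)
  cst : ⟦ bits ⊗ a ⟧ → ℕ
  cst (l , v) = 11 + (cost F v + tailCost (l , v))
  -- A bound cannot depend on which bit comes first, so the costs for both possible bits are added.
  ext : Bool → ⟦ bits ⊗ a ⟧ → ⟦ bool ⊗ bits ⊗ a ⟧
  ext x (l , v) = x , tail l , v
    where
    tail : Bits → Bits
    tail []      = []
    tail (_ ∷ l) = l
  below : PolyBounded (size (bits ⊗ a)) (λ (l , v) → size a v)
  below = pb-≤ (λ (l , v) → m≤n+m (size a v) (suc (length l))) pb-size
  above : ∀ {x} → PolyBounded (size (bits ⊗ a)) (λ p → size (bool ⊗ bits ⊗ a) (ext x p))
  above {x} = pb-≤ (λ { ([] , v) → ≤-refl ; (_ ∷ l , v) → n≤1+n _ }) (pb-+ (pb-const 2) pb-size)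
  cost-le : ∀ p → tailCost p ≤ cost G (ext false p) + cost G (ext true p)
  cost-le ([] , v)        = z≤n
  cost-le (false ∷ l , v) = m≤m+n _ _
  cost-le (true ∷ l , v)  = m≤n+m _ _
  size-le : ∀ ((l , v) : ⟦ bits ⊗ a ⟧) → size b (caseBits l (f v) (λ x l → g (x , l , v))) ≤ size b (f v) + (size b (g (ext false (l , v))) + size b (g (ext true (l , v))))
  size-le ([] , v)        = m≤m+n _ _
  size-le (false ∷ l , v) = ≤-trans (m≤m+n _ (size b (g (true , l , v)))) (m≤n+m _ (size b (f v)))
  size-le (true ∷ l , v)  = ≤-trans (m≤n+m _ (size b (g (false , l , v)))) (m≤n+m _ (size b (f v)))
  branch-if : ∀ x → (if x then branch true else branch false) ≡ branch x
  branch-if false = refl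
  branch-if true  = refl
  ok : ∀ ((l , v) : ⟦ bits ⊗ a ⟧) S → pop (delList 0 ⨾ code F) (branch false) (branch true) ∶ push (bits ⊗ a) (l , v) S
         ⇒[ cst (l , v) ] push b (caseBits l (f v) (λ x l → g (x , l , v))) S
  ok ([] , v) S = stk-weaken (+-mono-≤ {9} {11} (m≤n+m 9 2) (m≤m+n (cost F v) 0))
    (stk-pop-[] (stk-delList [] {[]} ⨾ₛ runs-ok F v S))
  ok (x ∷ l , v) S = stk-weaken (+-mono-≤ {5} {11} (m≤n+m 5 6) (m≤n+m _ (cost F v)))
    (stk-pop-∷ x (subst (λ c → c ∶ l ∷ push a v S ⇒[ 2 + cost G (x , l , v) ] push b (g (x , l , v)) S) (sym (branch-if x))
      (stk-newList ⨾ₛ stk-pushBit ⨾ₛ runs-ok G (x , l , v) S)))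

consᴾ : PT {bool ⊗ bits} {bits} (λ (x , l) → x ∷ l)
consᴾ = record
  { code = pop nop (delList 0 ⨾ pushBit false) (delList 0 ⨾ pushBit true)
  ; cost = λ _ → 10
  ; runs-ok = λ { (false , l) S → stk-pop-∷ false (stk-delList [] {[]} ⨾ₛ stk-pushBit)
                ; (true , l)  S → stk-pop-∷ true  (stk-delList [] {[]} ⨾ₛ stk-pushBit) }
  ; cost-poly = pb-const 10
  ; size-poly = pb-≤ (λ (x , l) → n≤1+n (suc (suc (length l)))) pb-size }

module _ {a g : Ty} {f : ⟦ bool ⊗ a ⊗ g ⟧ → ⟦ a ⟧} (F : PT {bool ⊗ a ⊗ g} {a} f)
         (e : ℕ) (growth : ∀ x u v → size a (f (x , u , v)) ≤ size a u + poly e (size g v)) where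

  private
    step : ⟦ g ⟧ → ⟦ a ⟧ → Bool → ⟦ a ⟧
    step v u x = f (x , u , v)

    body : Bool → Cmd
    body x = copy (a ⊗ g) 1 ⨾ newList ⨾ pushBit x ⨾ code F ⨾ del a (arity (a ⊗ bits))
           ⨾ copy bits (arity a) ⨾ del bits (arity (bits ⊗ a))

    -- W bounds the size of every accumulator of the loop.
    bodyTime : ℕ → ℕ → ℕ → ℕ
    bodyTime W L V = copyTime (L + (W + V)) (arity (a ⊗ g)) + (1 + (1 + (poly (proj₁ (cost-poly F)) (2 + (W + V))
      + ((W * (7 * (W + L) + 6) + 1) + (copyTime (W + L) 1 + (L * (7 * (L + W) + 6) + 1))))))

    copyTime-mono : ∀ {z z′} k → z ≤ z′ → copyTime z k ≤ copyTime z′ k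
    copyTime-mono k p = +-monoˡ-≤ 1 (*-monoʳ-≤ k (pickTime-mono p p))

    body-ok : ∀ {W L} x l u v S → size a u ≤ W → size a (f (x , u , v)) ≤ W → suc (length l) ≤ L →
      body x ∶ l ∷ push (a ⊗ g) (u , v) S ⇒[ bodyTime W L (size g v) ] l ∷ push (a ⊗ g) (f (x , u , v) , v) S
    body-ok {W} {L} x l u v S u≤ u′≤ l≤ =
      stk-weaken (copyTime-mono (arity (a ⊗ g)) (+-mono-≤ (≤-trans (≤-reflexive (+-identityʳ _)) l≤) (+-monoˡ-≤ _ u≤))) (stk-copy (a ⊗ g) {u , v} (l ∷ []))
      ⨾ₛ stk-newList ⨾ₛ stk-pushBit
      ⨾ₛ stk-weaken (≤-trans (proj₂ (cost-poly F) _) (poly-monoʳ (proj₁ (cost-poly F)) (+-monoʳ-≤ 2 (+-monoˡ-≤ _ u≤))))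
           (runs-ok F (x , u , v) (l ∷ push a u (push g v S)))
      ⨾ₛ stk-weaken (+-monoˡ-≤ 1 (*-mono-≤ u≤ (+-monoˡ-≤ 6 (*-monoʳ-≤ 7 (+-mono-≤ u′≤ l≤)))))
           (stk-del-under (a ⊗ bits) a {f (x , u , v) , l} {u} {push g v S})
      ⨾ₛ stk-weaken (copyTime-mono 1 (+-mono-≤ u′≤ l≤)) (stk-copy-under a bits {f (x , u , v)} {l} {push g v S})
      ⨾ₛ stk-weaken (+-monoˡ-≤ 1 (*-mono-≤ l≤ (+-monoˡ-≤ 6 (*-monoʳ-≤ 7 (+-mono-≤ l≤ u′≤)))))
           (stk-del-under (bits ⊗ a) bits {l , f (x , u , v)} {l} {push g v S})

    maxSize : ⟦ bits ⊗ a ⊗ g ⟧ → ℕ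
    maxSize (l , u , v) = size a u + length l * poly e (size g v)

    loopTime : ⟦ bits ⊗ a ⊗ g ⟧ → ℕ
    loopTime (l , u , v) = length l * (bodyTime (maxSize (l , u , v)) (suc (length l)) (size g v) + 4) + 3

    result : ⟦ bits ⊗ a ⊗ g ⟧ → ⟦ a ⟧
    result (l , u , v) = foldl (step v) u l

    result-size : ∀ l u v → size a (result (l , u , v)) ≤ maxSize (l , u , v)
    result-size []      u v = m≤m+n _ 0
    result-size (x ∷ l) u v = ≤-trans (result-size l (step v u x) v)
      (≤-trans (+-monoˡ-≤ _ (growth x u v)) (≤-reflexive (+-assoc (size a u) _ _)))

    loop-ok : ∀ l u v S → popEach (body false) (body true) ∶ l ∷ push (a ⊗ g) (u , v) S
      ⇒[ loopTime (l , u , v) ] [] ∷ push (a ⊗ g) (result (l , u , v) , v) S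
    loop-ok l₀ u₀ v S = stk-popEach (λ u → push (a ⊗ g) (u , v) S) (step v)
        (λ u l → size a u + length l * poly e (size g v) ≤ W × suc (length l) ≤ suc (length l₀))
        inv once u₀ l₀ (≤-refl , ≤-refl)
      where
      W = maxSize (l₀ , u₀ , v)
      inv : ∀ u x l → _ → _
      inv u x l (p , q) = ≤-trans (≤-trans (+-monoˡ-≤ _ (growth x u v)) (≤-reflexive (+-assoc (size a u) _ _))) p , ≤-trans (n≤1+n _) q
      if-body : ∀ x → (if x then body true else body false) ≡ body x
      if-body false = refl
      if-body true  = refl
      once : ∀ u x l → size a u + suc (length l) * poly e (size g v) ≤ W × suc (suc (length l)) ≤ suc (length l₀) →
        (if x then body true else body false) ∶ l ∷ push (a ⊗ g) (u , v) S
          ⇒[ bodyTime W (suc (length l₀)) (size g v) ] l ∷ push (a ⊗ g) (step v u x , v) S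
      once u x l (p , q) rewrite if-body x = body-ok x l u v S (≤-trans (m≤m+n _ _) p)
        (≤-trans (growth x u v) (≤-trans (+-monoʳ-≤ (size a u) (m≤m+n _ _)) p)) (≤-trans (n≤1+n _) q)

  -- Each round may add to the accumulator only a polynomial in the fixed context `v`. Hence its
  -- size stays polynomial over all rounds, whereas a bound that merely multiplied the size could
  -- compound to exponential growth.
  foldᴾ : PT {bits ⊗ a ⊗ g} {a} (λ (l , u , v) → foldl (λ u x → f (x , u , v)) u l)
  foldᴾ = record
    { code = popEach (body false) (body true) ⨾ delList 0 ⨾ del g (arity a)
    ; cost = λ (l , u , v) → loopTime (l , u , v) + (6 + (size g v * (7 * size a (result (l , u , v)) + 6) + 1))
    ; runs-ok = λ (l , u , v) S → loop-ok l u v S ⨾ₛ stk-delList [] {[]} ⨾ₛ stk-del-under a g {result (l , u , v)}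
    ; cost-poly = pb-+ (pb-+ (pb-* L-poly (pb-+ body-poly (pb-const 4))) (pb-const 3))
                       (pb-+ (pb-const 6) (pb-delTime V-poly R-poly))
    ; size-poly = R-poly }
    where
    s = size (bits ⊗ a ⊗ g)
    L-poly : PolyBounded s (λ (l , u , v) → length l)
    L-poly = pb-≤ (λ (l , u , v) → ≤-trans (n≤1+n (length l)) (m≤m+n (suc (length l)) _)) pb-size
    V-poly : PolyBounded s (λ (l , u , v) → size g v)
    V-poly = pb-≤ (λ (l , u , v) → ≤-trans (m≤n+m (size g v) (size a u)) (m≤n+m _ (suc (length l)))) pb-size
    U-poly : PolyBounded s (λ (l , u , v) → size a u)
    U-poly = pb-≤ (λ (l , u , v) → ≤-trans (m≤m+n (size a u) (size g v)) (m≤n+m _ (suc (length l)))) pb-size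
    W-poly : PolyBounded s maxSize
    W-poly = pb-+ U-poly (pb-* L-poly (pb-poly e V-poly))
    R-poly : PolyBounded s (λ p → size a (result p))
    R-poly = pb-≤ (λ (l , u , v) → result-size l u v) W-poly
    L′-poly : PolyBounded s (λ (l , u , v) → suc (length l))
    L′-poly = pb-+ (pb-const 1) L-poly
    body-poly : PolyBounded s (λ (l , u , v) → bodyTime (maxSize (l , u , v)) (suc (length l)) (size g v))
    body-poly = pb-+ (pb-copyTime (arity (a ⊗ g)) (pb-+ L′-poly (pb-+ W-poly V-poly)))
      (pb-+ (pb-const 1) (pb-+ (pb-const 1) (pb-+ (pb-poly (proj₁ (cost-poly F)) (pb-+ (pb-const 2) (pb-+ W-poly V-poly)))
      (pb-+ (pb-delTime W-poly (pb-+ W-poly L′-poly)) (pb-+ (pb-copyTime 1 (pb-+ W-poly L′-poly)) (pb-delTime L′-poly (pb-+ L′-poly W-poly)))))))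

ptExt : ∀ {a b} {f f′ : ⟦ a ⟧ → ⟦ b ⟧} → (∀ x → f x ≡ f′ x) → PT {a} {b} f → PT {a} {b} f′
ptExt {a} {b} eq F = record
  { code = code F
  ; cost = cost F
  ; runs-ok = λ x S → subst (λ y → code F ∶ push a x S ⇒[ cost F x ] push b y S) (eq x) (runs-ok F x S)
  ; cost-poly = cost-poly F
  ; size-poly = pb-≤ (λ x → ≤-reflexive (cong (size b) (sym (eq x)))) (size-poly F) }

-- From polynomial-time predicates to Turing machines on encoded triples

module _ {f : ⟦ bits ⊗ bits ⊗ bits ⟧ → Bool} (F : PT {bits ⊗ bits ⊗ bits} {bool} f) where

  -- A separator written to the left of the input turns the tape into a stack without any copying.
  -- Its top is the right end of the input, so the predicate receives `z`, `y`, `x` in this order,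
  -- each reversed.
  decider : Cmd
  decider = act id left ⨾ act (const sep) right ⨾ toRight nonBlank ⨾ code F ⨾ act id left

  private
    input : Bits → Bits → Bits → ⟦ bits ⊗ bits ⊗ bits ⟧
    input x y z = reverse z , reverse y , reverse x

    syms-ʳ++ : ∀ l R → syms l ʳ++ R ≡ syms (reverse l) ++ R
    syms-ʳ++ l R = trans (ʳ++-defn (syms l)) (cong (_++ R) (sym (reverse-map bitSym l)))

    encode3-ʳ++ : ∀ x y z → encode3 x y z ʳ++ (sep ∷ []) ≡ flat (push (bits ⊗ bits ⊗ bits) (input x y z) [])
    encode3-ʳ++ x y z = trans (++-ʳ++ (syms x) {sep ∷ syms y ++ sep ∷ syms z} {sep ∷ []})
      (trans (++-ʳ++ (syms y) {sep ∷ syms z})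
      (trans (syms-ʳ++ z _) (cong (λ R → syms (reverse z) ++ sep ∷ R)
      (trans (syms-ʳ++ y _) (cong (λ R → syms (reverse y) ++ sep ∷ R)
      (syms-ʳ++ x (sep ∷ [])))))))

    encode3-nonBlank : ∀ x y z → All (λ s → nonBlank s ≡ true) (encode3 x y z)
    encode3-nonBlank x y z = All.++⁺ (syms-nonBlank x) (refl ∷ All.++⁺ (syms-nonBlank y) (refl ∷ syms-nonBlank z))

    initConf-focus : ∀ M w → initConf M w ≡ at (TM.start M) (focus [] w)
    initConf-focus M []      = refl
    initConf-focus M (c ∷ w) = refl

    deciderTime : Bits → Bits → Bits → ℕ
    deciderTime x y z = 1 + (1 + ((2 * length (encode3 x y z) + 1) + (cost F (input x y z) + 1)))

    enter : ∀ x y z → Runs (act id left) (focus [] (encode3 x y z)) 1 (tape [] blank (encode3 x y z))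
    enter []      y z = runs-act
    enter (_ ∷ _) y z = runs-act

    runs-decider : ∀ x y z → Σ ℕ λ r → Runs decider (focus [] (encode3 x y z)) (deciderTime x y z)
      (tape (sep ∷ []) (bitSym (f (input x y z))) (blank ∷ blanks r))
    runs-decider x y z with from (runs-ok F (input x y z) []) 0
    ... | r , R = r , enter x y z ⨾ᵣ runs-actʳ ⨾ᵣ arrive ⨾ᵣ R ⨾ᵣ runs-act
      where
      w = encode3 x y z
      arrive : Runs (toRight nonBlank) (focus (sep ∷ []) w) (2 * length w + 1) (End (push (bits ⊗ bits ⊗ bits) (input x y z) []) 0)
      arrive = runs-≡ (cong (focus (sep ∷ [])) (++-identityʳ w)) (cong (λ l → tape l blank []) (encode3-ʳ++ x y z))
        (runs-toRight w (sep ∷ []) 0 (encode3-nonBlank x y z))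

    isOne-bitSym : ∀ b → isOne (bitSym b) ≡ b
    isOne-bitSym false = refl
    isOne-bitSym true  = refl

    run-decider : ∀ x y z t → suc (deciderTime x y z) ≤ t →
      run (compile decider) t (initConf (compile decider) (encode3 x y z)) ≡ just (f (input x y z))
    run-decider x y z t le with runs-decider x y z
    ... | r , runs w E = trans (cong (run (compile decider) t) (initConf-focus (compile decider) (encode3 x y z)))
      (trans (compile-correct E t (≤-trans (s≤s w) le)) (cong just (isOne-bitSym (f (input x y z)))))

    total : Bits × Bits × Bits → ℕ
    total (x , y , z) = length x + length y + length z

    length-encode3 : ∀ x y z → length (encode3 x y z) ≡ length x + suc (length y + suc (length z))
    length-encode3 x y z = trans (length-++ (syms x)) (cong₂ (λ a b → a + suc b) (length-map bitSym x)
      (trans (length-++ (syms y)) (cong₂ (λ a b → a + suc b) (length-map bitSym y) (length-map bitSym z))))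

    decider-poly : PolyBounded total (λ (x , y , z) → suc (deciderTime x y z))
    decider-poly = pb-+ (pb-const 3) (pb-+ (pb-+ (pb-* (pb-const 2) length-poly) (pb-const 1))
        (pb-+ (pb-∘ (λ (x , y , z) → input x y z) (cost-poly F) input-poly) (pb-const 1)))
      where
      eq₁ : ∀ a b c → a + suc (b + suc c) ≡ 2 + (a + b + c)
      eq₁ = solve-∀
      eq₂ : ∀ a b c → suc c + (suc b + suc a) ≡ 3 + (a + b + c)
      eq₂ = solve-∀
      length-poly : PolyBounded total (λ (x , y , z) → length (encode3 x y z))
      length-poly = pb-≤ (λ (x , y , z) → ≤-reflexive (trans (length-encode3 x y z) (eq₁ (length x) (length y) (length z))))
        (pb-+ (pb-const 2) pb-size)
      input-poly : PolyBounded total (λ (x , y , z) → size (bits ⊗ bits ⊗ bits) (input x y z))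
      input-poly = pb-≤ (λ (x , y , z) → ≤-reflexive (trans
          (cong₂ (λ c p → suc c + p) (length-reverse z) (cong₂ (λ b a → suc b + suc a) (length-reverse y) (length-reverse x)))
          (eq₂ (length x) (length y) (length z))))
        (pb-+ (pb-const 3) pb-size)

  abstract
    pt-decidable : Σ TM λ M → Σ ℕ λ e → ∀ x y z t → poly e (length x + length y + length z) ≤ t →
      run M t (initConf M (encode3 x y z)) ≡ just (f (reverse z , reverse y , reverse x))
    pt-decidable = compile decider , proj₁ decider-poly , λ x y z t le →
      run-decider x y z t (≤-trans (proj₂ decider-poly (x , y , z)) le)

-- Range avoidance: comparing two claims about the preimage tree

eqᵇ : Bits → Bits → Bool
eqᵇ []      []      = true
eqᵇ []      (_ ∷ _) = false
eqᵇ (_ ∷ _) []      = false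
eqᵇ (x ∷ l) (y ∷ m) = (if x then y else not y) ∧ eqᵇ l m

eqᵇ-refl : ∀ l → eqᵇ l l ≡ true
eqᵇ-refl []          = refl
eqᵇ-refl (false ∷ l) = eqᵇ-refl l
eqᵇ-refl (true ∷ l)  = eqᵇ-refl l

eqᵇ-sound : ∀ l m → eqᵇ l m ≡ true → l ≡ m
eqᵇ-sound []          []          e = refl
eqᵇ-sound (false ∷ l) (false ∷ m) e = cong (false ∷_) (eqᵇ-sound l m e)
eqᵇ-sound (true ∷ l)  (true ∷ m)  e = cong (true ∷_) (eqᵇ-sound l m e)

eqᵇ-sym : ∀ l m → eqᵇ l m ≡ eqᵇ m l
eqᵇ-sym []          []          = refl
eqᵇ-sym []          (_ ∷ _)     = refl
eqᵇ-sym (_ ∷ _)     []          = refl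
eqᵇ-sym (false ∷ l) (false ∷ m) = eqᵇ-sym l m
eqᵇ-sym (false ∷ l) (true ∷ m)  = refl
eqᵇ-sym (true ∷ l)  (false ∷ m) = refl
eqᵇ-sym (true ∷ l)  (true ∷ m)  = eqᵇ-sym l m

∧-true : ∀ {x y} → x ∧ y ≡ true → x ≡ true × y ≡ true
∧-true {true} {true} _ = refl , refl

-- Lexicographic order and least witnesses

less : Bits → Bits → Bool
less []      _       = false
less (_ ∷ _) []      = false
less (x ∷ l) (y ∷ m) = if x then (if y then less l m else false) else (if y then true else less l m)

orElse : Maybe Bits → Maybe Bits → Maybe Bits
orElse (just v) _ = just v
orElse nothing  m = m

-- Exhaustive search. It enters the definition of the language and of the honest claim, but never
-- the verifier.
first : ℕ → (Bits → Bool) → Maybe Bits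
first zero    P = if P [] then just [] else nothing
first (suc k) P = orElse (Maybe.map (false ∷_) (first k (P ∘ (false ∷_))))
                         (Maybe.map (true ∷_) (first k (P ∘ (true ∷_))))

-- Both comparisons are recorded: `judge` and `smaller` only ask whether the string presented first
-- is less, and the least one may be on either side.
Beats : Bits → Bits → Set
Beats v v′ = less v v′ ≡ true × less v′ v ≡ false

record IsFirst (k : ℕ) (P : Bits → Bool) (v : Bits) : Set where
  field
    holds : P v ≡ true
    len   : length v ≡ k
    least : ∀ v′ → length v′ ≡ k → P v′ ≡ true → v′ ≡ v ⊎ Beats v v′

first-nothing : ∀ k P → first k P ≡ nothing → ∀ v → length v ≡ k → P v ≡ false
first-nothing zero P e [] refl with P []
... | false = refl
first-nothing (suc k) P e (x ∷ v) p
  with first k (P ∘ (false ∷_)) in e₀ | first k (P ∘ (true ∷_)) in e₁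
first-nothing (suc k) P e (false ∷ v) p | nothing | nothing = first-nothing k _ e₀ v (suc-injective p)
first-nothing (suc k) P e (true ∷ v)  p | nothing | nothing = first-nothing k _ e₁ v (suc-injective p)

false≢true : ∀ {x} → x ≡ false → ¬ x ≡ true
false≢true refl ()

first-just : ∀ k P {v} → first k P ≡ just v → IsFirst k P v
first-just zero P e with P [] in e₀
first-just zero P refl | true = record { holds = e₀ ; len = refl ; least = λ { [] _ _ → inj₁ refl } }
first-just (suc k) P e with first k (P ∘ (false ∷_)) in e₀
first-just (suc k) P refl | just v = record { holds = holds ; len = cong suc len ; least = least′ }
  where
  open IsFirst (first-just k (P ∘ (false ∷_)) e₀)
  least′ : ∀ v′ → length v′ ≡ suc k → P v′ ≡ true → v′ ≡ false ∷ v ⊎ Beats (false ∷ v) v′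
  least′ (false ∷ v′) p q with least v′ (suc-injective p) q
  ... | inj₁ eq = inj₁ (cong (false ∷_) eq)
  ... | inj₂ b  = inj₂ b
  least′ (true ∷ v′) p q = inj₂ (refl , refl)
... | nothing with first k (P ∘ (true ∷_)) in e₁
first-just (suc k) P refl | nothing | just v = record { holds = holds ; len = cong suc len ; least = least′ }
  where
  open IsFirst (first-just k (P ∘ (true ∷_)) e₁)
  least′ : ∀ v′ → length v′ ≡ suc k → P v′ ≡ true → v′ ≡ true ∷ v ⊎ Beats (true ∷ v) v′
  least′ (true ∷ v′) p q with least v′ (suc-injective p) q
  ... | inj₁ eq = inj₁ (cong (true ∷_) eq)
  ... | inj₂ b  = inj₂ b
  least′ (false ∷ v′) p q = ⊥-elim (false≢true (first-nothing k _ e₀ v′ (suc-injective p)) q)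

headᵇ : Bits → Bool
headᵇ []      = false
headᵇ (x ∷ _) = x

tailᵇ : Bits → Bits
tailᵇ []      = []
tailᵇ (_ ∷ l) = l

-- Pads with zeros if l is shorter than u.
fit : Bits → Bits → Bits
fit []      l = []
fit (_ ∷ u) l = headᵇ l ∷ fit u (tailᵇ l)

length-fit : ∀ u l → length (fit u l) ≡ length u
length-fit []      l = refl
length-fit (_ ∷ u) l = cong suc (length-fit u (tailᵇ l))

fit-++ : ∀ u l m → length l ≡ length u → fit u (l ++ m) ≡ l
fit-++ []      []      m p = refl
fit-++ (_ ∷ u) (x ∷ l) m p = cong (x ∷_) (fit-++ u l m (suc-injective p))

drop-++-length : ∀ (u l m : Bits) → length l ≡ length u → drop (length u) (l ++ m) ≡ m
drop-++-length []      []      m p = refl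
drop-++-length (_ ∷ u) (x ∷ l) m p = drop-++-length u l m (suc-injective p)

flipHead : Bits → Bits
flipHead []      = []
flipHead (x ∷ l) = not x ∷ l

length-flipHead : ∀ l → length (flipHead l) ≡ length l
length-flipHead []      = refl
length-flipHead (x ∷ l) = refl

flipHead-≢ : ∀ l → 1 ≤ length l → ¬ flipHead l ≡ l
flipHead-≢ (false ∷ l) _ ()
flipHead-≢ (true ∷ l)  _ ()

choose : Bool → Bits × Bits → Bits
choose false = proj₁
choose true  = proj₂

-- A claim about a node is (defined?, value, claims about the nodes below).
Claim : Set
Claim = Bool × Bits × Bits

defined : Claim → Bool
defined = proj₁

value : Claim → Bits
value = proj₁ ∘ proj₂

-- Two undefined claims do not agree. So the walk also descends where both sides say undefined, and
-- it ends at a node whose children have undisputed values.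
agreed : Claim → Claim → Bool
agreed (f , v , _) (f′ , v′ , _) = f ∧ f′ ∧ eqᵇ v v′

agreed-sym : ∀ σ τ → agreed σ τ ≡ agreed τ σ
agreed-sym (false , v , _) (false , v′ , _) = refl
agreed-sym (false , v , _) (true , v′ , _)  = refl
agreed-sym (true , v , _) (false , v′ , _)  = refl
agreed-sym (true , v , _) (true , v′ , _)   = eqᵇ-sym v v′

-- The components are: whether the walk has stopped at a node, the path to the current node, what
-- either side claims there, and the values of the two children once it has stopped.
Walk : Set
Walk = Bool × Bits × Claim × Claim × Bits × Bits

data Verdict : Set where
  fst-wins snd-wins tie : Verdict

-- The preimage tree and the contest between two claims

module Tree (X : Bits) (G : Bits → Bits × Bits) where

  -- `X` is a unary numeral for N: polynomial-time functions recurse on strings, so lengths are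
  -- passed to them as strings.
  N : ℕ
  N = length X

  -- Below a defined node nothing has to be claimed, as `G` computes the children. Below an
  -- undefined one the string lists both children, and both inherit the remainder, since only the
  -- first undefined child has a use for it.
  kids : Claim → Claim × Claim
  kids (true , v , ρ)  = (true , proj₁ (G v) , ρ) , (true , proj₂ (G v) , ρ)
  kids (false , v , ρ) =
    let ρ₁ = tailᵇ ρ ; ρ₂ = drop N ρ₁ ; ρ₃ = tailᵇ ρ₂ ; ρ₄ = drop N ρ₃
    in (headᵇ ρ , fit X ρ₁ , ρ₄) , (headᵇ ρ₂ , fit X ρ₃ , ρ₄)

  follow : Bits → Bits → Bits
  follow v []      = v
  follow v (b ∷ p) = choose b (G (follow v p))

  -- Depth N makes paths as long as values, so one string can be read both as a path and as a
  -- candidate for the value of the root.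
  leaf : Bits → Bits
  leaf p = flipHead (follow p p)

  walkStep : Walk → Walk
  walkStep (true , rest)            = true , rest
  walkStep (false , p , σ , τ , lr) =
    if agreed (proj₁ (kids σ)) (proj₁ (kids τ))
    then (if agreed (proj₂ (kids σ)) (proj₂ (kids τ))
          then (true , p , σ , τ , value (proj₁ (kids σ)) , value (proj₂ (kids σ)))
          else (false , true ∷ p , proj₂ (kids σ) , proj₂ (kids τ) , lr))
    else (false , false ∷ p , proj₁ (kids σ) , proj₁ (kids τ) , lr)

  walk : Bits → Walk → Walk
  walk u w = foldl (λ w _ → walkStep w) w u

  -- The value of a leaf can be computed. At a node with undisputed children, a value claimed by
  -- either side is a preimage of them without any check, because the children were computed from
  -- it; so a value beats undefined and the smaller value beats the larger. If both say undefined,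
  -- the pair of children is the one sought and the secrets have to decide.
  judge : Walk → Verdict
  judge (false , p , (f , v , _) , _) = if f ∧ eqᵇ v (leaf p) then fst-wins else snd-wins
  judge (true , _ , (f , v , _) , (f′ , v′ , _) , _) =
    if f then (if f′ then (if less v v′ then fst-wins else snd-wins) else fst-wins)
         else (if f′ then snd-wins else tie)

  module Correct (1≤N : 1 ≤ N) (G-length₁ : ∀ v → length (proj₁ (G v)) ≡ N) (G-length₂ : ∀ v → length (proj₂ (G v)) ≡ N) where

    isPre : Bits → Bits → Bits → Bool
    isPre l r v = eqᵇ (proj₁ (G v)) l ∧ eqᵇ (proj₂ (G v)) r

    isPre-sound : ∀ l r v → isPre l r v ≡ true → proj₁ (G v) ≡ l × proj₂ (G v) ≡ r
    isPre-sound l r v e with ∧-true e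
    ... | e₁ , e₂ = eqᵇ-sound _ _ e₁ , eqᵇ-sound _ _ e₂

    isPre-complete : ∀ v → isPre (proj₁ (G v)) (proj₂ (G v)) v ≡ true
    isPre-complete v rewrite eqᵇ-refl (proj₁ (G v)) | eqᵇ-refl (proj₂ (G v)) = refl

    merge : Maybe Bits → Maybe Bits → Maybe Bits
    merge (just l) (just r) = first N (isPre l r)
    merge _        _        = nothing

    -- The number is the height above the leaves. A path lists its latest turn first, so passing to
    -- a child is a cons.
    val : ℕ → Bits → Maybe Bits
    val zero    p = just (leaf p)
    val (suc k) p = merge (val k (false ∷ p)) (val k (true ∷ p))

    merge-just : ∀ m m′ {v} → merge m m′ ≡ just v → m ≡ just (proj₁ (G v)) × m′ ≡ just (proj₂ (G v))
    merge-just (just l) (just r) {v} e with isPre-sound l r v (IsFirst.holds (first-just N _ e))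
    ... | refl , refl = refl , refl

    merge-length : ∀ m m′ {v} → merge m m′ ≡ just v → length v ≡ N
    merge-length (just l) (just r) e = IsFirst.len (first-just N _ e)

    length-choose : ∀ b v → length (choose b (G v)) ≡ N
    length-choose false = G-length₁
    length-choose true  = G-length₂

    length-follow : ∀ v p → length v ≡ N → length (follow v p) ≡ N
    length-follow v []      e = e
    length-follow v (b ∷ p) e = length-choose b _

    -- Below a defined root everything is determined by the root, so the leaf
    -- that diagonalises against the root's value gives a contradiction.
    val-follow : ∀ {v} p k → length p + k ≡ N → val N [] ≡ just v → val k p ≡ just (follow v p)
    val-follow [] k refl e = e
    val-follow (b ∷ p) k eq e with merge-just (val k (false ∷ p)) (val k (true ∷ p)) (val-follow p (suc k) (trans (+-suc (length p) k) eq) e)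
    val-follow (false ∷ p) k eq e | e₁ , e₂ = e₁
    val-follow (true ∷ p)  k eq e | e₁ , e₂ = e₂

    val-length-suc : ∀ k p {v} → val (suc k) p ≡ just v → length v ≡ N
    val-length-suc k p = merge-length (val k (false ∷ p)) (val k (true ∷ p))

    root-undefined : val N [] ≡ nothing
    root-undefined with val N [] in e
    ... | nothing = refl
    ... | just v = ⊥-elim (flipHead-≢ (follow v v)
          (≤-trans 1≤N (≤-reflexive (sym (length-follow v v v-length))))
          (just-injective (val-follow v 0 (trans (+-identityʳ _) v-length) e)))
      where
      val-length₀ : ∀ k → 1 ≤ k → val k [] ≡ just v → length v ≡ N
      val-length₀ (suc k) _ = val-length-suc k []
      v-length : length v ≡ N
      v-length = val-length₀ N 1≤N e

    val-length : ∀ k p {v} → length p + k ≡ N → val k p ≡ just v → length v ≡ N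
    val-length zero p eq refl = trans (length-flipHead (follow p p))
      (length-follow p p (trans (sym (+-identityʳ _)) eq))
    val-length (suc k) p eq e = val-length-suc k p e

    encMaybe : Maybe Bits → Bits
    encMaybe (just v) = true ∷ v
    encMaybe nothing  = false ∷ X

    -- The history ends where both children are defined. Filling it up makes the length of a claim
    -- depend on N alone, as witnesses must have the prescribed length `m n`.
    pad : ℕ → Bits
    pad zero    = []
    pad (suc k) = false ∷ X ++ false ∷ X ++ pad k

    hist : ℕ → Bits → Bits
    next-hist : ℕ → Bits → Maybe Bits → Maybe Bits → Bits
    hist zero    p = []
    hist (suc k) p = encMaybe (val k (false ∷ p)) ++ encMaybe (val k (true ∷ p)) ++
                     next-hist k p (val k (false ∷ p)) (val k (true ∷ p))
    next-hist k p nothing  _        = hist k (false ∷ p)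
    next-hist k p (just _) nothing  = hist k (true ∷ p)
    next-hist k p (just _) (just _) = pad k

    length-pad : ∀ k → length (pad k) ≡ k * (suc N + suc N)
    length-pad zero    = refl
    length-pad (suc k) = trans (cong suc (trans (length-++ X) (cong (λ t → N + suc t) (trans (length-++ X) (cong (N +_) (length-pad k))))))
                               (eq N (k * (suc N + suc N)))
      where
      eq : ∀ n m → suc (n + suc (n + m)) ≡ suc n + suc n + m
      eq = solve-∀

    length-encMaybe : ∀ m → (∀ {v} → m ≡ just v → length v ≡ N) → length (encMaybe m) ≡ suc N
    length-encMaybe (just v) h = cong suc (h refl)
    length-encMaybe nothing  h = refl

    kid-length : ∀ k b p {v} → length p + suc k ≡ N → val k (b ∷ p) ≡ just v → length v ≡ N
    kid-length k b p eq = val-length k (b ∷ p) (trans (sym (+-suc (length p) k)) eq)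

    length-hist : ∀ k p → length p + k ≡ N → length (hist k p) ≡ k * (suc N + suc N)
    length-next : ∀ k p m m′ → length p + suc k ≡ N → length (next-hist k p m m′) ≡ k * (suc N + suc N)
    length-hist zero    p eq = refl
    length-hist (suc k) p eq = trans (length-++ (encMaybe (val k (false ∷ p))))
      (trans (cong₂ _+_ (length-encMaybe _ (kid-length k false p eq)) (trans (length-++ (encMaybe (val k (true ∷ p))))
        (cong₂ _+_ (length-encMaybe _ (kid-length k true p eq)) (length-next k p (val k (false ∷ p)) (val k (true ∷ p)) eq))))
        (sym (+-assoc (suc N) (suc N) _)))
    length-next k p nothing  _        eq = length-hist k (false ∷ p) (trans (sym (+-suc (length p) k)) eq)
    length-next k p (just _) nothing  eq = length-hist k (true ∷ p) (trans (sym (+-suc (length p) k)) eq)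
    length-next k p (just _) (just _) eq = length-pad k

    -- A known value may be followed by any string, since `kids` ignores it below a defined node; an
    -- undefined node has to carry the true history.
    data Honest (k : ℕ) (p : Bits) : Claim → Set where
      known   : ∀ {v ρ} → val k p ≡ just v → Honest k p (true , v , ρ)
      unknown : ∀ {v j} → val k p ≡ nothing → Honest k p (false , v , hist k p ++ j)

    honest-kid : ∀ {k p} m {ρ} → val k p ≡ m → length (encMaybe m) ≡ suc N → (m ≡ nothing → Σ Bits λ j → ρ ≡ hist k p ++ j) →
      ∀ rest → Honest k p (headᵇ (encMaybe m ++ rest) , fit X (tailᵇ (encMaybe m ++ rest)) , ρ)
    honest-kid (just v) e l _ rest = known (trans e (cong just (sym (fit-++ X v rest (suc-injective l)))))
    honest-kid nothing  e l h rest with h refl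
    ... | j , refl = unknown e

    tail-drop : ∀ m rest → length (encMaybe m) ≡ suc N → drop N (tailᵇ (encMaybe m ++ rest)) ≡ rest
    tail-drop (just v) rest l = drop-++-length X v rest (suc-injective l)
    tail-drop nothing  rest l = drop-++-length X X rest refl

    head-nothing : ∀ m rest → headᵇ (encMaybe m ++ rest) ≡ true → Σ Bits λ v → m ≡ just v
    head-nothing (just v) rest e = v , refl

    -- The right child is honest only under a condition: if the left child is undefined, the
    -- remaining string is the history of the left subtree. The walk turns right only after
    -- agreement on the left, and then the condition holds.
    honest-kids : ∀ {k p σ} → length p + suc k ≡ N → Honest (suc k) p σ →
      Honest k (false ∷ p) (proj₁ (kids σ)) × (defined (proj₁ (kids σ)) ≡ true → Honest k (true ∷ p) (proj₂ (kids σ)))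
    honest-kids {k} {p} eq (known e) with merge-just (val k (false ∷ p)) (val k (true ∷ p)) e
    ... | e₁ , e₂ = known e₁ , λ _ → known e₂
    honest-kids {k} {p} eq (unknown {v} {j} e) = honest-left , honest-right
      where
      m₀ = val k (false ∷ p)
      m₁ = val k (true ∷ p)
      H = next-hist k p m₀ m₁
      l₀ : length (encMaybe m₀) ≡ suc N
      l₀ = length-encMaybe m₀ (kid-length k false p eq)
      l₁ : length (encMaybe m₁) ≡ suc N
      l₁ = length-encMaybe m₁ (kid-length k true p eq)
      ρ = hist (suc k) p ++ j
      ρ-eq : ρ ≡ encMaybe m₀ ++ encMaybe m₁ ++ H ++ j
      ρ-eq = trans (++-assoc (encMaybe m₀) (encMaybe m₁ ++ H) j) (cong (encMaybe m₀ ++_) (++-assoc (encMaybe m₁) H j))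
      d₀ : drop N (tailᵇ ρ) ≡ encMaybe m₁ ++ H ++ j
      d₀ = trans (cong (λ ρ → drop N (tailᵇ ρ)) ρ-eq) (tail-drop m₀ _ l₀)
      d₁ : drop N (tailᵇ (drop N (tailᵇ ρ))) ≡ H ++ j
      d₁ = trans (cong (λ ρ → drop N (tailᵇ ρ)) d₀) (tail-drop m₁ _ l₁)
      next-left : ∀ m m′ → m ≡ nothing → next-hist k p m m′ ≡ hist k (false ∷ p)
      next-left _ _ refl = refl
      next-right : ∀ m m′ {v} → m ≡ just v → m′ ≡ nothing → next-hist k p m m′ ≡ hist k (true ∷ p)
      next-right _ _ refl refl = refl
      honest-left : Honest k (false ∷ p) (headᵇ ρ , fit X (tailᵇ ρ) , drop N (tailᵇ (drop N (tailᵇ ρ))))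
      honest-left = subst (λ ρ′ → Honest k (false ∷ p) (headᵇ ρ′ , fit X (tailᵇ ρ′) , drop N (tailᵇ (drop N (tailᵇ ρ))))) (sym ρ-eq)
        (honest-kid m₀ refl l₀ (λ n → j , trans d₁ (cong (_++ j) (next-left m₀ m₁ n))) (encMaybe m₁ ++ H ++ j))
      honest-right : headᵇ ρ ≡ true → Honest k (true ∷ p) (headᵇ (drop N (tailᵇ ρ)) , fit X (tailᵇ (drop N (tailᵇ ρ))) , drop N (tailᵇ (drop N (tailᵇ ρ))))
      honest-right h with head-nothing m₀ _ (trans (cong headᵇ (sym ρ-eq)) h)
      ... | u , e₀ = subst (λ ρ′ → Honest k (true ∷ p) (headᵇ ρ′ , fit X (tailᵇ ρ′) , drop N (tailᵇ (drop N (tailᵇ ρ))))) (sym d₀)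
        (honest-kid m₁ refl l₁ (λ n → j , trans d₁ (cong (_++ j) (next-right m₀ m₁ e₀ n))) (H ++ j))

    -- The least preimage is least among strings of N bits only, so the opposing value must have
    -- that length; `kids` enforces it for arbitrary claims.
    Sized : Claim → Set
    Sized (f , v , _) = f ≡ true → length v ≡ N

    sized-kids : ∀ σ → Sized (proj₁ (kids σ)) × Sized (proj₂ (kids σ))
    sized-kids (true , v , ρ)  = (λ _ → G-length₁ v) , (λ _ → G-length₂ v)
    sized-kids (false , v , ρ) = (λ _ → length-fit X _) , (λ _ → length-fit X _)

    stopPair : ℕ → Bits → Bits × Bits
    stopNext : ℕ → Bits → Maybe Bits → Maybe Bits → Bits × Bits
    -- A dummy: leaves have values, so a descent through undefined nodes never arrives here.
    stopPair zero    p = [] , []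
    stopPair (suc k) p = stopNext k p (val k (false ∷ p)) (val k (true ∷ p))
    stopNext k p nothing  _        = stopPair k (false ∷ p)
    stopNext k p (just _) nothing  = stopPair k (true ∷ p)
    stopNext k p (just l) (just r) = l , r

    record Missed (lr : Bits × Bits) : Set where
      field
        length₁ : length (proj₁ lr) ≡ N
        length₂ : length (proj₂ lr) ≡ N
        missed  : ∀ v → length v ≡ N → ¬ (proj₁ (G v) ≡ proj₁ lr × proj₂ (G v) ≡ proj₂ lr)

    -- The descent ends at an undefined node with two defined children. There `merge` is the search
    -- for a preimage of the two values, and its failure says precisely that `G` misses the pair.
    stopPair-missed : ∀ k p → length p + k ≡ N → val k p ≡ nothing → Missed (stopPair k p)
    stopPair-missed (suc k) p eq e = helper (val k (false ∷ p)) (val k (true ∷ p)) refl refl e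
      where
      helper : ∀ m m′ → val k (false ∷ p) ≡ m → val k (true ∷ p) ≡ m′ → merge m m′ ≡ nothing → Missed (stopNext k p m m′)
      helper nothing  m′      e₀ e₁ _ = stopPair-missed k (false ∷ p) (trans (sym (+-suc (length p) k)) eq) e₀
      helper (just _) nothing e₀ e₁ _ = stopPair-missed k (true ∷ p) (trans (sym (+-suc (length p) k)) eq) e₁
      helper (just l) (just r) e₀ e₁ e = record
        { length₁ = kid-length k false p eq e₀
        ; length₂ = kid-length k true p eq e₁
        ; missed = λ { v len (refl , refl) → false≢true (first-nothing N _ e v len) (isPre-complete v) } }

    agreed-true : ∀ σ τ → agreed σ τ ≡ true → defined σ ≡ true × defined τ ≡ true × value σ ≡ value τ
    agreed-true (true , v , _) (true , v′ , _) e = refl , refl , eqᵇ-sound v v′ e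

    -- σ is the honest claim, τ any other one.
    data Outcome (k : ℕ) (p : Bits) : Walk → Set where
      at-leaf : ∀ {p′ σ τ lr} → Honest 0 p′ σ → agreed σ τ ≡ false → Outcome k p (false , p′ , σ , τ , lr)
      at-node : ∀ {k′ p′ σ τ l r} → Honest (suc k′) p′ σ → agreed σ τ ≡ false → Sized τ →
        val k′ (false ∷ p′) ≡ just l → val k′ (true ∷ p′) ≡ just r →
        (defined τ ≡ true → proj₁ (G (value τ)) ≡ l × proj₂ (G (value τ)) ≡ r) →
        (defined σ ≡ false → val k p ≡ nothing × stopPair k p ≡ (l , r)) → Outcome k p (true , p′ , σ , τ , l , r)

    honest-defined : ∀ {k p σ} → Honest k p σ → defined σ ≡ true → val k p ≡ just (value σ)
    honest-defined (known e) _ = e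

    honest-undefined : ∀ {k p σ} → Honest k p σ → defined σ ≡ false → val k p ≡ nothing
    honest-undefined (unknown e) _ = e

    merge-nothing : ∀ m m′ → (m ≡ nothing) ⊎ (m′ ≡ nothing) → merge m m′ ≡ nothing
    merge-nothing nothing  _       _ = refl
    merge-nothing (just _) nothing _ = refl
    merge-nothing (just _) (just _) (inj₁ ())
    merge-nothing (just _) (just _) (inj₂ ())

    outcome-left : ∀ {k p w} → Outcome k (false ∷ p) w → Outcome (suc k) p w
    outcome-left (at-leaf h a) = at-leaf h a
    outcome-left {k} {p} (at-node h a s e₀ e₁ g t) = at-node h a s e₀ e₁ g λ u →
      let (n , st) = t u in merge-nothing (val k (false ∷ p)) (val k (true ∷ p)) (inj₁ n) , trans (stop n) st
      where
      stop : ∀ {m m′} → m ≡ nothing → stopNext k p m m′ ≡ stopPair k (false ∷ p)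
      stop refl = refl

    -- A turn to the right presupposes agreement on the left, where the honest value is therefore
    -- defined. So an undefined right child is the first undefined one, and `stopPair` takes the
    -- same turn.
    outcome-right : ∀ {k p w v} → val k (false ∷ p) ≡ just v → Outcome k (true ∷ p) w → Outcome (suc k) p w
    outcome-right _ (at-leaf h a) = at-leaf h a
    outcome-right {k} {p} {v = v} e (at-node h a s e₀ e₁ g t) = at-node h a s e₀ e₁ g λ u →
      let (n , st) = t u in merge-nothing (val k (false ∷ p)) (val k (true ∷ p)) (inj₂ n) , trans (stop e n) st
      where
      stop : ∀ {m m′} → m ≡ just v → m′ ≡ nothing → stopNext k p m m′ ≡ stopPair k (true ∷ p)
      stop refl refl = refl

    walk-done : ∀ u {w} → walk u (true , w) ≡ (true , w)
    walk-done []      = refl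
    walk-done (_ ∷ u) = walk-done u

    walk-outcome : ∀ u p {σ τ lr} → length p + length u ≡ N → Honest (length u) p σ → agreed σ τ ≡ false → Sized τ →
                   Outcome (length u) p (walk u (false , p , σ , τ , lr))
    walk-outcome [] p eq h a s = at-leaf h a
    walk-outcome (_ ∷ u) p {σ} {τ} eq h a s
      with honest-kids eq h | sized-kids τ
         | agreed (proj₁ (kids σ)) (proj₁ (kids τ)) in a₀ | agreed (proj₂ (kids σ)) (proj₂ (kids τ)) in a₁
    ... | h₀ , h₁ | s₀ , s₁ | false | _ =
      outcome-left (walk-outcome u (false ∷ p) (trans (sym (+-suc (length p) (length u))) eq) h₀ a₀ s₀)
    ... | h₀ , h₁ | s₀ , s₁ | true | false with agreed-true (proj₁ (kids σ)) (proj₁ (kids τ)) a₀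
    ... | d , _ , _ = outcome-right (honest-defined h₀ d)
      (walk-outcome u (true ∷ p) (trans (sym (+-suc (length p) (length u))) eq) (h₁ d) a₁ s₁)
    walk-outcome (_ ∷ u) p {σ} {τ} {lr} eq h a s | h₀ , h₁ | s₀ , s₁ | true | true
      with agreed-true (proj₁ (kids σ)) (proj₁ (kids τ)) a₀ | agreed-true (proj₂ (kids σ)) (proj₂ (kids τ)) a₁
    ... | d , d′ , v | c , c′ , v′ =
      subst (Outcome (suc (length u)) p) (sym (walk-done u {p , σ , τ , _}))
        (at-node h a s e₀ e₁ (same τ v v′) λ n → honest-undefined h n , stop e₀ e₁)
      where
      e₀ = honest-defined h₀ d
      e₁ = honest-defined (h₁ d) c
      -- The children of a defined `τ` are computed by `G`, so agreement on them makes the value of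
      -- `τ` a preimage of the honest pair.
      same : ∀ τ → value (proj₁ (kids σ)) ≡ value (proj₁ (kids τ)) → value (proj₂ (kids σ)) ≡ value (proj₂ (kids τ)) →
             defined τ ≡ true → proj₁ (G (value τ)) ≡ value (proj₁ (kids σ)) × proj₂ (G (value τ)) ≡ value (proj₂ (kids σ))
      same (true , _) v v′ _ = sym v , sym v′
      stop : ∀ {m m′ l r} → m ≡ just l → m′ ≡ just r → stopNext (length u) p m m′ ≡ (l , r)
      stop refl refl = refl

    swap : Walk → Walk
    swap (d , p , σ , τ , lr) = d , p , τ , σ , lr

    -- Only the recorded pair is taken from one particular side, and it is recorded only when both
    -- sides agree on it.
    swap-step : ∀ w → walkStep (swap w) ≡ swap (walkStep w)
    swap-step (true , _) = refl
    swap-step (false , p , σ , τ , lr)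
      rewrite agreed-sym (proj₁ (kids τ)) (proj₁ (kids σ)) | agreed-sym (proj₂ (kids τ)) (proj₂ (kids σ))
      with agreed (proj₁ (kids σ)) (proj₁ (kids τ)) in a₀ | agreed (proj₂ (kids σ)) (proj₂ (kids τ)) in a₁
    ... | false | _     = refl
    ... | true  | false = refl
    ... | true  | true  with agreed-true (proj₁ (kids σ)) (proj₁ (kids τ)) a₀ | agreed-true (proj₂ (kids σ)) (proj₂ (kids τ)) a₁
    ... | _ , _ , v | _ , _ , v′ = cong₂ (λ l r → true , p , τ , σ , l , r) (sym v) (sym v′)

    swap-walk : ∀ u w → walk u (swap w) ≡ swap (walk u w)
    swap-walk []      w = refl
    swap-walk (_ ∷ u) w = trans (cong (walk u) (swap-step w)) (swap-walk u (walkStep w))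

    data Decision (good : Verdict) (w : Walk) : Verdict → Set where
      wins : Decision good w good
      draw : stopPair N [] ≡ proj₂ (proj₂ (proj₂ (proj₂ w))) → Decision good w tie

    leaf-value : ∀ {p v ρ} → Honest 0 p (true , v , ρ) → v ≡ leaf p
    leaf-value (known e) = sym (just-injective e)

    least-pre : ∀ m m′ {l r v v′} → m ≡ just l → m′ ≡ just r → merge m m′ ≡ just v → length v′ ≡ N →
      proj₁ (G v′) ≡ l × proj₂ (G v′) ≡ r → v′ ≡ v ⊎ Beats v v′
    least-pre _ _ {v′ = v′} refl refl e len (refl , refl) = IsFirst.least (first-just N _ e) v′ len (isPre-complete v′)

    no-pre : ∀ m m′ {l r v′} → m ≡ just l → m′ ≡ just r → merge m m′ ≡ nothing → length v′ ≡ N →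
      ¬ (proj₁ (G v′) ≡ l × proj₂ (G v′) ≡ r)
    no-pre _ _ {v′ = v′} refl refl e len (refl , refl) = false≢true (first-nothing N _ e v′ len) (isPre-complete v′)

    -- The honest value wins by minimality, and equality is excluded by the disagreement at the
    -- node. An honest undefined claim cannot meet a defined one there, for the latter would supply
    -- the preimage that does not exist.
    judge-fst : ∀ w → Outcome N [] w → Decision fst-wins w (judge w)
    judge-fst (false , p , (true , v , _) , _) (at-leaf h a) rewrite leaf-value h | eqᵇ-refl (leaf p) = wins
    judge-fst (false , p , (false , v , _) , _) (at-leaf (unknown ()) a)
    judge-fst (true , p , (true , v , _) , (false , v′ , _) , _) (at-node h a s e₀ e₁ g t) = wins
    judge-fst (true , p , (false , v , _) , (false , v′ , _) , l , r) (at-node h a s e₀ e₁ g t) = draw (proj₂ (t refl))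
    judge-fst (true , p , (true , v , _) , (true , v′ , _) , l , r) (at-node (known e) a s e₀ e₁ g t)
      with least-pre _ _ e₀ e₁ e (s refl) (g refl)
    ... | inj₁ refl = ⊥-elim (false≢true a (eqᵇ-refl v))
    ... | inj₂ (b , _) rewrite b = wins
    judge-fst (true , p , (false , v , _) , (true , v′ , _) , l , r) (at-node (unknown e) a s e₀ e₁ g t) =
      ⊥-elim (no-pre _ _ e₀ e₁ e (s refl) (g refl))

    judge-snd : ∀ w → Outcome N [] w → Decision snd-wins (swap w) (judge (swap w))
    judge-snd (false , p , (true , v , _) , (f , v′ , _) , _) (at-leaf h a) with f | eqᵇ v′ (leaf p) in e
    ... | false | _ = wins
    ... | true | false = wins
    ... | true | true = ⊥-elim (false≢true a (trans (cong (eqᵇ v) (trans (eqᵇ-sound v′ _ e) (sym (leaf-value h)))) (eqᵇ-refl v)))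
    judge-snd (false , p , (false , v , _) , _) (at-leaf (unknown ()) a)
    judge-snd (true , p , (true , v , _) , (false , v′ , _) , _) (at-node h a s e₀ e₁ g t) = wins
    judge-snd (true , p , (false , v , _) , (false , v′ , _) , l , r) (at-node h a s e₀ e₁ g t) = draw (proj₂ (t refl))
    judge-snd (true , p , (true , v , _) , (true , v′ , _) , l , r) (at-node (known e) a s e₀ e₁ g t)
      with least-pre _ _ e₀ e₁ e (s refl) (g refl)
    ... | inj₁ refl = ⊥-elim (false≢true a (eqᵇ-refl v))
    ... | inj₂ (_ , b) rewrite b = wins
    judge-snd (true , p , (false , v , _) , (true , v′ , _) , l , r) (at-node (unknown e) a s e₀ e₁ g t) =
      ⊥-elim (no-pre _ _ e₀ e₁ e (s refl) (g refl))

    -- Both roots count as undefined, hence as disagreeing. The walk thus starts with its invariant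
    -- even if the two claims are identical.
    startWalk : Bits → Bits → Walk
    startWalk ρ ρ′ = false , [] , (false , [] , ρ) , (false , [] , ρ′) , [] , []

    honest-root : ∀ j → Honest N [] (false , [] , hist N [] ++ j)
    honest-root j = unknown root-undefined

    decide-fst : ∀ j ρ′ → let w = walk X (startWalk (hist N [] ++ j) ρ′) in Decision fst-wins w (judge w)
    decide-fst j ρ′ = judge-fst _ (walk-outcome X [] refl (honest-root j) refl λ ())

    decide-snd : ∀ j ρ → let w = walk X (startWalk ρ (hist N [] ++ j)) in Decision snd-wins w (judge w)
    decide-snd j ρ = subst (λ w → Decision snd-wins w (judge w)) (sym (swap-walk X (startWalk (hist N [] ++ j) ρ)))
      (judge-snd _ (walk-outcome X [] refl (honest-root j) refl λ ()))

    stop-missed : Missed (stopPair N [])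
    stop-missed = stopPair-missed N [] refl root-undefined

-- Hard truth tables

half : Bool → Bits → Bits
half b     []      = []
half false (x ∷ l) = x ∷ half true l
half true  (x ∷ l) = half false l

-- Random access by halving: the index is read in binary, least significant bit first.
sel : Bits → Bits → Bool
sel l i = headᵇ (foldl (λ l b → half b l) l i)

inc : Bits → Bits
inc []          = []
inc (false ∷ x) = true ∷ x
inc (true ∷ x)  = false ∷ inc x

length-inc : ∀ x → length (inc x) ≡ length x
length-inc []          = refl
length-inc (false ∷ x) = refl
length-inc (true ∷ x)  = cong suc (length-inc x)

orbit : (Bits → Bool) → ℕ → Bits → Bits
orbit g zero    x = []
orbit g (suc k) x = g x ∷ orbit g k (inc x)

length-orbit : ∀ g k x → length (orbit g k x) ≡ k
length-orbit g zero    x = refl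
length-orbit g (suc k) x = cong suc (length-orbit g k (inc x))

orbit-cong : ∀ {g h} k n x → length x ≡ n → (∀ x → length x ≡ n → g x ≡ h x) → orbit g k x ≡ orbit h k x
orbit-cong zero    n x e p = refl
orbit-cong (suc k) n x e p = cong₂ _∷_ (p x e) (orbit-cong k n (inc x) (trans (length-inc x) e) p)

half-orbit : ∀ b g k x → half b (orbit g (k + k) (false ∷ x)) ≡ orbit (g ∘ (b ∷_)) k x
half-orbit b g zero x = refl
half-orbit b g (suc k) x rewrite +-suc k k with b
... | false = cong (g (false ∷ x) ∷_) (half-orbit false g k (inc x))
... | true  = cong (g (true ∷ x) ∷_) (half-orbit true g k (inc x))

length-half : ∀ b k l → length l ≡ k + k → length (half b l) ≡ k
length-half b     zero    []          e = refl
length-half b     (suc k) (x ∷ [])    e = ⊥-elim (case trans (suc-injective e) (+-suc k k) of λ ())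
length-half false (suc k) (x ∷ y ∷ l) e = cong suc (length-half false k l (suc-injective (trans (suc-injective e) (+-suc k k))))
length-half true  (suc k) (x ∷ y ∷ l) e = cong suc (length-half true k l (suc-injective (trans (suc-injective e) (+-suc k k))))

half-injective : ∀ l l′ → half false l ≡ half false l′ → half true l ≡ half true l′ → l ≡ l′
half-injective []      []       p q = refl
half-injective (x ∷ l) (y ∷ l′) p q = cong₂ _∷_ (∷-injectiveˡ p) (half-injective l l′ q (∷-injectiveʳ p))

-- Counting is least significant bit first, so the even and the odd positions of the list are the
-- two tables with the lowest address bit fixed. Each is recovered by induction, and the two halves
-- determine the list.
orbit-sel : ∀ n l → length l ≡ 2 ^ n → orbit (sel l) (2 ^ n) (replicate n false) ≡ l
orbit-sel zero    (x ∷ []) e = refl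
orbit-sel (suc n) l e rewrite +-identityʳ (2 ^ n) = half-injective _ l (on false) (on true)
  where
  on : ∀ b → half b (orbit (sel l) (2 ^ n + 2 ^ n) (false ∷ replicate n false)) ≡ half b l
  on b = trans (half-orbit b (sel l) (2 ^ n) (replicate n false)) (orbit-sel n (half b l) (length-half b (2 ^ n) l e))

-- A machine with a stack, an addressable memory that only grows, and a program.
Frame : Set
Frame = Bits × Bits × Bits

two four : Bits
two  = false ∷ false ∷ []
four = two ++ two

-- Instructions: 0 a₁ … a_w pushes the memory bit at address a; 1 t₀ t₁ t₂ t₃ pops two
-- bits, applies the gate with truth table t, pushes the result and appends it to memory.
frameStep : Bits → Frame → Frame
frameStep w (st , mem , [])        = st , mem , []
frameStep w (st , mem , false ∷ p) = sel mem (fit w p) ∷ st , mem , drop (length w) p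
frameStep w (st , mem , true ∷ p)  =
  let r = sel (fit four p) (fit two st) in r ∷ drop 2 st , mem ++ r ∷ [] , drop 4 p

zeros ones : Bits → Bits
zeros = foldr (λ x l → if x then [] else false ∷ l) []
ones  = foldr (λ x l → if x then true ∷ l else []) []

-- A program is padding 0…0, the address width w in unary 1…1 0, and instructions.
runProgram : Bits → Bits → Bool
runProgram d x =
  let d₁ = drop (length (zeros d)) d ; w = ones d₁ ; body = tailᵇ (drop (length w) d₁)
  -- One round per bit of `d` is enough: every instruction consumes at least one bit, and an
  -- exhausted program changes nothing.
  in headᵇ (proj₁ (foldl (λ s _ → frameStep w s) ([] , x , body) d))

smaller : (Bits → Bool) → Bits → Bits → Bits
smaller P s s′ = if P s then (if P s′ then (if less s s′ then s else s′) else s) else s′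

smaller-fst : ∀ {k P s} → IsFirst k P s → ∀ s′ → length s′ ≡ k → smaller P s s′ ≡ s
smaller-fst {P = P} {s} F s′ e rewrite IsFirst.holds F with P s′ in v
... | false = refl
... | true with IsFirst.least F s′ e v
...   | inj₂ (b , _) rewrite b = refl
...   | inj₁ refl with less s s
...     | false = refl
...     | true  = refl

smaller-snd : ∀ {k P s} → IsFirst k P s → ∀ s′ → length s′ ≡ k → smaller P s′ s ≡ s
smaller-snd {P = P} {s} F s′ e with P s′ in v
... | false = refl
... | true rewrite IsFirst.holds F with IsFirst.least F s′ e v
...   | inj₂ (_ , b) rewrite b = refl
...   | inj₁ refl with less s s
...     | false = refl
...     | true  = refl

length-zeros : ∀ l → length (zeros l) ≤ length l
length-zeros []          = z≤n
length-zeros (false ∷ l) = s≤s (length-zeros l)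
length-zeros (true ∷ l)  = z≤n

zeros-replicate : ∀ k j → length (zeros (replicate k false ++ replicate j true)) ≡ k
zeros-replicate zero    zero    = refl
zeros-replicate zero    (suc j) = refl
zeros-replicate (suc k) j       = cong suc (zeros-replicate k j)

-- The length condition says that `u` contains a 1; at the first one the other string still has a 0.
more-zeros : ∀ u c rest → suc (length (zeros u)) ≤ length u → let s = replicate (suc (length (zeros u))) false ++ rest in
  less (u ++ c) s ≡ false × ¬ s ≡ u ++ c
more-zeros (false ∷ u) c rest (s≤s p) with more-zeros u c rest p
... | a , b = a , λ e → b (∷-injectiveʳ e)
more-zeros (true ∷ u) c rest p = refl , λ ()

fit-full : ∀ u l → length l ≡ length u → fit u l ≡ l
fit-full u l e = trans (cong (fit u) (sym (++-identityʳ l))) (fit-++ u l [] e)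

fit-snoc : ∀ t u l → length u ≡ suc (length t) → fit u l ≡ fit t l ++ headᵇ (drop (length t) l) ∷ []
fit-snoc []      (_ ∷ [])    l e = refl
fit-snoc (_ ∷ t) (_ ∷ u) []      e = cong (false ∷_) (trans (fit-snoc t u [] (suc-injective e)) (cong (λ l → fit t [] ++ headᵇ l ∷ []) (drop-[] (length t))))
fit-snoc (_ ∷ t) (_ ∷ u) (x ∷ l) e = cong (x ∷_) (fit-snoc t u l (suc-injective e))

fit-cong : ∀ u u′ l → length u ≡ length u′ → fit u l ≡ fit u′ l
fit-cong []      []       l e = refl
fit-cong (_ ∷ u) (_ ∷ u′) l e = cong (headᵇ l ∷_) (fit-cong u u′ (tailᵇ l) (suc-injective e))

fit-drop : ∀ (u s : Bits) k → length s ≡ length u + k → s ≡ fit u s ++ drop (length u) s × length (drop (length u) s) ≡ k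
fit-drop []      s       k e = refl , e
fit-drop (_ ∷ u) (x ∷ s) k e with fit-drop u s k (suc-injective e)
... | a , b = cong (x ∷_) a , b

-- Iterating the truth table map, and the secrets that undo the iteration

module Hard (X x₀ : Bits) where

  truthTable : Bits → Bits
  truthTable d = orbit (runProgram d) (length X) x₀

  -- The first bit is set aside and the other N - 1 bits, read as a program, become a truth table of
  -- N bits. Each link gains one bit, so N links lead from N to 2N bits.
  link : Bits × Bits → Bits × Bits
  link (v , acc) = truthTable (tailᵇ v) , headᵇ v ∷ acc

  chain : Bits → Bits × Bits → Bits × Bits
  chain u s = foldl (λ s _ → link s) s u

  chain-length₂ : ∀ u v acc → length (proj₂ (chain u (v , acc))) ≡ length u + length acc
  chain-length₂ []      v acc = refl
  chain-length₂ (_ ∷ u) v acc = trans (chain-length₂ u _ _) (+-suc (length u) (length acc))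

  G : Bits → Bits × Bits
  G v = let c = chain X (v , []) in fit X (proj₁ c) , proj₂ c

  open Tree X G public

  -- A secret is u ++ c, where the chain from c has as many links as u has leading zeros;
  -- so a longer chain makes a lexicographically smaller secret.
  validSecret : Bits × Bits → Bits → Bool
  validSecret (l , r) s =
    let t = zeros (fit X s) ; c = chain t (drop N s , [])
    in eqᵇ (proj₁ c) l ∧ eqᵇ (proj₂ c) (fit t r)

  award : Verdict → Bits × Bits → Bits → Bits → Bits
  award fst-wins lr s s′ = s
  award snd-wins lr s s′ = s′
  award tie      lr s s′ = smaller (validSecret lr) s s′

  secretOf claimsOf : Bits → Bits
  secretOf y = fit (X ++ X) y
  claimsOf y = drop (length (X ++ X)) y

  start : Bits → Bits → Walk
  start ρ ρ′ = false , [] , (false , [] , ρ) , (false , [] , ρ′) , [] , []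

  contestOf : Bits → Bits → Bits → Bits → Bits
  contestOf s ρ s′ ρ′ =
    let w = walk X (start ρ ρ′) in award (judge w) (proj₂ (proj₂ (proj₂ (proj₂ w)))) s s′

  contest : Bits → Bits → Bits
  contest y z = contestOf (secretOf y) (claimsOf y) (secretOf z) (claimsOf z)

  module Winner (1≤N : 1 ≤ N) where

    open Correct 1≤N (λ v → length-fit X _)
                 (λ v → trans (chain-length₂ X v []) (+-identityʳ N)) public

    chain-++ : ∀ u v acc a → chain u (v , acc ++ a) ≡ (proj₁ (chain u (v , acc)) , proj₂ (chain u (v , acc)) ++ a)
    chain-++ []      v acc a = refl
    chain-++ (_ ∷ u) v acc a = chain-++ u _ (headᵇ v ∷ acc) a

    chain-cong : ∀ u u′ s → length u ≡ length u′ → chain u s ≡ chain u′ s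
    chain-cong []      []       s e = refl
    chain-cong (_ ∷ u) (_ ∷ u′) s e = chain-cong u u′ (link s) (suc-injective e)

    module Secret (l r : Bits) (l-length : length l ≡ N) (r-length : length r ≡ N)
                  (missed : ∀ v → length v ≡ N → ¬ (proj₁ (G v) ≡ l × proj₂ (G v) ≡ r)) where

      secret-exists : Σ Bits λ s → first (N + N) (validSecret (l , r)) ≡ just s
      secret-exists with first (N + N) (validSecret (l , r)) in e
      ... | just s  = s , refl
      ... | nothing = ⊥-elim (false≢true (first-nothing (N + N) _ e trivial trivial-length) trivial-valid)
        where
        -- No leading zero means a chain without links, and such a chain is valid from `l` itself;
        -- so some secret exists.
        trivial = replicate N true ++ l
        trivial-length : length trivial ≡ N + N
        trivial-length = trans (length-++ (replicate N true)) (cong₂ _+_ (length-replicate N) l-length)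
        zeros-trues : ∀ k → zeros (replicate k true) ≡ []
        zeros-trues zero    = refl
        zeros-trues (suc k) = refl
        trivial-valid : validSecret (l , r) trivial ≡ true
        trivial-valid rewrite fit-++ X (replicate N true) l (length-replicate N) | zeros-trues N
          | drop-++-length X (replicate N true) l (length-replicate N) | eqᵇ-refl l = refl

      -- If the final value were the truth table of q, the chain could be prolonged by one link.
      module _ {s : Bits} (F : IsFirst (N + N) (validSecret (l , r)) s) where
        open IsFirst F

        private
          hard u* t* : Bits
          hard = drop N s
          u* = fit X s
          t* = zeros u*

          hard-chain : chain t* (hard , []) ≡ (l , fit t* r)
          hard-chain with ∧-true holds
          ... | a , b = cong₂ _,_ (eqᵇ-sound _ _ a) (eqᵇ-sound _ _ b)

          s-split : s ≡ u* ++ hard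
          s-split = proj₁ (fit-drop X s N len)

        length-hard : length hard ≡ N
        length-hard = proj₂ (fit-drop X s N len)

        private
          -- N links would exhibit a preimage of the missed pair under `G`.
          full-chain : length t* ≡ N → ⊥
          full-chain t≡N = missed hard length-hard (cong proj₁ full ,
              trans (cong proj₂ full) (trans (fit-cong t* X r t≡N) (fit-full X r r-length)))
            where
            full : G hard ≡ (l , fit t* r)
            full = trans (cong (λ c → fit X (proj₁ c) , proj₂ c) (trans (chain-cong X t* (hard , []) (sym t≡N)) hard-chain))
                         (cong (_, fit t* r) (fit-full X l l-length))

          longer-chain : ∀ q → suc (length q) ≡ N → truthTable q ≡ hard → suc (length t*) ≤ N → ⊥
          longer-chain q q-length eq t<N with least s′ s′-length s′-valid
            where
            -- Later links put their bits in front, so the bit set aside by a new first link must be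
            -- the one of `r` just behind those of the present chain.
            b = headᵇ (drop (length t*) r)
            -- One zero more than in `u*` announces the longer chain and makes the secret smaller;
            -- the ones stop the count.
            u′ = replicate (suc (length t*)) false ++ replicate (N ∸ suc (length t*)) true
            s′ = u′ ++ b ∷ q
            u′-length : length u′ ≡ N
            u′-length = trans (length-++ (replicate (suc (length t*)) false))
              (trans (cong₂ _+_ (length-replicate (suc (length t*))) (length-replicate (N ∸ suc (length t*)))) (m+[n∸m]≡n t<N))
            s′-length : length s′ ≡ N + N
            s′-length = trans (length-++ u′) (cong₂ _+_ u′-length q-length)
            t′ = zeros u′
            t′-length : length t′ ≡ suc (length t*)
            t′-length = zeros-replicate (suc (length t*)) (N ∸ suc (length t*))
            one-more : chain t′ (b ∷ q , []) ≡ (l , fit t′ r)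
            one-more = trans (chain-cong t′ (false ∷ t*) (b ∷ q , []) t′-length)
              (trans (cong (λ h → chain t* (h , b ∷ [])) eq)
              (trans (chain-++ t* hard [] (b ∷ []))
              (cong₂ _,_ (cong proj₁ hard-chain) (trans (cong (λ p → proj₂ p ++ b ∷ []) hard-chain) (sym (fit-snoc t* t′ r t′-length))))))
            s′-valid : validSecret (l , r) s′ ≡ true
            s′-valid = trans (cong₂ (λ u c → valid-from (zeros u) c) (fit-++ X u′ (b ∷ q) u′-length) (drop-++-length X u′ (b ∷ q) u′-length))
              (trans (cong (λ p → eqᵇ (proj₁ p) l ∧ eqᵇ (proj₂ p) (fit t′ r)) one-more) (cong₂ _∧_ (eqᵇ-refl l) (eqᵇ-refl (fit t′ r))))
              where
              valid-from : Bits → Bits → Bool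
              valid-from t c = eqᵇ (proj₁ (chain t (c , []))) l ∧ eqᵇ (proj₂ (chain t (c , []))) (fit t r)
          ... | result = contra result
            where
            rest = replicate (N ∸ suc (length t*)) true ++ headᵇ (drop (length t*) r) ∷ q
            mz = more-zeros u* hard rest (≤-trans t<N (≤-reflexive (sym (length-fit X s))))
            assoc : (replicate (suc (length t*)) false ++ replicate (N ∸ suc (length t*)) true) ++ headᵇ (drop (length t*) r) ∷ q
                    ≡ replicate (suc (length t*)) false ++ rest
            assoc = ++-assoc (replicate (suc (length t*)) false) _ _
            contra : let s′ = (replicate (suc (length t*)) false ++ replicate (N ∸ suc (length t*)) true) ++ headᵇ (drop (length t*) r) ∷ q
                     in s′ ≡ s ⊎ Beats s s′ → ⊥
            contra (inj₁ e) = proj₂ mz (trans (sym assoc) (trans e s-split))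
            contra (inj₂ (e , _)) = false≢true (trans (cong₂ less s-split assoc) (proj₁ mz)) e

        hard-avoids : ∀ q → suc (length q) ≡ N → ¬ truthTable q ≡ hard
        hard-avoids q q-length eq with m≤n⇒m<n∨m≡n (≤-trans (length-zeros u*) (≤-reflexive (length-fit X s)))
        ... | inj₁ t<N = longer-chain q q-length eq t<N
        ... | inj₂ t≡N = full-chain t≡N

    abstract
      missing : Σ (Bits × Bits) λ lr → stopPair N [] ≡ lr × Missed lr
      missing = stopPair N [] , refl , stop-missed

    private
      lr : Bits × Bits
      lr = proj₁ missing
      module M = Missed (proj₂ (proj₂ missing))
      module S = Secret (proj₁ lr) (proj₂ lr) M.length₁ M.length₂ M.missed

    abstract
      secretΣ : Σ Bits (IsFirst (N + N) (validSecret lr))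
      secretΣ = _ , first-just (N + N) (validSecret lr) (proj₂ S.secret-exists)

    -- The secret has the fixed length 2N and stands in front, so it can be separated from the
    -- history in any string that a side presents.
    secret hard honestClaim : Bits
    secret = proj₁ secretΣ
    hard = drop N secret
    honestClaim = secret ++ hist N []

    length-hard : length hard ≡ N
    length-hard = S.length-hard (proj₂ secretΣ)

    hard-avoids : ∀ q → suc (length q) ≡ N → ¬ truthTable q ≡ hard
    hard-avoids = S.hard-avoids (proj₂ secretΣ)

    private
      len : length secret ≡ N + N
      len = IsFirst.len (proj₂ secretΣ)

    length-honestClaim : length honestClaim ≡ N + N + N * (suc N + suc N)
    length-honestClaim = trans (length-++ secret) (cong₂ _+_ len (length-hist N [] refl))

    private
      secretOf-honest : secretOf honestClaim ≡ secret
      secretOf-honest = fit-++ (X ++ X) secret (hist N []) (trans len (sym (length-++ X)))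

      claimsOf-honest : claimsOf honestClaim ≡ hist N [] ++ []
      claimsOf-honest = trans (drop-++-length (X ++ X) secret (hist N []) (trans len (sym (length-++ X)))) (sym (++-identityʳ _))

      length-secretOf : ∀ y → length (secretOf y) ≡ N + N
      length-secretOf y = trans (length-fit (X ++ X) y) (length-++ X)

      drawn : Walk → Bits × Bits
      drawn w = proj₂ (proj₂ (proj₂ (proj₂ w)))

      award-fst : ∀ {w v} s → length s ≡ N + N → Decision fst-wins w v → award v (drawn w) secret s ≡ secret
      award-fst s e wins = refl
      award-fst s e (draw eq) = trans (cong (λ p → smaller (validSecret p) secret s) (trans (sym eq) (proj₁ (proj₂ missing))))
        (smaller-fst (proj₂ secretΣ) s e)

      award-snd : ∀ {w v} s → length s ≡ N + N → Decision snd-wins w v → award v (drawn w) s secret ≡ secret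
      award-snd s e wins = refl
      award-snd s e (draw eq) = trans (cong (λ p → smaller (validSecret p) s secret) (trans (sym eq) (proj₁ (proj₂ missing))))
        (smaller-snd (proj₂ secretΣ) s e)

    contest-fst : ∀ z → contest honestClaim z ≡ secret
    contest-fst z = trans (cong₂ (λ s ρ → contestOf s ρ (secretOf z) (claimsOf z)) secretOf-honest claimsOf-honest)
      (award-fst (secretOf z) (length-secretOf z) (decide-fst [] (claimsOf z)))

    contest-snd : ∀ y → contest y honestClaim ≡ secret
    contest-snd y = trans (cong₂ (λ s ρ → contestOf (secretOf y) (claimsOf y) s ρ) secretOf-honest claimsOf-honest)
      (award-snd (secretOf y) (length-secretOf y) (decide-snd [] (claimsOf y)))

-- The verifier is computable in polynomial time

π₀ : ∀ {a b} → PT {a ⊗ b} {a} proj₁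
π₀ = fstᴾ

π₁ : ∀ {a b c} → PT {a ⊗ b ⊗ c} {b} (λ v → proj₁ (proj₂ v))
π₁ = fstᴾ ∘ᴾ sndᴾ

ρ₁ : ∀ {a b} → PT {a ⊗ b} {b} proj₂
ρ₁ = sndᴾ

ρ₂ : ∀ {a b c} → PT {a ⊗ b ⊗ c} {c} (λ v → proj₂ (proj₂ v))
ρ₂ = sndᴾ ∘ᴾ sndᴾ

module _ {Γ : Ty} where

  infixr 5 _∷ᴾ_
  infixr 6 _∧ᴾ_

  _∷ᴾ_ : ∀ {x l} → PT {Γ} {bool} x → PT {Γ} {bits} l → PT {Γ} {bits} (λ v → x v ∷ l v)
  X ∷ᴾ L = consᴾ ∘ᴾ (X ,ᴾ L)

  iteᴾ : ∀ {a c} {f g : ⟦ Γ ⟧ → ⟦ a ⟧} → PT {Γ} {bool} c → PT {Γ} {a} f → PT {Γ} {a} g →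
         PT {Γ} {a} (λ v → if c v then f v else g v)
  iteᴾ C F G = ifᴾ F G ∘ᴾ (C ,ᴾ idᴾ)

  matchᴾ : ∀ {a l} {f : ⟦ Γ ⟧ → ⟦ a ⟧} {g : ⟦ bool ⊗ bits ⊗ Γ ⟧ → ⟦ a ⟧} → PT {Γ} {bits} l → PT {Γ} {a} f →
           PT {bool ⊗ bits ⊗ Γ} {a} g → PT {Γ} {a} (λ v → caseBits (l v) (f v) (λ x m → g (x , m , v)))
  matchᴾ L F G = caseᴾ F G ∘ᴾ (L ,ᴾ idᴾ)

  record Growth (a : Ty) (f : ⟦ bool ⊗ a ⊗ Γ ⟧ → ⟦ a ⟧) : Set where
    constructor growth
    field
      additive : Σ ℕ λ e → ∀ x u v → size a (f (x , u , v)) ≤ size a u + poly e (size Γ v)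

  growth-const : ∀ {a f} k → (∀ x u v → size a (f (x , u , v)) ≤ size a u + k) → Growth a f
  growth-const k h = growth (k , λ x u v → ≤-trans (h x u v) (+-monoʳ-≤ _ (k≤poly k (size Γ v))))

  growth-by : ∀ {a f} h → PolyBounded (size Γ) h → (∀ x u v → size a (f (x , u , v)) ≤ size a u + h v) → Growth a f
  growth-by h (e , p) q = growth (e , λ x u v → ≤-trans (q x u v) (+-monoʳ-≤ _ (p v)))

  foldlᴾ : ∀ {a l u} (f : ⟦ bool ⊗ a ⊗ Γ ⟧ → ⟦ a ⟧) → Growth a f → PT {Γ} {bits} l → PT {Γ} {a} u →
           PT {bool ⊗ a ⊗ Γ} {a} f → PT {Γ} {a} (λ v → foldl (λ u x → f (x , u , v)) (u v) (l v))
  foldlᴾ f (growth (e , h)) L U F = foldᴾ F e h ∘ᴾ (L ,ᴾ U ,ᴾ idᴾ)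

  notᴾ : ∀ {x} → PT {Γ} {bool} x → PT {Γ} {bool} (λ v → not (x v))
  notᴾ {x} X = ptExt (λ v → eq (x v)) (iteᴾ X (boolᴾ false) (boolᴾ true))
    where
    eq : ∀ x → (if x then false else true) ≡ not x
    eq false = refl
    eq true  = refl

  _∧ᴾ_ : ∀ {x y} → PT {Γ} {bool} x → PT {Γ} {bool} y → PT {Γ} {bool} (λ v → x v ∧ y v)
  _∧ᴾ_ {x} {y} X Y = ptExt (λ v → eq (x v)) (iteᴾ X Y (boolᴾ false))
    where
    eq : ∀ x {y} → (if x then y else false) ≡ x ∧ y
    eq false = refl
    eq true  = refl

  headᴾ : ∀ {l} → PT {Γ} {bits} l → PT {Γ} {bool} (λ v → headᵇ (l v))
  headᴾ {l} L = ptExt (λ v → eq (l v)) (matchᴾ L (boolᴾ false) π₀)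
    where
    eq : ∀ l → caseBits l false (λ x m → x) ≡ headᵇ l
    eq []      = refl
    eq (x ∷ l) = refl

  tailᴾ : ∀ {l} → PT {Γ} {bits} l → PT {Γ} {bits} (λ v → tailᵇ (l v))
  tailᴾ {l} L = ptExt (λ v → eq (l v)) (matchᴾ L nilᴾ π₁)
    where
    eq : ∀ l → caseBits l [] (λ x m → m) ≡ tailᵇ l
    eq []      = refl
    eq (x ∷ l) = refl

-- Polynomial-time functions on bit strings

suc≤+1 : ∀ n → suc n ≤ n + 1
suc≤+1 n = ≤-reflexive (+-comm 1 n)

length-tailᵇ : ∀ l → length (tailᵇ l) ≤ length l
length-tailᵇ []      = z≤n
length-tailᵇ (x ∷ l) = n≤1+n _

length-drop-≤ : ∀ k (l : Bits) → length (drop k l) ≤ length l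
length-drop-≤ k l = ≤-trans (≤-reflexive (length-drop k l)) (m∸n≤m (length l) k)

reverseᴾ : ∀ {Γ l} → PT {Γ} {bits} l → PT {Γ} {bits} (λ v → reverse (l v))
reverseᴾ {Γ} L = foldlᴾ {Γ = bits} (λ (x , u , v) → x ∷ u) (growth-const 1 λ x u v → suc≤+1 _) idᴾ nilᴾ (π₀ ∷ᴾ π₁) ∘ᴾ L

foldrᴾ : ∀ {Γ a l u} (f : ⟦ bool ⊗ a ⊗ Γ ⟧ → ⟦ a ⟧) → Growth a f → PT {Γ} {bits} l → PT {Γ} {a} u →
         PT {bool ⊗ a ⊗ Γ} {a} f → PT {Γ} {a} (λ v → foldr (λ x u → f (x , u , v)) (u v) (l v))
foldrᴾ {l = l} {u} f gr L U F = ptExt (λ v → reverse-foldl (λ u x → f (x , u , v)) (u v) (l v)) (foldlᴾ f gr (reverseᴾ L) U F)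

appendᴾ : ∀ {Γ l m} → PT {Γ} {bits} l → PT {Γ} {bits} m → PT {Γ} {bits} (λ v → l v ++ m v)
appendᴾ {Γ} {l} {m} L M = ptExt (λ v → eq (l v) (m v))
  (foldrᴾ (λ (x , u , v) → x ∷ u) (growth-const 1 λ x u v → suc≤+1 _) L M (π₀ ∷ᴾ π₁))
  where
  eq : ∀ l m → foldr _∷_ m l ≡ l ++ m
  eq []      m = refl
  eq (x ∷ l) m = cong (x ∷_) (eq l m)

dropᴾ : ∀ {Γ u l} → PT {Γ} {bits} u → PT {Γ} {bits} l → PT {Γ} {bits} (λ v → drop (length (u v)) (l v))
dropᴾ {Γ} {u} {l} U L = ptExt (λ v → eq (u v) (l v))
  (foldlᴾ (λ (x , l , v) → tailᵇ l) (growth-const 0 λ x l v → ≤-trans (s≤s (length-tailᵇ l)) (m≤m+n _ 0)) U L (tailᴾ π₁))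
  where
  eq : ∀ u l → foldl (λ l _ → tailᵇ l) l u ≡ drop (length u) l
  eq []      l       = refl
  eq (_ ∷ u) []      = trans (eq u []) (drop-[] (length u))
  eq (_ ∷ u) (x ∷ l) = eq u l

fitᴾ : ∀ {Γ u l} → PT {Γ} {bits} u → PT {Γ} {bits} l → PT {Γ} {bits} (λ v → fit (u v) (l v))
fitᴾ {Γ} {u} {l} U L = ptExt (λ v → trans (cong reverse (eq (u v) (l v) [])) (reverse-involutive (fit (u v) (l v))))
  (reverseᴾ (π₀ ∘ᴾ foldlᴾ {a = bits ⊗ bits} (λ (x , (acc , l) , v) → headᵇ l ∷ acc , tailᵇ l)
    (growth-const 1 λ x (acc , l) v → bound (length acc) (length-tailᵇ l))
    U (nilᴾ ,ᴾ L) ((headᴾ (ρ₁ ∘ᴾ π₁) ∷ᴾ (π₀ ∘ᴾ π₁)) ,ᴾ tailᴾ (ρ₁ ∘ᴾ π₁))))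
  where
  bound : ∀ a {b c} → b ≤ c → suc (suc a) + suc b ≤ suc a + suc c + 1
  bound a {b} {c} p = ≤-trans (s≤s (+-monoʳ-≤ (suc a) (s≤s p))) (suc≤+1 (suc a + suc c))
  eq : ∀ u l acc → proj₁ (foldl (λ (acc , l) x → headᵇ l ∷ acc , tailᵇ l) (acc , l) u) ≡ fit u l ʳ++ acc
  eq []      l acc = refl
  eq (_ ∷ u) l acc = eq u (tailᵇ l) (headᵇ l ∷ acc)

-- One pass from the right builds both halves at once; a new first bit makes even and odd positions
-- exchange roles.
halfᴾ : ∀ {Γ b l} → PT {Γ} {bool} b → PT {Γ} {bits} l → PT {Γ} {bits} (λ v → half (b v) (l v))
halfᴾ {Γ} {b} {l} B L = ptExt (λ v → eq (b v) (l v))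
  (iteᴾ π₀ (ρ₁ ∘ᴾ ρ₁) (π₀ ∘ᴾ ρ₁) ∘ᴾ (B ,ᴾ foldrᴾ {a = bits ⊗ bits} (λ (x , (e , o) , v) → x ∷ o , e)
    (growth-const 1 λ x (e , o) v → ≤-reflexive (swap (length e) (length o))) L (nilᴾ ,ᴾ nilᴾ)
    ((π₀ ∷ᴾ (ρ₁ ∘ᴾ π₁)) ,ᴾ (π₀ ∘ᴾ π₁))))
  where
  swap : ∀ e o → suc (suc o) + suc e ≡ suc e + suc o + 1
  swap e o = trans (cong suc (+-comm (suc o) (suc e))) (+-comm 1 _)
  both : ∀ l → foldr (λ x (e , o) → x ∷ o , e) ([] , []) l ≡ (half false l , half true l)
  both []      = refl
  both (x ∷ l) = cong (λ (e , o) → x ∷ o , e) (both l)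
  eq : ∀ b l → (let p = foldr (λ x (e , o) → x ∷ o , e) ([] , []) l in if b then proj₂ p else proj₁ p) ≡ half b l
  eq b l rewrite both l with b
  ... | false = refl
  ... | true  = refl

length-half-≤ : ∀ b l → length (half b l) ≤ length l
length-half-≤ b     []      = z≤n
length-half-≤ false (x ∷ l) = s≤s (length-half-≤ true l)
length-half-≤ true  (x ∷ l) = ≤-trans (length-half-≤ false l) (n≤1+n _)

selᴾ : ∀ {Γ l i} → PT {Γ} {bits} l → PT {Γ} {bits} i → PT {Γ} {bool} (λ v → sel (l v) (i v))
selᴾ L I = headᴾ (foldlᴾ (λ (b , l , v) → half b l)
  (growth-const 0 λ b l v → ≤-trans (s≤s (length-half-≤ b l)) (m≤m+n _ 0)) I L (halfᴾ π₀ π₁))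

incᴾ : ∀ {Γ x} → PT {Γ} {bits} x → PT {Γ} {bits} (λ v → inc (x v))
incᴾ {Γ} {x} X = ptExt (λ v → trans (cong reverse (carried (x v) [])) (reverse-involutive (inc (x v))))
  (reverseᴾ (ρ₁ ∘ᴾ foldlᴾ {a = bool ⊗ bits} (λ (x , (c , acc) , v) → (if c then x else false) , (if c then not x else x) ∷ acc)
    (growth-const 1 λ x u v → suc≤+1 _) X (boolᴾ true ,ᴾ nilᴾ)
    (iteᴾ (π₀ ∘ᴾ π₁) π₀ (boolᴾ false) ,ᴾ (iteᴾ (π₀ ∘ᴾ π₁) (notᴾ π₀) π₀ ∷ᴾ (ρ₁ ∘ᴾ π₁)))))
  where
  step : Bool × Bits → Bool → Bool × Bits
  step (c , acc) x = (if c then x else false) , (if c then not x else x) ∷ acc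
  uncarried : ∀ x acc → proj₂ (foldl step (false , acc) x) ≡ x ʳ++ acc
  uncarried []      acc = refl
  uncarried (b ∷ x) acc = uncarried x (b ∷ acc)
  carried : ∀ x acc → proj₂ (foldl step (true , acc) x) ≡ inc x ʳ++ acc
  carried []          acc = refl
  carried (false ∷ x) acc = uncarried x (true ∷ acc)
  carried (true ∷ x)  acc = carried x (false ∷ acc)

zerosᴾ : ∀ {Γ l} → PT {Γ} {bits} l → PT {Γ} {bits} (λ v → zeros (l v))
zerosᴾ L = foldrᴾ (λ (x , l , v) → if x then [] else false ∷ l)
  (growth-const 1 λ { false l v → suc≤+1 _ ; true l v → s≤s z≤n }) L nilᴾ
  (iteᴾ π₀ nilᴾ (boolᴾ false ∷ᴾ π₁))

onesᴾ : ∀ {Γ l} → PT {Γ} {bits} l → PT {Γ} {bits} (λ v → ones (l v))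
onesᴾ L = foldrᴾ (λ (x , l , v) → if x then true ∷ l else [])
  (growth-const 1 λ { true l v → suc≤+1 _ ; false l v → s≤s z≤n }) L nilᴾ
  (iteᴾ π₀ (boolᴾ true ∷ᴾ π₁) nilᴾ)

eqᴾ : ∀ {Γ l m} → PT {Γ} {bits} l → PT {Γ} {bits} m → PT {Γ} {bool} (λ v → eqᵇ (l v) (m v))
eqᴾ {Γ} {l} {m} L M = ptExt (λ v → eq (l v) true (m v))
  (finish ∘ᴾ foldlᴾ {a = bool ⊗ bits} (λ (x , (ok , m) , v) → caseBits m (false , []) λ y m′ → ok ∧ (if x then y else not y) , m′)
    (growth-const 0 λ { x (ok , []) v → ≤-refl ; x (ok , y ∷ m) v → ≤-trans (n≤1+n _) (≤-reflexive (sym (+-identityʳ _))) })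
    L (boolᴾ true ,ᴾ M)
    (matchᴾ (ρ₁ ∘ᴾ π₁) (boolᴾ false ,ᴾ nilᴾ) (((π₀ ∘ᴾ π₁ ∘ᴾ ρ₂) ∧ᴾ iteᴾ (π₀ ∘ᴾ ρ₂) π₀ (notᴾ π₀)) ,ᴾ π₁)))
  where
  finish : PT {bool ⊗ bits} {bool} (λ (ok , m) → ok ∧ caseBits m true (λ _ _ → false))
  finish = π₀ ∧ᴾ matchᴾ ρ₁ (boolᴾ true) (boolᴾ false)
  step : Bool × Bits → Bool → Bool × Bits
  step (ok , m) x = caseBits m (false , []) λ y m′ → ok ∧ (if x then y else not y) , m′
  done : Bool × Bits → Bool
  done (ok , m) = ok ∧ caseBits m true (λ _ _ → false)
  failed : ∀ l m → done (foldl step (false , m) l) ≡ false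
  failed []      m       = refl
  failed (x ∷ l) []      = failed l []
  failed (x ∷ l) (y ∷ m) = failed l m
  eq : ∀ l ok m → done (foldl step (ok , m) l) ≡ ok ∧ eqᵇ l m
  eq []      ok []      = refl
  eq []      ok (_ ∷ _) = refl
  eq (x ∷ l) ok []      = trans (failed l []) (sym (∧-zeroʳ ok))
  eq (x ∷ l) ok (y ∷ m) = trans (eq l _ m) (∧-assoc ok _ _)

-- The first component of the accumulator is the verdict: empty while the strings agree, a single
-- bit once they have been told apart.
lessᴾ : ∀ {Γ l m} → PT {Γ} {bits} l → PT {Γ} {bits} m → PT {Γ} {bool} (λ v → less (l v) (m v))
lessᴾ {Γ} {l} {m} L M = ptExt (λ v → eq (l v) (m v))
  (headᴾ π₀ ∘ᴾ foldlᴾ {a = bits ⊗ bits} (λ (x , u , v) → step u x)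
    (growth-const 1 bound) L (nilᴾ ,ᴾ M)
    (matchᴾ (π₀ ∘ᴾ π₁)
      (matchᴾ (ρ₁ ∘ᴾ π₁) ((boolᴾ false ∷ᴾ nilᴾ) ,ᴾ nilᴾ)
        (iteᴾ (π₀ ∘ᴾ ρ₂)
          (iteᴾ π₀ (nilᴾ ,ᴾ π₁) ((boolᴾ false ∷ᴾ nilᴾ) ,ᴾ π₁))
          (iteᴾ π₀ ((boolᴾ true ∷ᴾ nilᴾ) ,ᴾ π₁) (nilᴾ ,ᴾ π₁))))
      (π₁ ∘ᴾ ρ₂)))
  where
  step : Bits × Bits → Bool → Bits × Bits
  step (d , m) x = caseBits d
    (caseBits m (false ∷ [] , []) λ y m′ →
      if x then (if y then ([] , m′) else (false ∷ [] , m′)) else (if y then (true ∷ [] , m′) else ([] , m′)))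
    (λ _ _ → d , m)
  bound : ∀ x (u : Bits × Bits) (v : ⟦ Γ ⟧) → size (bits ⊗ bits) (step u x) ≤ size (bits ⊗ bits) u + 1
  bound x (_ ∷ _ , m) v = m≤m+n _ 1
  bound x ([] , []) v = ≤-refl
  bound false ([] , false ∷ m) v = ≤-trans (n≤1+n _) (m≤m+n _ 1)
  bound false ([] , true ∷ m) v = m≤m+n _ 1
  bound true ([] , false ∷ m) v = m≤m+n _ 1
  bound true ([] , true ∷ m) v = ≤-trans (n≤1+n _) (m≤m+n _ 1)
  decided : ∀ l d m → headᵇ (proj₁ (foldl step (d ∷ [] , m) l)) ≡ d
  decided []      d m = refl
  decided (x ∷ l) d m = decided l d m
  eq : ∀ l m → headᵇ (proj₁ (foldl step ([] , m) l)) ≡ less l m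
  eq []          m           = refl
  eq (x ∷ l)     []          = decided l false []
  eq (false ∷ l) (false ∷ m) = eq l m
  eq (false ∷ l) (true ∷ m)  = decided l true m
  eq (true ∷ l)  (false ∷ m) = decided l false m
  eq (true ∷ l)  (true ∷ m)  = eq l m

-- Stack machine, tree walk and contest in polynomial time

frame : Ty
frame = bits ⊗ bits ⊗ bits

twoᴾ : ∀ {Γ} → PT {Γ} {bits} (λ _ → two)
twoᴾ = boolᴾ false ∷ᴾ boolᴾ false ∷ᴾ nilᴾ

fourᴾ : ∀ {Γ} → PT {Γ} {bits} (λ _ → four)
fourᴾ = boolᴾ false ∷ᴾ boolᴾ false ∷ᴾ twoᴾ

frameStepᴾ : PT {bits ⊗ frame} {frame} (λ (w , s) → frameStep w s)
frameStepᴾ = ptExt eq (matchᴾ (ρ₂ ∘ᴾ ρ₁) (π₀ ∘ᴾ ρ₁ ,ᴾ π₁ ∘ᴾ ρ₁ ,ᴾ nilᴾ)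
    (iteᴾ π₀ (gate ∷ᴾ dropᴾ twoᴾ st ,ᴾ appendᴾ mem (gate ∷ᴾ nilᴾ) ,ᴾ dropᴾ fourᴾ π₁)
             (selᴾ mem (fitᴾ w π₁) ∷ᴾ st ,ᴾ mem ,ᴾ dropᴾ w π₁)))
  where
  Γ′ = bool ⊗ bits ⊗ bits ⊗ frame
  w : PT {Γ′} {bits} (λ (x , p , w , s) → w)
  w = π₀ ∘ᴾ ρ₂
  st : PT {Γ′} {bits} (λ (x , p , w , s) → proj₁ s)
  st = π₀ ∘ᴾ ρ₁ ∘ᴾ ρ₂
  mem : PT {Γ′} {bits} (λ (x , p , w , s) → proj₁ (proj₂ s))
  mem = π₁ ∘ᴾ ρ₁ ∘ᴾ ρ₂
  gate : PT {Γ′} {bool} (λ (x , p , w , s) → sel (fit four p) (fit two (proj₁ s)))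
  gate = selᴾ (fitᴾ fourᴾ π₁) (fitᴾ twoᴾ st)
  eq : ∀ ((w , st , mem , p) : ⟦ bits ⊗ frame ⟧) →
    caseBits p (st , mem , []) (λ x p → if x
      then (sel (fit four p) (fit two st) ∷ drop 2 st , mem ++ sel (fit four p) (fit two st) ∷ [] , drop 4 p)
      else (sel mem (fit w p) ∷ st , mem , drop (length w) p)) ≡ frameStep w (st , mem , p)
  eq (w , st , mem , [])        = refl
  eq (w , st , mem , false ∷ p) = refl
  eq (w , st , mem , true ∷ p)  = refl

frameStep-size : ∀ w s → size frame (frameStep w s) ≤ size frame s + 2
frameStep-size w (st , mem , [])        = m≤m+n _ 2
frameStep-size w (st , mem , false ∷ p) = ≤-trans (s≤s (s≤s (+-monoʳ-≤ (length st) (+-monoʳ-≤ (suc (length mem)) (s≤s (length-drop-≤ (length w) p))))))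
  (≤-trans (n≤1+n _) (≤-trans (n≤1+n _) (≤-reflexive (eq (length st) (length mem) (length p)))))
  where
  eq : ∀ a b c → suc (suc (suc (suc (a + (suc b + suc c))))) ≡ suc a + (suc b + suc (suc c)) + 2
  eq = solve-∀
frameStep-size w (st , mem , true ∷ p) = ≤-trans (s≤s (s≤s (+-mono-≤ (length-drop-≤ 2 st)
    (s≤s (+-mono-≤ (≤-reflexive (length-++ mem)) (s≤s (length-drop-≤ 4 p)))))))
  (≤-trans (n≤1+n _) (≤-reflexive (eq (length st) (length mem) (length p))))
  where
  eq : ∀ a b c → suc (suc (suc (a + suc (b + 1 + suc c)))) ≡ suc a + (suc b + suc (suc c)) + 2
  eq = solve-∀

runProgramᴾ : PT {bits ⊗ bits} {bool} (λ (d , x) → runProgram d x)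
runProgramᴾ = headᴾ (π₀ ∘ᴾ foldlᴾ {a = frame} (λ (b , s , (d , x)) → frameStep (ones (drop (length (zeros d)) d)) s)
    (growth-const 2 λ b s (d , x) → frameStep-size _ s) π₀
    (nilᴾ ,ᴾ ρ₁ ,ᴾ tailᴾ (dropᴾ (onesᴾ skipped) skipped))
    (frameStepᴾ ∘ᴾ (onesᴾ (skipped ∘ᴾ ρ₂) ,ᴾ π₁)))
  where
  skipped : PT {bits ⊗ bits} {bits} (λ (d , x) → drop (length (zeros d)) d)
  skipped = dropᴾ (zerosᴾ π₀) π₀

truthTableᴾ : PT {bits ⊗ bits ⊗ bits} {bits} (λ (X , x₀ , d) → Hard.truthTable X x₀ d)
truthTableᴾ = ptExt (λ (X , x₀ , d) → trans (cong reverse (eq d X x₀ [])) (reverse-involutive (Hard.truthTable X x₀ d)))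
  (reverseᴾ (ρ₁ ∘ᴾ foldlᴾ {a = bits ⊗ bits} (λ (b , (x , acc) , (X , x₀ , d)) → inc x , runProgram d x ∷ acc)
    (growth-const 1 λ b (x , acc) v → bound x (length acc)) π₀ (π₁ ,ᴾ nilᴾ)
    (incᴾ (π₀ ∘ᴾ π₁) ,ᴾ runProgramᴾ ∘ᴾ (ρ₂ ∘ᴾ ρ₂ ,ᴾ π₀ ∘ᴾ π₁) ∷ᴾ ρ₁ ∘ᴾ π₁)))
  where
  bound : ∀ x a → suc (length (inc x)) + suc (suc a) ≤ suc (length x) + suc a + 1
  bound x a = ≤-reflexive (trans (cong (λ t → suc t + suc (suc a)) (length-inc x))
    (trans (+-suc (suc (length x)) (suc a)) (+-comm 1 _)))
  eq : ∀ d X x acc → proj₂ (foldl (λ (x , acc) b → inc x , runProgram d x ∷ acc) (x , acc) X)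
                     ≡ orbit (runProgram d) (length X) x ʳ++ acc
  eq d []      x acc = refl
  eq d (_ ∷ X) x acc = eq d X (inc x) (runProgram d x ∷ acc)

-- The growth condition has to hold for all strings, also malformed ones. A link meets it because it
-- replaces any value by one of |X| bits.
chainᴾ : PT {bits ⊗ (bits ⊗ bits) ⊗ bits ⊗ bits} {bits ⊗ bits} (λ (u , s , X , x₀) → Hard.chain X x₀ u s)
chainᴾ = foldlᴾ (λ (b , s , (u , s₀ , X , x₀)) → Hard.link X x₀ s)
    (growth-by (λ (u , s₀ , X , x₀) → length X + 1) (pb-+ X-poly (pb-const 1)) (λ { b (v , acc) (u , s₀ , X , x₀) → bound X x₀ v acc }))
    π₀ π₁
    (truthTableᴾ ∘ᴾ (π₀ ∘ᴾ ρ₂ ∘ᴾ ρ₂ ,ᴾ ρ₁ ∘ᴾ ρ₂ ∘ᴾ ρ₂ ,ᴾ tailᴾ (π₀ ∘ᴾ π₁)) ,ᴾ headᴾ (π₀ ∘ᴾ π₁) ∷ᴾ ρ₁ ∘ᴾ π₁)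
  where
  Γ = bits ⊗ (bits ⊗ bits) ⊗ bits ⊗ bits
  X-poly : PolyBounded (size Γ) (λ (u , s₀ , X , x₀) → length X)
  X-poly = pb-≤ (λ (u , s₀ , X , x₀) → ≤-trans (≤-trans (n≤1+n (length X)) (m≤m+n (suc (length X)) (suc (length x₀))))
    (≤-trans (m≤n+m _ (size (bits ⊗ bits) s₀)) (m≤n+m _ (suc (length u))))) pb-size
  eq : ∀ n v a → suc n + suc (suc a) + v ≡ suc v + suc a + (n + 1)
  eq = solve-∀
  bound : ∀ X x₀ v acc → size (bits ⊗ bits) (Hard.link X x₀ (v , acc)) ≤ size (bits ⊗ bits) (v , acc) + (length X + 1)
  bound X x₀ v acc = ≤-trans (≤-reflexive (cong (λ t → suc t + suc (suc (length acc))) (length-orbit _ (length X) x₀)))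
    (≤-trans (m≤m+n _ (length v)) (≤-reflexive (eq (length X) (length v) (length acc))))

params : Ty
params = bits ⊗ bits

Gᴾ : PT {bits ⊗ params} {bits ⊗ bits} (λ (v , X , x₀) → Hard.G X x₀ v)
Gᴾ = fitᴾ (π₀ ∘ᴾ ρ₁) (π₀ ∘ᴾ whole) ,ᴾ ρ₁ ∘ᴾ whole
  where
  whole : PT {bits ⊗ params} {bits ⊗ bits} (λ (v , X , x₀) → Hard.chain X x₀ X (v , []))
  whole = chainᴾ ∘ᴾ (π₁ ,ᴾ (π₀ ,ᴾ nilᴾ) ,ᴾ ρ₁)

module _ (X x₀ : Bits) where
  open Hard X x₀

  length-G₁ : ∀ v → length (proj₁ (G v)) ≡ N
  length-G₁ v = length-fit X _

  length-G₂ : ∀ v → length (proj₂ (G v)) ≡ N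
  length-G₂ v = trans (chain-length₂ X v []) (+-identityʳ N)

  length-chooseG : ∀ b v → length (choose b (G v)) ≡ N
  length-chooseG false = length-G₁
  length-chooseG true  = length-G₂

chooseᴾ : ∀ {Γ b p} → PT {Γ} {bool} b → PT {Γ} {bits ⊗ bits} p → PT {Γ} {bits} (λ v → choose (b v) (p v))
chooseᴾ {b = b} {p} B P = ptExt (λ v → eq (b v) (p v)) (iteᴾ B (ρ₁ ∘ᴾ P) (π₀ ∘ᴾ P))
  where
  eq : ∀ b p → (if b then proj₂ p else proj₁ p) ≡ choose b p
  eq false p = refl
  eq true  p = refl

leafᴾ : PT {bits ⊗ params} {bits} (λ (p , X , x₀) → Hard.leaf X x₀ p)
leafᴾ = ptExt (λ (p , X , x₀) → trans (cong (λ l → caseBits l [] (λ x l → not x ∷ l)) (followed X x₀ p p)) (flipped (Hard.follow X x₀ p p)))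
  (matchᴾ (foldrᴾ (λ (b , u , (p , X , x₀)) → choose b (Hard.G X x₀ u))
      (growth-by (λ (p , X , x₀) → length X) X-poly λ { b u (p , X , x₀) → s≤s (≤-trans (≤-reflexive (length-chooseG X x₀ b u)) (m≤n+m _ (length u))) })
      π₀ π₀ (chooseᴾ π₀ (Gᴾ ∘ᴾ (π₁ ,ᴾ ρ₁ ∘ᴾ ρ₂))))
    nilᴾ (notᴾ π₀ ∷ᴾ π₁))
  where
  X-poly : PolyBounded (size (bits ⊗ params)) (λ (p , X , x₀) → length X)
  X-poly = pb-≤ (λ (p , X , x₀) → ≤-trans (≤-trans (n≤1+n (length X)) (m≤m+n (suc (length X)) (suc (length x₀)))) (m≤n+m _ (suc (length p)))) pb-size
  followed : ∀ X x₀ v p → foldr (λ b u → choose b (Hard.G X x₀ u)) v p ≡ Hard.follow X x₀ v p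
  followed X x₀ v []      = refl
  followed X x₀ v (b ∷ p) = cong (λ u → choose b (Hard.G X x₀ u)) (followed X x₀ v p)
  flipped : ∀ l → caseBits l [] (λ x l → not x ∷ l) ≡ flipHead l
  flipped []      = refl
  flipped (x ∷ l) = refl

claim : Ty
claim = bool ⊗ bits ⊗ bits

kidsᴾ : PT {claim ⊗ params} {claim ⊗ claim} (λ (σ , X , x₀) → Hard.kids X x₀ σ)
kidsᴾ = ptExt eq (iteᴾ (π₀ ∘ᴾ π₀)
    ((boolᴾ true ,ᴾ π₀ ∘ᴾ below ,ᴾ rest) ,ᴾ (boolᴾ true ,ᴾ ρ₁ ∘ᴾ below ,ᴾ rest))
    ((headᴾ rest ,ᴾ fitᴾ X rest₁ ,ᴾ rest₄) ,ᴾ (headᴾ rest₂ ,ᴾ fitᴾ X rest₃ ,ᴾ rest₄)))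
  where
  Γ = claim ⊗ params
  X : PT {Γ} {bits} (λ (σ , X , x₀) → X)
  X = π₁
  rest : PT {Γ} {bits} (λ ((f , v , r) , X , x₀) → r)
  rest = ρ₂ ∘ᴾ π₀
  rest₁ = tailᴾ rest
  rest₂ = dropᴾ X rest₁
  rest₃ = tailᴾ rest₂
  rest₄ = dropᴾ X rest₃
  below : PT {Γ} {bits ⊗ bits} (λ ((f , v , r) , X , x₀) → Hard.G X x₀ v)
  below = Gᴾ ∘ᴾ (π₁ ∘ᴾ π₀ ,ᴾ ρ₁)
  eq : ∀ (((f , v , r) , X , x₀) : ⟦ Γ ⟧) → (if f then _ else _) ≡ Hard.kids X x₀ (f , v , r)
  eq ((false , v , r) , X , x₀) = refl
  eq ((true , v , r) , X , x₀)  = refl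

agreedᴾ : ∀ {Γ σ τ} → PT {Γ} {claim} σ → PT {Γ} {claim} τ → PT {Γ} {bool} (λ v → agreed (σ v) (τ v))
agreedᴾ S T = π₀ ∘ᴾ S ∧ᴾ (π₀ ∘ᴾ T ∧ᴾ eqᴾ (π₁ ∘ᴾ S) (π₁ ∘ᴾ T))

walkTy : Ty
walkTy = bool ⊗ bits ⊗ claim ⊗ claim ⊗ bits ⊗ bits

walkStepᴾ : PT {walkTy ⊗ params} {walkTy} (λ (w , X , x₀) → Hard.walkStep X x₀ w)
walkStepᴾ = ptExt eq (iteᴾ (π₀ ∘ᴾ π₀) π₀
    (iteᴾ (agreedᴾ σ₀ τ₀)
      (iteᴾ (agreedᴾ σ₁ τ₁)
        (boolᴾ true ,ᴾ path ,ᴾ σ ,ᴾ τ ,ᴾ π₁ ∘ᴾ σ₀ ,ᴾ π₁ ∘ᴾ σ₁)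
        (boolᴾ false ,ᴾ boolᴾ true ∷ᴾ path ,ᴾ σ₁ ,ᴾ τ₁ ,ᴾ lr))
      (boolᴾ false ,ᴾ boolᴾ false ∷ᴾ path ,ᴾ σ₀ ,ᴾ τ₀ ,ᴾ lr)))
  where
  Γ = walkTy ⊗ params
  path : PT {Γ} {bits} (λ ((d , p , σ , τ , lr) , _) → p)
  path = π₁ ∘ᴾ π₀
  σ : PT {Γ} {claim} (λ ((d , p , σ , τ , lr) , _) → σ)
  σ = π₀ ∘ᴾ ρ₂ ∘ᴾ π₀
  τ : PT {Γ} {claim} (λ ((d , p , σ , τ , lr) , _) → τ)
  τ = π₁ ∘ᴾ ρ₂ ∘ᴾ π₀
  lr : PT {Γ} {bits ⊗ bits} (λ ((d , p , σ , τ , lr) , _) → lr)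
  lr = ρ₂ ∘ᴾ ρ₂ ∘ᴾ π₀
  σ₀ = π₀ ∘ᴾ kidsᴾ ∘ᴾ (σ ,ᴾ ρ₁)
  σ₁ = ρ₁ ∘ᴾ kidsᴾ ∘ᴾ (σ ,ᴾ ρ₁)
  τ₀ = π₀ ∘ᴾ kidsᴾ ∘ᴾ (τ ,ᴾ ρ₁)
  τ₁ = ρ₁ ∘ᴾ kidsᴾ ∘ᴾ (τ ,ᴾ ρ₁)
  eq : ∀ ((w , X , x₀) : ⟦ Γ ⟧) → (if proj₁ w then _ else _) ≡ Hard.walkStep X x₀ w
  eq ((true , w) , X , x₀)  = refl
  eq ((false , w) , X , x₀) = refl

module _ (X x₀ : Bits) where
  open Hard X x₀

  length-dropped : ∀ ρ → length (drop N (tailᵇ (drop N (tailᵇ ρ)))) ≤ length ρ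
  length-dropped ρ = ≤-trans (length-drop-≤ N _) (≤-trans (length-tailᵇ (drop N (tailᵇ ρ)))
    (≤-trans (length-drop-≤ N _) (length-tailᵇ ρ)))

  length-kid : ∀ σ → length (value (proj₁ (kids σ))) ≡ N × length (value (proj₂ (kids σ))) ≡ N
  length-kid (false , v , ρ) = length-fit X _ , length-fit X _
  length-kid (true , v , ρ)  = length-G₁ X x₀ v , length-G₂ X x₀ v

  private
    bound : ∀ {u n v r ρ} → u ≡ n → r ≤ ρ → 2 + (suc u + suc r) ≤ 2 + (suc v + suc ρ) + n
    bound {u} {n} {v} {r} {ρ} refl p = ≤-trans (+-monoʳ-≤ 2 (+-monoʳ-≤ (suc u) (s≤s p)))
      (≤-trans (m≤m+n _ v) (≤-reflexive (eq u ρ v)))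
      where
      eq : ∀ u ρ v → 2 + (suc u + suc ρ) + v ≡ 2 + (suc v + suc ρ) + u
      eq = solve-∀

  kid-size : ∀ σ → size claim (proj₁ (kids σ)) ≤ size claim σ + N × size claim (proj₂ (kids σ)) ≤ size claim σ + N
  kid-size (false , v , ρ) = bound {v = length v} (length-fit X _) (length-dropped ρ) , bound {v = length v} (length-fit X _) (length-dropped ρ)
  kid-size (true , v , ρ)  = bound {v = length v} (length-G₁ X x₀ v) ≤-refl , bound {v = length v} (length-G₂ X x₀ v) ≤-refl

  -- Passing to children gives each of the two claims at most N new bits and the path one; the final
  -- pair costs at most 2N.
  walkStep-size : ∀ w → size walkTy (walkStep w) ≤ size walkTy w + (N + N + 1)
  walkStep-size (true , _) = m≤m+n _ _
  walkStep-size (false , p , σ , τ , l , r)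
    with agreed (proj₁ (kids σ)) (proj₁ (kids τ)) | agreed (proj₂ (kids σ)) (proj₂ (kids τ))
  ... | false | _     = ≤-trans (s≤s (s≤s (s≤s (s≤s (+-monoʳ-≤ (length p) (+-mono-≤ (proj₁ (kid-size σ)) (+-monoˡ-≤ _ (proj₁ (kid-size τ)))))))))
                          (≤-reflexive (eq (length p) (size claim σ) (size claim τ) (suc (length l) + suc (length r)) N))
    where
    eq : ∀ p a b c n → suc (suc (suc (suc (p + ((a + n) + ((b + n) + c)))))) ≡ 2 + (suc p + (a + (b + c))) + (n + n + 1)
    eq = solve-∀
  ... | true  | false = ≤-trans (s≤s (s≤s (s≤s (s≤s (+-monoʳ-≤ (length p) (+-mono-≤ (proj₂ (kid-size σ)) (+-monoˡ-≤ _ (proj₂ (kid-size τ)))))))))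
                          (≤-reflexive (eq (length p) (size claim σ) (size claim τ) (suc (length l) + suc (length r)) N))
    where
    eq : ∀ p a b c n → suc (suc (suc (suc (p + ((a + n) + ((b + n) + c)))))) ≡ 2 + (suc p + (a + (b + c))) + (n + n + 1)
    eq = solve-∀
  ... | true  | true rewrite proj₁ (length-kid σ) | proj₂ (length-kid σ) =
    ≤-trans (m≤m+n _ (suc (length l + length r))) (≤-reflexive (eq (length p) (size claim σ) (size claim τ) (length l) (length r) N))
    where
    eq : ∀ p a b l r n → 2 + (suc p + (a + (b + (suc n + suc n)))) + suc (l + r) ≡ 2 + (suc p + (a + (b + (suc l + suc r)))) + (n + n + 1)
    eq = solve-∀

walkᴾ : PT {walkTy ⊗ params} {walkTy} (λ (w , X , x₀) → Hard.walk X x₀ X w)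
walkᴾ = foldlᴾ (λ (b , w , (w₀ , X , x₀)) → Hard.walkStep X x₀ w)
  (growth-by (λ (w₀ , X , x₀) → length X + length X + 1) (pb-+ (pb-+ X-poly X-poly) (pb-const 1))
    λ { b w (w₀ , X , x₀) → walkStep-size X x₀ w })
  (π₀ ∘ᴾ ρ₁) π₀ (walkStepᴾ ∘ᴾ (π₁ ,ᴾ ρ₁ ∘ᴾ ρ₂))
  where
  X-poly : PolyBounded (size (walkTy ⊗ params)) (λ (w , X , x₀) → length X)
  X-poly = pb-≤ (λ (w , X , x₀) → ≤-trans (≤-trans (n≤1+n (length X)) (m≤m+n (suc (length X)) (suc (length x₀)))) (m≤n+m _ (size walkTy w))) pb-size

validSecretᴾ : PT {(bits ⊗ bits) ⊗ bits ⊗ params} {bool} (λ (lr , s , X , x₀) → Hard.validSecret X x₀ lr s)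
validSecretᴾ = eqᴾ (π₀ ∘ᴾ chained) (π₀ ∘ᴾ π₀) ∧ᴾ eqᴾ (ρ₁ ∘ᴾ chained) (fitᴾ steps (ρ₁ ∘ᴾ π₀))
  where
  Γ = (bits ⊗ bits) ⊗ bits ⊗ params
  steps : PT {Γ} {bits} (λ (lr , s , X , x₀) → zeros (fit X s))
  steps = zerosᴾ (fitᴾ (π₀ ∘ᴾ ρ₂) π₁)
  chained : PT {Γ} {bits ⊗ bits} (λ (lr , s , X , x₀) → Hard.chain X x₀ (zeros (fit X s)) (drop (length X) s , []))
  chained = chainᴾ ∘ᴾ (steps ,ᴾ (dropᴾ (π₀ ∘ᴾ ρ₂) π₁ ,ᴾ nilᴾ) ,ᴾ ρ₂)

-- `Verdict` has no counterpart in `Ty`, so judging and awarding are merged into one case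
-- distinction.
awardᴾ : PT {walkTy ⊗ bits ⊗ bits ⊗ params} {bits} (λ (w , s , s′ , X , x₀) →
           Hard.award X x₀ (Hard.judge X x₀ w) (proj₂ (proj₂ (proj₂ (proj₂ w)))) s s′)
awardᴾ = ptExt eq (iteᴾ (π₀ ∘ᴾ π₀)
    (iteᴾ (π₀ ∘ᴾ σ)
      (iteᴾ (π₀ ∘ᴾ τ) (iteᴾ (lessᴾ (π₁ ∘ᴾ σ) (π₁ ∘ᴾ τ)) s s′) s)
      (iteᴾ (π₀ ∘ᴾ τ) s′
        (iteᴾ (validSecretᴾ ∘ᴾ (lr ,ᴾ s ,ᴾ ps))
          (iteᴾ (validSecretᴾ ∘ᴾ (lr ,ᴾ s′ ,ᴾ ps)) (iteᴾ (lessᴾ s s′) s s′) s) s′)))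
    (iteᴾ (π₀ ∘ᴾ σ ∧ᴾ eqᴾ (π₁ ∘ᴾ σ) (leafᴾ ∘ᴾ (π₁ ∘ᴾ π₀ ,ᴾ ps))) s s′))
  where
  Γ = walkTy ⊗ bits ⊗ bits ⊗ params
  s s′ : PT {Γ} {bits} _
  s  = π₁
  s′ = π₀ ∘ᴾ ρ₂
  ps : PT {Γ} {params} _
  ps = ρ₁ ∘ᴾ ρ₂
  σ τ : PT {Γ} {claim} _
  σ = π₀ ∘ᴾ ρ₂ ∘ᴾ π₀
  τ = π₁ ∘ᴾ ρ₂ ∘ᴾ π₀
  lr : PT {Γ} {bits ⊗ bits} _
  lr = ρ₂ ∘ᴾ ρ₂ ∘ᴾ π₀
  prize : ⟦ Γ ⟧ → Bits
  prize ((d , p , (f , v , _) , (f′ , v′ , _) , lr) , s , s′ , X , x₀) =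
    if d then (if f then (if f′ then (if less v v′ then s else s′) else s)
                    else (if f′ then s′ else smaller (Hard.validSecret X x₀ lr) s s′))
         else (if f ∧ eqᵇ v (Hard.leaf X x₀ p) then s else s′)
  eq : ∀ ((w , s , s′ , X , x₀) : ⟦ Γ ⟧) → prize (w , s , s′ , X , x₀) ≡
         Hard.award X x₀ (Hard.judge X x₀ w) (proj₂ (proj₂ (proj₂ (proj₂ w)))) s s′
  eq ((false , p , (f , v , _) , _) , s , s′ , X , x₀) with f ∧ eqᵇ v (Hard.leaf X x₀ p)
  ... | false = refl
  ... | true  = refl
  eq ((true , p , (false , v , _) , (false , v′ , _) , lr) , s , s′ , X , x₀) = refl
  eq ((true , p , (false , v , _) , (true , v′ , _) , lr) , s , s′ , X , x₀) = refl
  eq ((true , p , (true , v , _) , (false , v′ , _) , lr) , s , s′ , X , x₀) = refl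
  eq ((true , p , (true , v , _) , (true , v′ , _) , lr) , s , s′ , X , x₀) with less v v′
  ... | false = refl
  ... | true  = refl

contestᴾ : PT {bits ⊗ bits ⊗ params} {bits} (λ (y , z , X , x₀) → Hard.contest X x₀ y z)
contestᴾ = awardᴾ ∘ᴾ (walkᴾ ∘ᴾ ((boolᴾ false ,ᴾ nilᴾ ,ᴾ
      (boolᴾ false ,ᴾ nilᴾ ,ᴾ dropᴾ XX π₀) ,ᴾ (boolᴾ false ,ᴾ nilᴾ ,ᴾ dropᴾ XX π₁) ,ᴾ nilᴾ ,ᴾ nilᴾ) ,ᴾ ρ₂)
    ,ᴾ fitᴾ XX π₀ ,ᴾ fitᴾ XX π₁ ,ᴾ ρ₂)
  where
  XX : PT {bits ⊗ bits ⊗ params} {bits} (λ (y , z , X , x₀) → X ++ X)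
  XX = appendᴾ (π₀ ∘ᴾ ρ₂) (π₀ ∘ᴾ ρ₂)

-- A unary numeral for min(|y|, 2·|acc|); the cap at |y| keeps the doubling polynomial.
doubled : Bits → Bits → Bits
doubled y acc = drop (length (drop (length (acc ++ acc)) y)) y

unary : Bits → Bits → Bits
unary y x = fit (foldl (λ acc _ → doubled y acc) (false ∷ []) x) []

unaryᴾ : PT {bits ⊗ bits} {bits} (λ (y , x) → unary y x)
unaryᴾ = fitᴾ (foldlᴾ (λ (b , acc , (y , x)) → doubled y acc)
    (growth-by (λ (y , x) → suc (length y)) (pb-≤ (λ (y , x) → m≤m+n (suc (length y)) _) pb-size)
      λ { b acc (y , x) → ≤-trans (s≤s (length-drop-≤ (length (drop (length (acc ++ acc)) y)) y)) (m≤n+m _ (suc (length acc))) })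
    ρ₁ (boolᴾ false ∷ᴾ nilᴾ) (dropᴾ (dropᴾ (appendᴾ π₁ π₁) (π₀ ∘ᴾ ρ₂)) (π₀ ∘ᴾ ρ₂))) nilᴾ

length-doubled : ∀ y acc → length acc + length acc ≤ length y → length (doubled y acc) ≡ length acc + length acc
length-doubled y acc le = trans (length-drop (length (drop (length (acc ++ acc)) y)) y)
  (trans (cong (length y ∸_) (trans (length-drop (length (acc ++ acc)) y) (cong (length y ∸_) (length-++ acc)))) (m∸[m∸n]≡n le))

fit-[] : ∀ u → fit u [] ≡ replicate (length u) false
fit-[] []      = refl
fit-[] (_ ∷ u) = cong (false ∷_) (fit-[] u)

unary-correct : ∀ y x → 2 ^ length x ≤ length y → unary y x ≡ replicate (2 ^ length x) false
unary-correct y x le = trans (fit-[] _) (cong (λ k → replicate k false) (trans (grow x (false ∷ []) (≤-trans (≤-reflexive (*-identityˡ _)) le)) (*-identityˡ _)))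
  where
  eq : ∀ a p → (a + a) * p ≡ a * (2 * p)
  eq = solve-∀
  grow : ∀ x acc → length acc * 2 ^ length x ≤ length y →
         length (foldl (λ acc _ → doubled y acc) acc x) ≡ length acc * 2 ^ length x
  grow []      acc le = sym (*-identityʳ _)
  grow (_ ∷ x) acc le = trans (grow x (doubled y acc) le′) eq′
    where
    fits : length acc + length acc ≤ length y
    fits = ≤-trans (m≤m*n (length acc + length acc) (2 ^ length x) ⦃ m^n≢0 2 (length x) ⦄) (≤-trans (≤-reflexive (eq (length acc) (2 ^ length x))) le)
    eq′ : length (doubled y acc) * 2 ^ length x ≡ length acc * (2 * 2 ^ length x)
    eq′ = trans (cong (_* 2 ^ length x) (length-doubled y acc fits)) (eq (length acc) (2 ^ length x))
    le′ : length (doubled y acc) * 2 ^ length x ≤ length y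
    le′ = ≤-trans (≤-reflexive eq′) le

answer : Bits → Bits → Bits → Bits → Bits → Bool
answer X x₀ x y z = sel (drop (length X) (Hard.contest X x₀ y z)) x

-- The numeral for 2^|x| is not polynomial in |x|, but it is in the length of the claims, so it is
-- computed under the cover of `y`.
verify : Bits → Bits → Bits → Bool
verify x y z = answer (unary y x) (fit x []) x y z

verifyᴾ : PT {bits ⊗ bits ⊗ bits} {bool} (λ (z , y , x) → verify (reverse x) (reverse y) (reverse z))
verifyᴾ = selᴾ (dropᴾ π₀ (contestᴾ ∘ᴾ (ρ₁ ∘ᴾ ρ₁ ∘ᴾ ρ₂ ,ᴾ π₀ ∘ᴾ ρ₁ ∘ᴾ ρ₂ ,ᴾ π₀ ,ᴾ π₁))) (π₀ ∘ᴾ ρ₂) ∘ᴾ all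
  where
  all : PT {bits ⊗ bits ⊗ bits} {bits ⊗ bits ⊗ bits ⊗ bits ⊗ bits}
          (λ (z , y , x) → unary (reverse y) (reverse x) , fit (reverse x) [] , reverse x , reverse z , reverse y)
  all = unaryᴾ ∘ᴾ (reverseᴾ π₁ ,ᴾ reverseᴾ ρ₂) ,ᴾ fitᴾ (reverseᴾ ρ₂) nilᴾ ,ᴾ reverseᴾ ρ₂ ,ᴾ reverseᴾ π₀ ,ᴾ reverseᴾ π₁

abstract
  verifier : Σ TM λ M → Σ ℕ λ e → ∀ x y z t → poly e (length x + length y + length z) ≤ t →
    run M t (initConf M (encode3 x y z)) ≡ just (verify x y z)
  verifier = proj₁ (pt-decidable verifyᴾ) , proj₁ (proj₂ (pt-decidable verifyᴾ)) , λ x y z t le →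
    trans (proj₂ (proj₂ (pt-decidable verifyᴾ)) x y z t le)
      (cong just (trans (cong₂ (λ a b → verify a b (reverse (reverse z))) (reverse-involutive x) (reverse-involutive y))
                        (cong (verify x y) (reverse-involutive z))))

-- The hard language and its symmetric witnesses

module At (n : ℕ) where

  X x₀ : Bits
  X  = replicate (2 ^ n) false
  x₀ = replicate n false

  open Hard X x₀ public

  N≡ : N ≡ 2 ^ n
  N≡ = length-replicate (2 ^ n)

  open Winner (≤-trans (m^n>0 2 n) (≤-reflexive (sym N≡))) public

  answer-fst : ∀ x z → answer X x₀ x honestClaim z ≡ sel hard x
  answer-fst x z = cong (λ s → sel (drop N s) x) (contest-fst z)

  answer-snd : ∀ x y → answer X x₀ x y honestClaim ≡ sel hard x
  answer-snd x y = cong (λ s → sel (drop N s) x) (contest-snd y)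

-- 2N bits of secret, then for each of N levels two values of N bits with a flag each.
claimLength : ℕ → ℕ
claimLength n = 2 ^ n + 2 ^ n + 2 ^ n * (suc (2 ^ n) + suc (2 ^ n))

toList-subst : ∀ {m n} (e : m ≡ n) (v : Vec Bool m) → toList (subst (Vec Bool) e v) ≡ toList v
toList-subst refl v = refl

abstract
  honest : ∀ n → Vec Bool (claimLength n)
  honest n = subst (Vec Bool) (trans length-honestClaim (cong (λ N → N + N + N * (suc N + suc N)) N≡)) (fromList honestClaim)
    where open At n

  toList-honest : ∀ n → toList (honest n) ≡ At.honestClaim n
  toList-honest n = trans (toList-subst _ (fromList (At.honestClaim n))) (toList∘fromList (At.honestClaim n))

-- One language serves every α; α only decides from which length on the bound is violated.
hardLanguage : Language
hardLanguage x = sel (At.hard (length x)) x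

verify-answer : ∀ x (y z : Vec Bool (claimLength (length x))) →
  verify x (toList y) (toList z) ≡ answer (At.X (length x)) (At.x₀ (length x)) x (toList y) (toList z)
verify-answer x y z = cong₂ (λ X x₀ → answer X x₀ x (toList y) (toList z))
  (unary-correct (toList y) x (≤-trans (≤-trans (m≤m+n _ _) (m≤m+n _ _)) (≤-reflexive (sym (length-toList y))))) (fit-[] x)

verify-fst : ∀ x z → verify x (toList (honest (length x))) (toList z) ≡ hardLanguage x
verify-fst x z = trans (verify-answer x (honest n) z)
  (trans (cong (λ y → answer (At.X n) (At.x₀ n) x y (toList z)) (toList-honest n)) (At.answer-fst n x (toList z)))
  where n = length x

verify-snd : ∀ x y → verify x (toList y) (toList (honest (length x))) ≡ hardLanguage x
verify-snd x y = trans (verify-answer x y (honest n))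
  (trans (cong (λ z → answer (At.X n) (At.x₀ n) x (toList y) z) (toList-honest n)) (At.answer-snd n x (toList y)))
  where n = length x

-- The left side is the base of `poly` at the total input length. It is at most 16 N² = 2^(4 + 2n),
-- and 6(n + 1) is a convenient multiple of n + 1 above this exponent.
input≤ : ∀ n → 2 + (n + claimLength n + claimLength n) ≤ 2 ^ (6 * suc n)
input≤ n = begin
  2 + (n + claimLength n + claimLength n)    ≤⟨ +-monoʳ-≤ 2 (+-monoˡ-≤ (claimLength n) (+-monoˡ-≤ (claimLength n) (k≤poly n 0))) ⟩
  2 + (N + claimLength n + claimLength n)    ≡⟨ eq₁ N ⟩
  2 + 9 * N + 4 * (N * N)                    ≤⟨ +-monoˡ-≤ (4 * (N * N)) (+-mono-≤ (*-monoʳ-≤ 2 (≤-trans 1≤N N≤N²)) (*-monoʳ-≤ 9 N≤N²)) ⟩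
  2 * (N * N) + 9 * (N * N) + 4 * (N * N)    ≤⟨ m≤m+n _ (N * N) ⟩
  2 * (N * N) + 9 * (N * N) + 4 * (N * N) + N * N ≡⟨ eq₂ N ⟩
  2 ^ 4 * (N * N)                            ≡⟨ cong (2 ^ 4 *_) (sym (^-distribˡ-+-* 2 n n)) ⟩
  2 ^ 4 * 2 ^ (n + n)                        ≡⟨ sym (^-distribˡ-+-* 2 4 (n + n)) ⟩
  2 ^ (4 + (n + n))                          ≤⟨ ^-monoʳ-≤ 2 (≤-trans (m≤m+n (4 + (n + n)) (2 + 4 * n)) (≤-reflexive (eq₃ n))) ⟩
  2 ^ (6 * suc n)                            ∎
  where
  open ≤-Reasoning
  N = 2 ^ n
  1≤N : 1 ≤ N
  1≤N = m^n>0 2 n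
  N≤N² : N ≤ N * N
  N≤N² = m≤m*n N N ⦃ m^n≢0 2 n ⦄
  eq₁ : ∀ N → 2 + (N + (N + N + N * (suc N + suc N)) + (N + N + N * (suc N + suc N))) ≡ 2 + 9 * N + 4 * (N * N)
  eq₁ = solve-∀
  eq₂ : ∀ N → 2 * (N * N) + 9 * (N * N) + 4 * (N * N) + N * N ≡ 2 ^ 4 * (N * N)
  eq₂ = solve-∀
  eq₃ : ∀ n → 4 + (n + n) + (2 + 4 * n) ≡ 6 * suc n
  eq₃ = solve-∀

-- The same string is the witness on both sides: the contest returns the honest secret whether it is
-- presented as `y` or as `z`.
hardLanguage-S2E : InS2E hardLanguage
hardLanguage-S2E = c , claimLength , M , length≤ ,
    (λ x y z → _ , halts x y z) ,
    (λ x e → honest (length x) , λ z → trans (halts x (honest (length x)) z) (cong just (trans (verify-fst x z) e))) ,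
    (λ x e → honest (length x) , λ y → trans (halts x y (honest (length x))) (cong just (trans (verify-snd x y) e)))
  where
  M : TM
  M = proj₁ verifier
  e c : ℕ
  e = proj₁ (proj₂ verifier)
  -- With `suc e` in place of `e` the constant also bounds the length of the claims, even if `e` is
  -- 0.
  c = 6 * suc e
  exponent : ∀ n → 6 * suc n * suc e ≡ c * suc n
  exponent n = trans (*-assoc 6 (suc n) (suc e)) (trans (cong (6 *_) (*-comm (suc n) (suc e))) (sym (*-assoc 6 (suc e) (suc n))))
  length≤ : ∀ n → claimLength n ≤ 2 ^ (c * suc n)
  length≤ n = ≤-trans (≤-trans (m≤n+m (claimLength n) (2 + (n + claimLength n))) (input≤ n))
    (^-monoʳ-≤ 2 (≤-trans (m≤m*n (6 * suc n) (suc e)) (≤-reflexive (exponent n))))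
  time≤ : ∀ x (y z : Vec Bool (claimLength (length x))) →
    poly e (length x + length (toList y) + length (toList z)) ≤ 2 ^ (c * suc (length x))
  time≤ x y z rewrite length-toList y | length-toList z = ≤-trans (^-monoˡ-≤ e (input≤ (length x)))
    (≤-trans (≤-reflexive (^-*-assoc 2 (6 * suc (length x)) e))
             (^-monoʳ-≤ 2 (≤-trans (*-monoʳ-≤ (6 * suc (length x)) (n≤1+n e)) (≤-reflexive (exponent (length x))))))
  halts : ∀ x (y z : Vec Bool (claimLength (length x))) →
    run M (2 ^ (c * suc (length x))) (initConf M (encode3 x (toList y) (toList z))) ≡ just (verify x (toList y) (toList z))
  halts x y z = proj₂ (proj₂ verifier) x (toList y) (toList z) _ (time≤ x y z)

-- Small circuits have short programs

nth : Bits → ℕ → Bool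
nth []      _       = false
nth (x ∷ l) zero    = x
nth (x ∷ l) (suc k) = nth l k

bit : Bool → ℕ
bit false = 0
bit true  = 1

number : Bits → ℕ
number []      = 0
number (b ∷ i) = bit b + (number i + number i)

nth-half : ∀ b l k → nth (half b l) k ≡ nth l (bit b + (k + k))
nth-half b     []      k       = refl
nth-half false (x ∷ l) zero    = refl
nth-half false (x ∷ l) (suc k) = trans (nth-half true l k) (cong (nth l) (sym (+-suc k k)))
nth-half true  (x ∷ l) k       = nth-half false l k

-- Addresses out of range read as false on both sides, so this holds for a memory of any length, not
-- only for powers of two.
sel-nth : ∀ l i → sel l i ≡ nth l (number i)
sel-nth []      []      = refl
sel-nth (x ∷ l) []      = refl
sel-nth l       (b ∷ i) = trans (sel-nth (half b l) i) (nth-half b l (number i))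

halve : ∀ a → Σ Bool λ b → Σ ℕ λ q → bit b + (q + q) ≡ a
halve zero    = false , 0 , refl
halve (suc a) with halve a
... | false , q , e = true , q , cong suc e
... | true  , q , e = false , suc q , trans (cong suc (+-suc q q)) (cong suc e)

address : ∀ w a → suc a ≤ 2 ^ w → Σ Bits λ i → length i ≡ w × number i ≡ a
address zero    zero    _ = [] , refl , refl
address zero    (suc a) (s≤s ())
address (suc w) a       h with halve a
... | b , q , e with address w q (q< (2 ^ w) (≤-trans (s≤s (≤-trans (m≤n+m (q + q) (bit b)) (≤-reflexive e))) (≤-trans h (≤-reflexive (cong (2 ^ w +_) (+-identityʳ _))))))
  where
  q< : ∀ p → suc (q + q) ≤ p + p → suc q ≤ p
  q< p h = ≰⇒> λ p≤q → <-irrefl refl (≤-trans h (+-mono-≤ p≤q p≤q))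
... | i , l , n = b ∷ i , cong suc l , trans (cong (λ k → bit b + (k + k)) n) e

nth-++ˡ : ∀ (x l : Bits) k → suc k ≤ length x → nth (x ++ l) k ≡ nth x k
nth-++ˡ (y ∷ x) l zero    h       = refl
nth-++ˡ (y ∷ x) l (suc k) (s≤s h) = nth-++ˡ x l k h

nth-++ʳ : ∀ (x l : Bits) k → nth (x ++ l) (length x + k) ≡ nth l k
nth-++ʳ []      l k = refl
nth-++ʳ (y ∷ x) l k = nth-++ʳ x l k

nth-toList : ∀ {n} (x : Vec Bool n) (v : Fin n) → nth (toList x) (toℕ v) ≡ lookup x v
nth-toList (y Vec.∷ x) Fin.zero    = refl
nth-toList (y Vec.∷ x) (Fin.suc v) = nth-toList x v

frameSteps : Bits → ℕ → Frame → Frame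
frameSteps w zero    s = s
frameSteps w (suc k) s = frameSteps w k (frameStep w s)

frameSteps-+ : ∀ w j k s → frameSteps w (j + k) s ≡ frameSteps w k (frameSteps w j s)
frameSteps-+ w zero    k s = refl
frameSteps-+ w (suc j) k s = frameSteps-+ w j k (frameStep w s)

frameSteps-halt : ∀ w k st mem → frameSteps w k (st , mem , []) ≡ (st , mem , [])
frameSteps-halt w zero    st mem = refl
frameSteps-halt w (suc k) st mem = frameSteps-halt w k st mem

foldl-frameSteps : ∀ w (d : Bits) s → foldl (λ s _ → frameStep w s) s d ≡ frameSteps w (length d) s
foldl-frameSteps w []      s = refl
foldl-frameSteps w (_ ∷ d) s = foldl-frameSteps w d (frameStep w s)

table : (Bool → Bool → Bool) → Bits
table f = f false false ∷ f false true ∷ f true false ∷ f true true ∷ []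

sel-table : ∀ f x y → sel (table f) (y ∷ x ∷ []) ≡ f x y
sel-table f false false = refl
sel-table f false true  = refl
sel-table f true  false = refl
sel-table f true  true  = refl

position : ℕ → List ℕ → Maybe ℕ
position k [] = nothing
position k (j ∷ vs) with k ≟ j
... | yes _ = just 0
... | no  _ with position k vs
...   | just p  = just (suc p)
...   | nothing = nothing

nth-position : ∀ (ρ : ℕ → Bool) k vs {p} → position k vs ≡ just p → nth (map ρ vs) p ≡ ρ k × suc p ≤ length vs
nth-position ρ k (j ∷ vs) e with k ≟ j
nth-position ρ k (j ∷ vs) refl | yes refl = refl , s≤s z≤n
... | no _ with position k vs in e′
nth-position ρ k (j ∷ vs) refl | no _ | just p with nth-position ρ k vs e′
... | a , b = a , s≤s b

absent : Maybe ℕ → ℕ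
absent nothing  = 1
absent (just _) = 0

-- The number of gates below s that have not been evaluated yet.
missing : ℕ → List ℕ → ℕ
missing zero    vs = 0
missing (suc s) vs = absent (position s vs) + missing s vs

missing-[] : ∀ s → missing s [] ≡ s
missing-[] zero    = refl
missing-[] (suc s) = cong suc (missing-[] s)

absent-snoc-≢ : ∀ i k vs → ¬ i ≡ k → absent (position i (vs ++ k ∷ [])) ≡ absent (position i vs)
absent-snoc-≢ i k [] ne with i ≟ k
... | yes e = ⊥-elim (ne e)
... | no  _ = refl
absent-snoc-≢ i k (j ∷ vs) ne with i ≟ j
... | yes _ = refl
... | no  _ with position i (vs ++ k ∷ []) | position i vs | absent-snoc-≢ i k vs ne
...   | just _  | just _  | _ = refl
...   | nothing | nothing | _ = refl

absent-snoc : ∀ k vs → absent (position k (vs ++ k ∷ [])) ≡ 0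
absent-snoc k [] with k ≟ k
... | yes _ = refl
... | no ne = ⊥-elim (ne refl)
absent-snoc k (j ∷ vs) with k ≟ j
... | yes _ = refl
... | no  _ with position k (vs ++ k ∷ []) | absent-snoc k vs
...   | just _ | _ = refl

missing-snoc-≥ : ∀ s k vs → s ≤ k → missing s (vs ++ k ∷ []) ≡ missing s vs
missing-snoc-≥ zero    k vs le = refl
missing-snoc-≥ (suc s) k vs le = cong₂ _+_ (absent-snoc-≢ s k vs (<⇒≢ le)) (missing-snoc-≥ s k vs (<⇒≤ le))

missing-snoc : ∀ s k vs → suc k ≤ s → position k vs ≡ nothing → suc (missing s (vs ++ k ∷ [])) ≡ missing s vs
missing-snoc (suc s) k vs (s≤s le) e with s ≟ k
... | yes refl rewrite absent-snoc k vs | e = cong suc (missing-snoc-≥ s k vs ≤-refl)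
... | no ne rewrite absent-snoc-≢ s k vs ne =
  trans (sym (+-suc (absent (position s vs)) _)) (cong (absent (position s vs) +_) (missing-snoc s k vs (≤∧≢⇒< le (ne ∘ sym)) e))

absent-nothing : ∀ {m} → absent m ≡ 1 → m ≡ nothing
absent-nothing {nothing} _ = refl

-- Naming gate values by number describes the memory uniformly while the recursion passes to
-- prefixes of the circuit, where wire indices shift.
Agree : ∀ {n k} → (Vec Bool n → ℕ → Bool) → Gates n k → Set
Agree ρ []             = ⊤
Agree ρ (_▷_ {k} gs g) = Agree ρ gs × (∀ x → ρ x k ≡ lookup (wires (gs ▷ g) x) Fin.zero)

module Compile {n : ℕ} (s w : ℕ) (W : Bits) (W-length : length W ≡ w) (fits : n + s ≤ 2 ^ w)
               (ρ : Vec Bool n → ℕ → Bool) where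

  memory : Vec Bool n → List ℕ → Bits
  memory x vs = toList x ++ map (ρ x) vs

  -- A gate pops two bits and pushes one, so pushed addresses outnumber the newly evaluated gates by
  -- one. With w + 1 bits per address and 5 per gate the length is w + 1 plus w + 6 for each new
  -- gate, the equation of `program-length`. `fresh` ensures that a gate is not evaluated while its
  -- inputs are, so none is counted twice and `accounted` keeps the count below `s`.
  record Compiled (k : ℕ) (val : Vec Bool n → Bool) (vs : List ℕ) : Set where
    field
      steps : ℕ
      program  : Bits
      vs′   : List ℕ
      correct : ∀ x st p → frameSteps W steps (st , memory x vs , program ++ p) ≡ (val x ∷ st , memory x vs′ , p)
      program-length  : length program + length vs * (w + 6) ≡ suc w + length vs′ * (w + 6)
      steps≤program   : steps ≤ length program
      accounted    : length vs′ + missing s vs′ ≡ s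
      fresh        : ∀ i → k ≤ i → position i vs ≡ nothing → position i vs′ ≡ nothing

  open Compiled

  weaken : ∀ {k val vs} → Compiled k val vs → Compiled (suc k) val vs
  weaken C = record
    { steps = steps C ; program = program C ; vs′ = vs′ C ; correct = correct C ; program-length = program-length C
    ; steps≤program = steps≤program C ; accounted = accounted C ; fresh = λ i le → fresh C i (≤-trans (n≤1+n _) le) }

  pushAddress : ∀ {k val vs} a → suc a ≤ 2 ^ w → (∀ x → nth (memory x vs) a ≡ val x) → length vs + missing s vs ≡ s → Compiled k val vs
  pushAddress {val = val} {vs} a a< ok acc = record
    { steps = 1 ; program = false ∷ i ; vs′ = vs
    ; correct = λ x st p → cong₂ (λ b p → b ∷ st , memory x vs , p)
        (trans (cong (sel (memory x vs)) (fit-++ W i p i-length)) (trans (sel-nth (memory x vs) i) (trans (cong (nth (memory x vs)) i-number) (ok x))))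
        (drop-++-length W i p i-length)
    ; program-length = cong (λ t → suc t + length vs * (w + 6)) (trans i-length W-length)
    ; steps≤program = s≤s z≤n
    ; accounted = acc
    ; fresh = λ _ _ e → e }
    where
    addr = address w a a<
    i = proj₁ addr
    i-length : length i ≡ length W
    i-length = trans (proj₁ (proj₂ addr)) (sym W-length)
    i-number = proj₂ (proj₂ addr)

  -- Depth-first evaluation with sharing: a gate met for the first time is computed from its inputs
  -- and remembered, a gate met again is fetched by address. The memory holds the n inputs followed
  -- by the results in the order of `vs`, hence the address `n + p`.
  compileWire : ∀ {k} (gs : Gates n k) → k ≤ s → Agree ρ gs → ∀ v vs → length vs + missing s vs ≡ s →
                Compiled k (λ x → lookup (wires gs x) v) vs
  compileWire [] k≤s ag v vs acc = pushAddress (toℕ v) (≤-trans (toℕ<n v) (≤-trans (m≤m+n n s) fits))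
    (λ x → trans (nth-++ˡ (toList x) _ (toℕ v) (≤-trans (toℕ<n v) (≤-reflexive (sym (length-toList x))))) (nth-toList x v)) acc
  compileWire (gs ▷ g) k≤s ag (Fin.suc v) vs acc = weaken (compileWire gs (≤-trans (n≤1+n _) k≤s) (proj₁ ag) v vs acc)
  compileWire (_▷_ {k} gs (f , i , j)) k≤s ag Fin.zero vs acc with position k vs in e
  ... | just p = pushAddress (n + p)
      (≤-trans (≤-reflexive (sym (+-suc n p))) (≤-trans (+-monoʳ-≤ n (≤-trans (proj₂ (nth-position (const false) k vs e)) (≤-trans (m≤m+n _ _) (≤-reflexive acc)))) fits))
      (λ x → trans (cong (λ t → nth (memory x vs) (t + p)) (sym (length-toList x)))
        (trans (nth-++ʳ (toList x) (map (ρ x) vs) p) (trans (proj₁ (nth-position (ρ x) k vs e)) (proj₂ ag x)))) acc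
  ... | nothing = record
      { steps = steps A + (steps B + 1) ; program = program A ++ program B ++ true ∷ table f ; vs′ = vs′ B ++ k ∷ []
      ; correct = ok
      ; program-length = len
      ; steps≤program = ≤-trans (+-mono-≤ (steps≤program A) (+-mono-≤ (steps≤program B) (s≤s z≤n)))
          (≤-reflexive (sym (trans (length-++ (program A)) (cong (length (program A) +_) (length-++ (program B))))))
      ; accounted = acc′
      ; fresh = λ i k<i e′ → absent-nothing (trans (absent-snoc-≢ i k (vs′ B) (<⇒≢ k<i ∘ sym))
          (cong absent (fresh B i (<⇒≤ k<i) (fresh A i (<⇒≤ k<i) e′)))) }
    where
    A = compileWire gs (≤-trans (n≤1+n _) k≤s) (proj₁ ag) i vs acc
    B = compileWire gs (≤-trans (n≤1+n _) k≤s) (proj₁ ag) j (vs′ A) (accounted A)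
    ok : ∀ x st p → frameSteps W (steps A + (steps B + 1)) (st , memory x vs , (program A ++ program B ++ true ∷ table f) ++ p)
           ≡ (lookup (wires (gs ▷ (f , i , j)) x) Fin.zero ∷ st , memory x (vs′ B ++ k ∷ []) , p)
    ok x st p = trans (cong (λ c → frameSteps W (steps A + (steps B + 1)) (st , memory x vs , c))
          (trans (++-assoc (program A) _ p) (cong (program A ++_) (++-assoc (program B) (true ∷ table f) p))))
      (trans (frameSteps-+ W (steps A) (steps B + 1) _) (trans (cong (frameSteps W (steps B + 1)) (correct A x st _))
      (trans (frameSteps-+ W (steps B) 1 _) (trans (cong (frameSteps W 1) (correct B x _ _))
      (cong₂ (λ b m → b ∷ st , m , p) (sel-table f _ _)
        (trans (cong (λ b → memory x (vs′ B) ++ b ∷ []) (trans (sel-table f _ _) (sym (proj₂ ag x))))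
          (trans (++-assoc (toList x) (map (ρ x) (vs′ B)) (ρ x k ∷ [])) (cong (toList x ++_) (sym (map-++ (ρ x) (vs′ B) (k ∷ [])))))))))))
    arith : ∀ a b v v₁ v₂ w → a + v * (w + 6) ≡ suc w + v₁ * (w + 6) → b + v₁ * (w + 6) ≡ suc w + v₂ * (w + 6) →
            a + (b + 5) + v * (w + 6) ≡ suc w + (v₂ + 1) * (w + 6)
    arith a b v v₁ v₂ w p q = +-cancelʳ-≡ (v₁ * (w + 6)) _ _
      (trans (e₁ a b (v * (w + 6)) (v₁ * (w + 6))) (trans (cong₂ (λ s t → s + t + 5) p q) (e₂ w v₁ v₂)))
      where
      e₁ : ∀ a b V V₁ → a + (b + 5) + V + V₁ ≡ (a + V) + (b + V₁) + 5
      e₁ = solve-∀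
      e₂ : ∀ w v₁ v₂ → (suc w + v₁ * (w + 6)) + (suc w + v₂ * (w + 6)) + 5 ≡ suc w + (v₂ + 1) * (w + 6) + v₁ * (w + 6)
      e₂ = solve-∀
    len : length (program A ++ program B ++ true ∷ table f) + length vs * (w + 6) ≡ suc w + length (vs′ B ++ k ∷ []) * (w + 6)
    len = trans (cong (_+ length vs * (w + 6)) (trans (length-++ (program A)) (cong (length (program A) +_) (length-++ (program B)))))
      (trans (arith (length (program A)) (length (program B)) (length vs) (length (vs′ A)) (length (vs′ B)) w (program-length A) (program-length B))
        (cong (λ t → suc w + t * (w + 6)) (sym (length-++ (vs′ B)))))
    acc′ : length (vs′ B ++ k ∷ []) + missing s (vs′ B ++ k ∷ []) ≡ s
    acc′ = trans (cong (_+ missing s (vs′ B ++ k ∷ [])) (trans (length-++ (vs′ B)) (+-comm (length (vs′ B)) 1)))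
      (trans (sym (+-suc (length (vs′ B)) _))
      (trans (cong (length (vs′ B) +_) (missing-snoc s k (vs′ B) k≤s (fresh B k ≤-refl (fresh A k ≤-refl e)))) (accounted B)))

gateValue : ∀ {n s} → Gates n s → Vec Bool n → ℕ → Bool
gateValue [] x k = false
gateValue (_▷_ {s} gs g) x k with k ≟ s
... | yes _ = lookup (wires (gs ▷ g) x) Fin.zero
... | no  _ = gateValue gs x k

agree-cong : ∀ {n k} {ρ ρ′ : Vec Bool n → ℕ → Bool} (gs : Gates n k) → (∀ x i → suc i ≤ k → ρ x i ≡ ρ′ x i) →
             Agree ρ gs → Agree ρ′ gs
agree-cong []       h ag        = tt
agree-cong (gs ▷ g) h (ag , ok) = agree-cong gs (λ x i le → h x i (≤-trans le (n≤1+n _))) ag , λ x → trans (sym (h x _ ≤-refl)) (ok x)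

gateValue-agree : ∀ {n k} (gs : Gates n k) → Agree (gateValue gs) gs
gateValue-agree [] = tt
gateValue-agree (_▷_ {k} gs g) = agree-cong gs below (gateValue-agree gs) , here
  where
  below : ∀ x i → suc i ≤ k → gateValue gs x i ≡ gateValue (gs ▷ g) x i
  below x i le with i ≟ k
  ... | yes refl = ⊥-elim (<-irrefl refl le)
  ... | no _ = refl
  here : ∀ x → gateValue (gs ▷ g) x k ≡ lookup (wires (gs ▷ g) x) Fin.zero
  here x with k ≟ k
  ... | yes _ = refl
  ... | no ne = ⊥-elim (ne refl)

-- Header, one address and s gates give the bound; leading zeros fill up to exactly m bits. With w ≥
-- 1 the header starts with a 1, which marks the end of the padding.
circuit-program : ∀ {n s} w (C : Circuit n s) → n + s ≤ 2 ^ w → ∀ m → suc w + (suc w + s * (w + 6)) ≤ m → 1 ≤ w →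
  Σ Bits λ d → length d ≡ m × (∀ x → runProgram d (toList x) ≡ eval C x)
circuit-program {n} {s} w (gs , o) fits m le 1≤w = d , d-length , ok
  where
  W : Bits
  W = replicate w true
  open Compile {n} s w W (length-replicate w) fits (gateValue gs)
  P = compileWire gs ≤-refl (gateValue-agree gs) o [] (missing-[] s)
  open Compiled P
  program≤ : length program ≤ suc w + s * (w + 6)
  program≤ = ≤-trans (≤-reflexive (trans (sym (+-identityʳ (length program))) program-length))
    (+-monoʳ-≤ (suc w) (*-monoˡ-≤ (w + 6) (≤-trans (m≤m+n (length vs′) _) (≤-reflexive accounted))))
  body = W ++ false ∷ program
  body-length : length body ≡ suc w + length program
  body-length = trans (length-++ W) (trans (cong (_+ suc (length program)) (length-replicate w)) (+-suc w (length program)))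
  pad = m ∸ length body
  d = replicate pad false ++ body
  d-length : length d ≡ m
  d-length = trans (length-++ (replicate pad false)) (trans (cong (_+ length body) (length-replicate pad))
    (m∸n+n≡m (≤-trans (≤-reflexive body-length) (≤-trans (+-monoʳ-≤ (suc w) program≤) le))))
  skip-zeros : ∀ k → drop (length (zeros (replicate k false ++ body))) (replicate k false ++ body) ≡ body
  skip-zeros (suc k) = skip-zeros k
  skip-zeros zero = none w 1≤w
    where
    none : ∀ w → 1 ≤ w → drop (length (zeros (replicate w true ++ false ∷ program))) (replicate w true ++ false ∷ program) ≡ replicate w true ++ false ∷ program
    none (suc w) _ = refl
  ones-body : ∀ w → ones (replicate w true ++ false ∷ program) ≡ replicate w true
  ones-body zero    = refl
  ones-body (suc w) = cong (true ∷_) (ones-body w)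
  ok : ∀ x → runProgram d (toList x) ≡ lookup (wires gs x) o
  ok x = trans (cong (λ b → headᵇ (proj₁ (foldl (λ s _ → frameStep (ones b) s) ([] , toList x , tailᵇ (drop (length (ones b)) b)) d))) (skip-zeros pad))
    (trans (cong (λ v → headᵇ (proj₁ (foldl (λ s _ → frameStep v s) ([] , toList x , tailᵇ (drop (length v) body)) d))) (ones-body w))
    (trans (cong (λ c → headᵇ (proj₁ (foldl (λ s _ → frameStep W s) ([] , toList x , tailᵇ c) d))) (drop-++-length W W (false ∷ program) refl))
    (trans (cong (headᵇ ∘ proj₁) (foldl-frameSteps W d ([] , toList x , program)))
    (cong (headᵇ ∘ proj₁) final))))
    where
    steps≤ : steps ≤ length d
    steps≤ = ≤-trans steps≤program (≤-trans (≤-trans (m≤n+m (length program) (suc w)) (≤-reflexive (sym body-length)))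
      (≤-trans (m≤n+m (length body) (length (replicate pad false))) (≤-reflexive (sym (length-++ (replicate pad false))))))
    final : frameSteps W (length d) ([] , toList x , program) ≡ (lookup (wires gs x) o ∷ [] , memory x vs′ , [])
    final = trans (cong (λ k → frameSteps W k ([] , toList x , program)) (sym (m+[n∸m]≡n steps≤)))
      (trans (frameSteps-+ W steps (length d ∸ steps) _)
      (trans (cong (frameSteps W (length d ∸ steps)) (trans
          (cong₂ (λ m c → frameSteps W steps ([] , m , c)) (sym (++-identityʳ (toList x))) (sym (++-identityʳ program))) (correct x [] [])))
        (frameSteps-halt W (length d ∸ steps) _ _)))

-- Counting

log₂ : ∀ n → 1 ≤ n → Σ ℕ λ ℓ → 2 ^ ℓ ≤ n × suc n ≤ 2 ^ suc ℓ
log₂ (suc zero) _ = 0 , ≤-refl , ≤-refl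
log₂ (suc (suc n)) _ with log₂ (suc n) (s≤s z≤n)
... | ℓ , lo , hi with m≤n⇒m<n∨m≡n hi
...   | inj₁ h = ℓ , ≤-trans lo (n≤1+n _) , h
...   | inj₂ e = suc ℓ , ≤-reflexive (sym e) , ≤-trans (≤-trans (s≤s (≤-reflexive e)) (+-monoˡ-≤ (2 ^ suc ℓ) (m^n>0 2 (suc ℓ))))
                   (≤-reflexive (cong (2 ^ suc ℓ +_) (sym (+-identityʳ _))))

2^-cancel-≤ : ∀ {a b} → 2 ^ a ≤ 2 ^ b → a ≤ b
2^-cancel-≤ h = ≮⇒≥ λ b<a → <-irrefl refl (≤-trans (^-monoʳ-< 2 (s≤s (s≤s z≤n)) b<a) h)

3k+21≤2^[5+k] : ∀ k → 3 * (5 + k) + 6 ≤ 2 ^ (5 + k)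
3k+21≤2^[5+k] zero    = ≤-trans (m≤m+n 21 11) ≤-refl
3k+21≤2^[5+k] (suc k) = begin
  3 * (5 + suc k) + 6                        ≤⟨ m≤m+n _ (18 + 3 * k) ⟩
  3 * (5 + suc k) + 6 + (18 + 3 * k)         ≡⟨ eq k ⟩
  2 * (3 * (5 + k) + 6)                      ≤⟨ *-monoʳ-≤ 2 (3k+21≤2^[5+k] k) ⟩
  2 ^ (5 + suc k)                            ∎
  where
  open ≤-Reasoning
  eq : ∀ k → 3 * (5 + suc k) + 6 + (18 + 3 * k) ≡ 2 * (3 * (5 + k) + 6)
  eq = solve-∀

-- Here α ≤ p/q < 1 and ℓ = ⌊log₂ n⌋; the gain s·(n − ℓ) over s·n beats the constants
-- because s ≤ (2ⁿ/n)(1 + p(ℓ+1)/(qn)) and (q − p)ℓ exceeds 8q + p.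
module Width {n s p q ℓ : ℕ} (lo : 2 ^ ℓ ≤ n) (hi : suc n ≤ 2 ^ suc ℓ) (p<q : suc p ≤ q) (large : 8 * q + p + 1 ≤ ℓ)
             (small : q * (n * n) * s ≤ q * n * 2 ^ n + suc ℓ * (p * 2 ^ n)) where

  open ≤-Reasoning

  private
    N r : ℕ
    N = 2 ^ n
    r = n ∸ ℓ

    1≤q : 1 ≤ q
    1≤q = ≤-trans (s≤s z≤n) p<q

    9≤ℓ : 9 ≤ ℓ
    9≤ℓ = ≤-trans (+-monoˡ-≤ 1 (≤-trans (*-monoʳ-≤ 8 1≤q) (m≤m+n (8 * q) p))) large

    3ℓ+6≤n : 3 * ℓ + 6 ≤ n
    3ℓ+6≤n = ≤-trans (subst (λ ℓ → 3 * ℓ + 6 ≤ 2 ^ ℓ) (m+[n∸m]≡n (≤-trans (m≤m+n 5 4) 9≤ℓ)) (3k+21≤2^[5+k] (ℓ ∸ 5))) lo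

    ℓ+ℓ≤n : ℓ + ℓ ≤ n
    ℓ+ℓ≤n = ≤-trans (≤-trans (m≤m+n (ℓ + ℓ) (ℓ + 6)) (≤-reflexive (eq ℓ))) 3ℓ+6≤n
      where
      eq : ∀ l → l + l + (l + 6) ≡ 3 * l + 6
      eq = solve-∀

    ℓ≤n : ℓ ≤ n
    ℓ≤n = ≤-trans (m≤m+n ℓ ℓ) ℓ+ℓ≤n

    n≡ : ℓ + r ≡ n
    n≡ = m+[n∸m]≡n ℓ≤n

    ℓ≤r : ℓ ≤ r
    ℓ≤r = +-cancelˡ-≤ ℓ ℓ r (≤-trans ℓ+ℓ≤n (≤-reflexive (sym n≡)))

    1≤n : 1 ≤ n
    1≤n = ≤-trans (m^n>0 2 ℓ) lo

    instance
      q≢0 : NonZero q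
      q≢0 = >-nonZero 1≤q
      n≢0 : NonZero n
      n≢0 = >-nonZero 1≤n
      qn≢0 : NonZero (q * n)
      qn≢0 = m*n≢0 q n
      qnn≢0 : NonZero (q * (n * n))
      qnn≢0 = m*n≢0 q (n * n) ⦃ q≢0 ⦄ ⦃ m*n≢0 n n ⦄
      2^ℓ≢0 : NonZero (2 ^ ℓ)
      2^ℓ≢0 = m^n≢0 2 ℓ

    -- Here r + 8 is the price of a gate, 6 more than the width r + 2. Since n = r + ℓ, the claim
    -- amounts to 8q + p + 1 ≤ (q - p)ℓ, and q - p ≥ 1 reduces it to `large`.
    key : q * (r + 8) + p * suc ℓ + 1 ≤ q * n
    key = begin
      q * (r + 8) + p * suc ℓ + 1               ≡⟨ eq₁ q r p ℓ ⟩
      q * r + (p * ℓ + (8 * q + p + 1))         ≤⟨ +-monoʳ-≤ (q * r) (+-monoʳ-≤ (p * ℓ) large) ⟩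
      q * r + (p * ℓ + ℓ)                       ≡⟨ cong (q * r +_) (+-comm (p * ℓ) ℓ) ⟩
      q * r + suc p * ℓ                         ≤⟨ +-monoʳ-≤ (q * r) (*-monoˡ-≤ ℓ p<q) ⟩
      q * r + q * ℓ                             ≡⟨ sym (*-distribˡ-+ q r ℓ) ⟩
      q * (r + ℓ)                               ≡⟨ cong (q *_) (trans (+-comm r ℓ) n≡) ⟩
      q * n                                     ∎
      where
      eq₁ : ∀ q r p l → q * (r + 8) + p * suc l + 1 ≡ q * r + (p * l + (8 * q + p + 1))
      eq₁ = solve-∀

    -- A crude factor 2 suffices, because it only fixes the address width and costs one bit there.
    ns≤2N : n * s ≤ 2 * N
    ns≤2N = *-cancelˡ-≤ (q * n) (begin
      q * n * (n * s)                           ≡⟨ eq₁ q n s ⟩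
      q * (n * n) * s                           ≤⟨ small ⟩
      q * n * N + suc ℓ * (p * N)               ≡⟨ cong (q * n * N +_) (eq₂ (suc ℓ) p N) ⟩
      q * n * N + p * suc ℓ * N                 ≤⟨ +-monoʳ-≤ (q * n * N) (*-monoˡ-≤ N (≤-trans (≤-trans (m≤n+m (p * suc ℓ) (q * (r + 8))) (m≤m+n _ 1)) key)) ⟩
      q * n * N + q * n * N                     ≡⟨ eq₃ (q * n) N ⟩
      q * n * (2 * N)                           ∎)
      where
      eq₁ : ∀ q n s → q * n * (n * s) ≡ q * (n * n) * s
      eq₁ = solve-∀
      eq₂ : ∀ l p N → l * (p * N) ≡ p * l * N
      eq₂ = solve-∀
      eq₃ : ∀ a N → a * N + a * N ≡ a * (2 * N)
      eq₃ = solve-∀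

    s≤ : s ≤ 2 ^ suc r
    s≤ = *-cancelˡ-≤ (2 ^ ℓ) (begin
      2 ^ ℓ * s                                 ≤⟨ *-monoˡ-≤ s lo ⟩
      n * s                                     ≤⟨ ns≤2N ⟩
      2 ^ suc n                                 ≡⟨ cong (λ k → 2 ^ suc k) (sym n≡) ⟩
      2 ^ suc (ℓ + r)                           ≡⟨ cong (2 ^_) (sym (+-suc ℓ r)) ⟩
      2 ^ (ℓ + suc r)                           ≡⟨ ^-distribˡ-+-* 2 ℓ (suc r) ⟩
      2 ^ ℓ * 2 ^ suc r                         ∎)

    n≤ : n ≤ 2 ^ suc ℓ
    n≤ = ≤-trans (n≤1+n n) hi

    -- 2r + 7 collects the header, the first address and the one bit that separates N - 1 from N.
    -- After q ≤ n the comparison is 2n³ ≤ 2ⁿ, and n ≤ 2^(ℓ + 1) turns this into 3ℓ + 4 ≤ n.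
    header≤ : q * (n * n) * (2 * r + 7) ≤ N * n
    header≤ = begin
      q * (n * n) * (2 * r + 7)                 ≤⟨ *-mono-≤ (*-monoˡ-≤ (n * n) q≤n) 2r+7≤ ⟩
      n * (n * n) * (2 * n)                     ≡⟨ eq₁ n ⟩
      2 * (n * (n * n)) * n                     ≤⟨ *-monoˡ-≤ n (*-monoʳ-≤ 2 (*-mono-≤ n≤ (*-mono-≤ n≤ n≤))) ⟩
      2 * (M * (M * M)) * n                     ≡⟨ cong (_* n) pow ⟩
      2 ^ (1 + (suc ℓ + (suc ℓ + suc ℓ))) * n   ≤⟨ *-monoˡ-≤ n (^-monoʳ-≤ 2 (≤-trans (≤-trans (m≤m+n (1 + (suc ℓ + (suc ℓ + suc ℓ))) 2) (≤-reflexive (eq₂ ℓ))) 3ℓ+6≤n)) ⟩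
      N * n                                     ∎
      where
      M = 2 ^ suc ℓ
      q≤n : q ≤ n
      q≤n = ≤-trans (≤-trans (≤-trans (m≤n*m q 8) (≤-trans (m≤m+n _ p) (m≤m+n _ 1))) large) ℓ≤n
      2r+7≤ : 2 * r + 7 ≤ 2 * n
      2r+7≤ = begin
        2 * r + 7      ≤⟨ +-monoʳ-≤ (2 * r) (≤-trans (≤-trans (m≤m+n 7 11) (≤-reflexive refl)) (*-monoʳ-≤ 2 9≤ℓ)) ⟩
        2 * r + 2 * ℓ  ≡⟨ sym (*-distribˡ-+ 2 r ℓ) ⟩
        2 * (r + ℓ)    ≡⟨ cong (2 *_) (trans (+-comm r ℓ) n≡) ⟩
        2 * n          ∎
      eq₁ : ∀ n → n * (n * n) * (2 * n) ≡ 2 * (n * (n * n)) * n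
      eq₁ = solve-∀
      eq₂ : ∀ l → 1 + (suc l + (suc l + suc l)) + 2 ≡ 3 * l + 6
      eq₂ = solve-∀
      pow : 2 * (M * (M * M)) ≡ 2 ^ (1 + (suc ℓ + (suc ℓ + suc ℓ)))
      pow = cong (2 *_) (sym (trans (^-distribˡ-+-* 2 (suc ℓ) (suc ℓ + suc ℓ)) (cong (M *_) (^-distribˡ-+-* 2 (suc ℓ) (suc ℓ)))))

    r+8≤n : r + 8 ≤ n
    r+8≤n = ≤-trans (+-monoʳ-≤ r (≤-trans (n≤1+n 8) 9≤ℓ)) (≤-reflexive (trans (+-comm r ℓ) n≡))

    -- The summand 1 in `key` becomes the spare N · n that pays for `header≤`.
    body≤ : q * (n * n) * s * (r + 8) + N * n ≤ q * (n * n) * N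
    body≤ = begin
      q * (n * n) * s * (r + 8) + N * n                      ≤⟨ +-monoˡ-≤ (N * n) (*-monoˡ-≤ (r + 8) small) ⟩
      (q * n * N + suc ℓ * (p * N)) * (r + 8) + N * n        ≡⟨ eq₁ q n N (suc ℓ) p (r + 8) ⟩
      q * n * N * (r + 8) + p * suc ℓ * N * (r + 8) + N * n  ≤⟨ +-monoˡ-≤ (N * n) (+-monoʳ-≤ (q * n * N * (r + 8)) (*-monoʳ-≤ (p * suc ℓ * N) r+8≤n)) ⟩
      q * n * N * (r + 8) + p * suc ℓ * N * n + N * n        ≡⟨ eq₂ q n N (p * suc ℓ) (r + 8) ⟩
      N * n * (q * (r + 8) + p * suc ℓ + 1)                  ≤⟨ *-monoʳ-≤ (N * n) key ⟩
      N * n * (q * n)                                        ≡⟨ eq₃ N n q ⟩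
      q * (n * n) * N                                        ∎
      where
      eq₁ : ∀ q n N l p d → (q * n * N + l * (p * N)) * d + N * n ≡ q * n * N * d + p * l * N * d + N * n
      eq₁ = solve-∀
      eq₂ : ∀ q n N a d → q * n * N * d + a * N * n + N * n ≡ N * n * (q * d + a + 1)
      eq₂ = solve-∀
      eq₃ : ∀ N n q → N * n * (q * n) ≡ q * (n * n) * N
      eq₃ = solve-∀

  width : ℕ
  width = r + 2

  1≤width : 1 ≤ width
  1≤width = ≤-trans (s≤s z≤n) (m≤n+m 2 r)

  wires≤ : n + s ≤ 2 ^ width
  wires≤ = begin
    n + s                    ≤⟨ +-mono-≤ (≤-trans n≤ (^-monoʳ-≤ 2 (s≤s ℓ≤r))) s≤ ⟩
    2 ^ suc r + 2 ^ suc r    ≡⟨ cong (2 ^ suc r +_) (sym (+-identityʳ _)) ⟩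
    2 ^ suc (suc r)          ≡⟨ cong (2 ^_) (+-comm 2 r) ⟩
    2 ^ width                ∎

  program≤ : suc (suc width + (suc width + s * (width + 6))) ≤ 2 ^ n
  program≤ = *-cancelˡ-≤ (q * (n * n)) (begin
    q * (n * n) * suc (suc width + (suc width + s * (width + 6)))  ≡⟨ eq (q * (n * n)) r s ⟩
    q * (n * n) * s * (r + 8) + q * (n * n) * (2 * r + 7)          ≤⟨ +-monoʳ-≤ _ header≤ ⟩
    q * (n * n) * s * (r + 8) + N * n                              ≤⟨ body≤ ⟩
    q * (n * n) * N                                                ∎)
    where
    eq : ∀ a r s → a * suc (suc (r + 2) + (suc (r + 2) + s * (r + 2 + 6))) ≡ a * s * (r + 8) + a * (2 * r + 7)
    eq = solve-∀

-- For negative α the bound is relaxed to α = 0 by dropping a factor that is at least 1; for the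
-- rest log₂ n is rounded up to ℓ + 1.
withinBound-linear : ∀ α {n s ℓ} → 1 ≤ n → suc n ≤ 2 ^ suc ℓ → WithinBound α n s →
  ↧ₙ α * (n * n) * s ≤ ↧ₙ α * n * 2 ^ n + suc ℓ * (pos (↥ α) * 2 ^ n)
withinBound-linear α {n} {s} {ℓ} 1≤n hi wb = 2^-cancel-≤ (begin
  2 ^ A                                         ≤⟨ m≤m*n (2 ^ A) (n ^ (neg (↥ α) * 2 ^ n)) ⦃ m^n≢0 n (neg (↥ α) * 2 ^ n) ⦃ >-nonZero 1≤n ⦄ ⦄ ⟩
  2 ^ A * n ^ (neg (↥ α) * 2 ^ n)               ≤⟨ wb ⟩
  2 ^ B * n ^ P                                 ≤⟨ *-monoʳ-≤ (2 ^ B) (^-monoˡ-≤ P (≤-trans (n≤1+n n) hi)) ⟩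
  2 ^ B * (2 ^ suc ℓ) ^ P                       ≡⟨ cong (2 ^ B *_) (^-*-assoc 2 (suc ℓ) P) ⟩
  2 ^ B * 2 ^ (suc ℓ * P)                       ≡⟨ sym (^-distribˡ-+-* 2 B (suc ℓ * P)) ⟩
  2 ^ (B + suc ℓ * P)                           ∎)
  where
  open ≤-Reasoning
  A = ↧ₙ α * (n * n) * s
  B = ↧ₙ α * n * 2 ^ n
  P = pos (↥ α) * 2 ^ n

pos-<-denominator : ∀ α → α < 1ℚ → suc (pos (↥ α)) ≤ ↧ₙ α
pos-<-denominator (mkℚ (ℤ.+ k) d _)    (*<* h) = ℤ.drop‿+<+
  (subst₂ ℤ._<_ (ℤ.*-identityʳ (ℤ.+ k)) (ℤ.*-identityˡ (ℤ.+ suc d)) h)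
pos-<-denominator (mkℚ -[1+ k ] d _)   _               = s≤s z≤n

program-hardLanguage : ∀ {n} d (f : Vec Bool n → Bool) → (∀ x → runProgram d (toList x) ≡ f x) →
  (∀ x → f x ≡ hardLanguage (toList x)) → ∀ x → length x ≡ n → runProgram d x ≡ sel (At.hard n) x
program-hardLanguage d f computes agrees x refl = trans (cong (runProgram d) (sym (toList∘fromList x)))
  (trans (computes (fromList x)) (trans (agrees (fromList x)) (cong hardLanguage (toList∘fromList x))))

hardLanguage-hard : ∀ α → α < 1ℚ → ¬ InSIZEio α hardLanguage
hardLanguage-hard α α<1 io = At.hard-avoids n d (trans (cong suc d-length) (trans suc-pred-N (sym (At.N≡ n)))) tt≡
  where
  q p k : ℕ
  q = ↧ₙ α
  p = pos (↥ α)
  -- The threshold that `Width` demands of ⌊log₂ n⌋; a length above 2^k meets it.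
  k = 8 * q + p + 1
  n s : ℕ
  n = proj₁ (io (2 ^ k))
  1≤n : 1 ≤ n
  1≤n = ≤-trans (s≤s z≤n) (proj₁ (proj₂ (io (2 ^ k))))
  smallAt = proj₂ (proj₂ (io (2 ^ k)))
  s = proj₁ smallAt
  C = proj₁ (proj₂ (proj₂ smallAt))
  ℓΣ = log₂ n 1≤n
  ℓ = proj₁ ℓΣ
  hi : suc n ≤ 2 ^ suc ℓ
  hi = proj₂ (proj₂ ℓΣ)
  large : k ≤ ℓ
  large = ≮⇒≥ λ ℓ<k → <-irrefl refl (≤-trans (≤-trans (s≤s (≤-trans (n≤1+n _) (proj₁ (proj₂ (io (2 ^ k)))))) hi) (^-monoʳ-≤ 2 ℓ<k))
  open Width {n} {s} {p} {q} {ℓ} (proj₁ (proj₂ ℓΣ)) hi (pos-<-denominator α α<1) large (withinBound-linear α {n} {s} {ℓ} 1≤n hi (proj₁ (proj₂ smallAt)))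
  -- Exactly N - 1 bits, the part of an N-bit string that `link` reads as a program.
  prog = circuit-program width C wires≤ (pred (2 ^ n)) (pred-mono-≤ program≤) 1≤width
  d = proj₁ prog
  d-length = proj₁ (proj₂ prog)
  suc-pred-N : suc (pred (2 ^ n)) ≡ 2 ^ n
  suc-pred-N = suc-pred (2 ^ n) ⦃ m^n≢0 2 n ⦄
  tt≡ : At.truthTable n d ≡ At.hard n
  tt≡ = trans (cong (λ N → orbit (runProgram d) N (At.x₀ n)) (At.N≡ n))
    (trans (orbit-cong (2 ^ n) n (At.x₀ n) (length-replicate n)
      (program-hardLanguage d (eval C) (proj₂ (proj₂ prog)) (proj₂ (proj₂ (proj₂ smallAt))))) (orbit-sel n (At.hard n) (trans (At.length-hard n) (At.N≡ n))))

mainTheorem5 : (α : ℚ) → α < 1ℚ → Σ Language λ L → InS2E L × ¬ InSIZEio α L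
mainTheorem5 α α<1 = hardLanguage , hardLanguage-S2E , hardLanguage-hard α α<1
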